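{- Fix an integer $k$. There is an algorithm that, given a graph $G=(V,E)$ on $n$ vertices with $\operatorname{tw}(G)\le k$, constructs in $O(n)$ time a box representation of $G$ in dimension bounded by a constant depending only on $k$.
   Context: A $b$-dimensional box representation of $G$ assigns to each vertex $u$ an axis-parallel box $B_u=R_1(u)\times\cdots\times R_b(u)\subseteq\mathbb{R}^b$, with each $R_i(u)$ a closed interval, such that distinct $u,v$ are adjacent iff $B_u\cap B_v\neq\emptyset$. The treewidth $\operatorname{tw}(G)$ is the minimum, over all tree decompositions $(\{X_i\},T)$ of $G$ (a tree $T$ with vertex subsets $X_i$ at its nodes covering all vertices and all edges, such that for each vertex the nodes containing it form a connected subtree), of $\max_i|X_i|-1$. -}

module Defs where

open import Data.Bool using (Bool; false; T; if_then_else_; _∧_)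
open import Data.Fin using (Fin; toℕ)
open import Data.Fin.Subset using (Subset; ∣_∣) renaming (_∈_ to _∈ₛ_)
open import Data.Integer as ℤ using (ℤ; +_; 1ℤ)
open import Data.List using (List; []; _∷_; _∷ʳ_; length; map; concatMap; allFin)
open import Data.List.Extrema.Nat using (max)
open import Data.List.Membership.Propositional using (_∈_)
open import Data.List.Relation.Unary.Linked using (Linked)
open import Data.List.Relation.Unary.Unique.Propositional using (Unique)
open import Data.Nat using (ℕ; zero; suc; _+_; _*_; _∸_; _≤_; _<_; _≡ᵇ_)
open import Data.Product using (Σ; ∃-syntax; _×_; _,_)
open import Data.Rational as ℚ using (ℚ; 0ℚ)
open import Data.Rational.Properties using (+-inverseʳ)
open import Function.Bundles using (_⇔_)
open import Relation.Binary.Construct.Closure.ReflexiveTransitive using (Star)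
open import Relation.Binary.PropositionalEquality using (_≡_; _≢_; sym; subst)
open import Relation.Nullary using (¬_)

record Graph (n : ℕ) : Set where
  field
    edge        : Fin n → Fin n → Bool
    edge-sym    : ∀ u v → edge u v ≡ edge v u
    edge-irrefl : ∀ v → edge v v ≡ false

  Adj : Fin n → Fin n → Set
  Adj u v = T (edge u v)

module _ {n : ℕ} (G : Graph n) where
  open Graph G

  Connected : Set
  Connected = (0 < n) × (∀ u v → Star Adj u v)

  -- The vertices x ∷ xs, in cyclic order, form a cycle.
  IsCycle : Fin n → List (Fin n) → Set
  IsCycle x xs = (2 ≤ length xs) × Unique (x ∷ xs) × Linked Adj (x ∷ (xs ∷ʳ x))

  Acyclic : Set
  Acyclic = ∀ x xs → ¬ IsCycle x xs

  IsTree : Set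
  IsTree = Connected × Acyclic

  -- A walk from u to v all of whose vertices satisfy P, when u and v do.
  WalkInside : (Fin n → Set) → Fin n → Fin n → Set
  WalkInside P = Star (λ i j → Adj i j × P i × P j)

record TreeDecomposition {n : ℕ} (G : Graph n) : Set where
  open Graph G using (Adj)
  field
    nodes   : ℕ
    tree    : Graph nodes
    isTree  : IsTree tree
    bag     : Fin nodes → Subset n
    coversV : ∀ v → ∃[ i ] v ∈ₛ bag i
    coversE : ∀ u v → Adj u v → ∃[ i ] (u ∈ₛ bag i × v ∈ₛ bag i)
    subtree : ∀ v i j → v ∈ₛ bag i → v ∈ₛ bag j →
              WalkInside tree (λ l → v ∈ₛ bag l) i j

  -- An integer, since the graph without vertices has a decomposition of
  -- width -1.
  width : ℤ
  width = + max 0 (map (λ i → ∣ bag i ∣) (allFin nodes)) ℤ.- 1ℤ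

open TreeDecomposition using (width)

IsTreewidth : ∀ {n} → Graph n → ℤ → Set
IsTreewidth G t =
  (Σ (TreeDecomposition G) λ D → width D ≡ t) ×
  ((D : TreeDecomposition G) → t ℤ.≤ width D)

tw[_]≤_ : ∀ {n} → Graph n → ℤ → Set
tw[ G ]≤ k = ∃[ t ] (IsTreewidth G t × t ℤ.≤ k)

record ℝ : Set where
  field
    seq    : ℕ → ℚ
    cauchy : ∀ ε → 0ℚ ℚ.< ε →
             ∃[ N ] (∀ i j → N ≤ i → N ≤ j → ℚ.∣ seq i ℚ.- seq j ∣ ℚ.< ε)

open ℝ using (seq)

infix 4 _≤ᵣ_ _≃ᵣ_

_≤ᵣ_ : ℝ → ℝ → Set
x ≤ᵣ y = ∀ ε → 0ℚ ℚ.< ε → ∃[ N ] (∀ i → N ≤ i → seq x i ℚ.≤ seq y i ℚ.+ ε)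

_≃ᵣ_ : ℝ → ℝ → Set
x ≃ᵣ y = (x ≤ᵣ y) × (y ≤ᵣ x)

fromℕ : ℕ → ℝ
fromℕ m = record
  { seq    = λ _ → q
  ; cauchy = λ ε 0<ε → 0 , λ _ _ _ _ →
      subst (λ d → ℚ.∣ d ∣ ℚ.< ε) (sym (+-inverseʳ q)) 0<ε
  }
  where
  q : ℚ
  q = + m ℚ./ 1

record Interval : Set where
  field
    lo hi : ℝ
    lo≤hi : lo ≤ᵣ hi

open Interval public using (lo; hi)

Box : ℕ → Set
Box b = Fin b → Interval

_∈□_ : ∀ {b} → (Fin b → ℝ) → Box b → Set
p ∈□ B = ∀ i → (lo (B i) ≤ᵣ p i) × (p i ≤ᵣ hi (B i))

Intersect : ∀ {b} → Box b → Box b → Set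
Intersect B B′ = ∃[ p ] (p ∈□ B × p ∈□ B′)

record BoxRepresentation {n : ℕ} (G : Graph n) (b : ℕ) : Set where
  open Graph G using (Adj)
  field
    box      : Fin n → Box b
    adjacent : ∀ u v → u ≢ v → Adj u v ⇔ Intersect (box u) (box v)

-- A random access machine with uniform cost. Programs are structured
-- (while programs) instead of flowcharts. The memory is divided into
-- arrays of natural numbers; the array name in a load or store is part of
-- the program text, so a program uses only finitely many arrays, and a
-- scalar register is a cell with a constant index. The index of a load or
-- store is computed at run time (indirect addressing). Every constant,
-- memory access, addition, truncated subtraction and test takes unit time;
-- there is no multiplication.

Memory : Set
Memory = ℕ → ℕ → ℕ

data Expr : Set where
  const : ℕ → Expr
  load  : (array : ℕ) (index : Expr) → Expr
  add   : Expr → Expr → Expr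
  sub   : Expr → Expr → Expr

eval : Memory → Expr → ℕ
eval σ (const c)  = c
eval σ (load a e) = σ a (eval σ e)
eval σ (add e f)  = eval σ e + eval σ f
eval σ (sub e f)  = eval σ e ∸ eval σ f

cost : Expr → ℕ
cost (const c)  = 1
cost (load a e) = suc (cost e)
cost (add e f)  = suc (cost e + cost f)
cost (sub e f)  = suc (cost e + cost f)

infixr 5 _⨟_

data Program : Set where
  skip   : Program
  store  : (array : ℕ) (index value : Expr) → Program
  _⨟_    : Program → Program → Program
  ifnz   : Expr → Program → Program → Program
  while  : Expr → Program → Program

_[_,_]≔_ : Memory → ℕ → ℕ → ℕ → Memory
(σ [ a , i ]≔ x) a′ i′ = if (a′ ≡ᵇ a) ∧ (i′ ≡ᵇ i) then x else σ a′ i′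

-- ⟨ P , σ ⟩⇓[ t ] τ : started in memory σ, the program P halts after t time
-- units in memory τ.  Tests succeed when the value is not 0.

infix 4 ⟨_,_⟩⇓[_]_

data ⟨_,_⟩⇓[_]_ : Program → Memory → ℕ → Memory → Set where
  skip : ∀ {σ} → ⟨ skip , σ ⟩⇓[ 1 ] σ
  store : ∀ {σ a e f} →
    ⟨ store a e f , σ ⟩⇓[ suc (cost e + cost f) ] (σ [ a , eval σ e ]≔ eval σ f)
  sequence : ∀ {σ τ υ P Q s t} →
    ⟨ P , σ ⟩⇓[ s ] τ → ⟨ Q , τ ⟩⇓[ t ] υ → ⟨ P ⨟ Q , σ ⟩⇓[ s + t ] υ
  if-true : ∀ {σ τ e P Q t} →
    eval σ e ≢ 0 → ⟨ P , σ ⟩⇓[ t ] τ → ⟨ ifnz e P Q , σ ⟩⇓[ suc (cost e + t) ] τ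
  if-false : ∀ {σ τ e P Q t} →
    eval σ e ≡ 0 → ⟨ Q , σ ⟩⇓[ t ] τ → ⟨ ifnz e P Q , σ ⟩⇓[ suc (cost e + t) ] τ
  while-stop : ∀ {σ e P} →
    eval σ e ≡ 0 → ⟨ while e P , σ ⟩⇓[ suc (cost e) ] σ
  while-step : ∀ {σ τ υ e P s t} →
    eval σ e ≢ 0 → ⟨ P , σ ⟩⇓[ s ] τ → ⟨ while e P , τ ⟩⇓[ t ] υ →
    ⟨ while e P , σ ⟩⇓[ suc (cost e + (s + t)) ] υ

-- The neighbours of each vertex, once each, in arbitrary order.
record AdjacencyLists {n : ℕ} (G : Graph n) : Set where
  open Graph G using (Adj)
  field
    neighbours : Fin n → List (Fin n)
    unique     : ∀ u → Unique (neighbours u)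
    correct    : ∀ u v → v ∈ neighbours u ⇔ Adj u v

-- n, followed for u = 0, …, n-1 by the degree of u and the neighbours of u.
encode : ∀ {n} {G : Graph n} → AdjacencyLists G → List ℕ
encode {n} L = n ∷ concatMap (λ u → length (N u) ∷ map toℕ (N u)) (allFin n)
  where N = AdjacencyLists.neighbours L

nth : List ℕ → ℕ → ℕ
nth []       _       = 0
nth (x ∷ xs) zero    = x
nth (x ∷ xs) (suc i) = nth xs i

-- The input is in array 0; all other cells are 0.
initial : List ℕ → Memory
initial xs zero    i = nth xs i
initial xs (suc _) i = 0

-- The output is in array 1: the dimension b, followed for each vertex v and
-- then each coordinate i < b by the two endpoints of the i-th interval of v.
Outputs : ∀ {n b} {G : Graph n} → Memory → BoxRepresentation G b → Set
Outputs {n} {b} σ R =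
  (σ 1 0 ≡ b) ×
  (∀ (v : Fin n) (i : Fin b) →
    let j = 2 * (toℕ v * b + toℕ i) in
    (lo (box v i) ≃ᵣ fromℕ (σ 1 (1 + j))) ×
    (hi (box v i) ≃ᵣ fromℕ (σ 1 (2 + j))))
  where open BoxRepresentation R

_∈O_ : (ℕ → ℕ) → (ℕ → ℕ) → Set
f ∈O g = ∃[ c ] ∃[ n₀ ] (∀ n → n₀ ≤ n → f n ≤ c * g n)

{-# OPTIONS --safe #-}

-- A graph of bounded treewidth has linearly many edges on every vertex set, so removing all
-- vertices of small degree at once removes at least half of the vertices; repeating this
-- orients G acyclically with bounded out-degree, in linear time.  Join each vertex to the
-- vertices at the end of its directed paths of length at most two, and the out-neighbours of a
-- vertex to one another.  If every bag is enlarged by the out-neighbours of its members one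
-- obtains a tree decomposition of this augmented graph, so peeling applies to it as well and
-- yields an order in which greedy colouring needs boundedly many colours.  In such a colouring
-- two colour classes induce a star forest of G whose leaves point to their centres.  Dimension
-- (i , j) puts the vertices of colours i and j at the centre of their star and lets all other
-- vertices span everything: u and v of different colours meet in dimension (col u , col v) only
-- if they are adjacent, and dimension (i , i) separates the vertices of colour i.

module Submission where

open import Data.Bool using (Bool; true; false; T; if_then_else_; _∨_)
open import Data.Bool.Properties using (T?)
open import Data.Empty using (⊥; ⊥-elim)
open import Data.Fin as Fin using (Fin; toℕ)
open import Data.Fin.Properties using (any?; toℕ-injective; toℕ<n; toℕ-fromℕ<; toℕ-combine; combine-surjective)
open import Data.Fin.Subset using (Subset; ∣_∣) renaming (_∈_ to _∈ₛ_)
open import Data.Integer as ℤ using (ℤ)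
import Data.Integer.Properties as ℤP
open import Data.List using (List; []; _∷_; _∷ʳ_; _++_; length; map; concatMap; allFin; upTo; applyUpTo; tabulate)
open import Data.List.Extrema.Nat using (xs≤max)
import Data.List.Membership.DecPropositional as DecMembership
open import Data.List.Membership.Propositional using (_∈_)
open import Data.List.Membership.Propositional.Properties using (∈-++⁺ˡ; ∈-++⁺ʳ; ∈-++⁻; ∈-map⁺; ∈-map⁻; ∈-∃++; ∈-upTo⁺; ∈-upTo⁻; ∈-allFin)
open import Data.List.Properties using (length-++; length-map; length-upTo; length-tabulate; ++-identityʳ; ∷ʳ-++)
open import Data.List.Relation.Unary.All as All using (All; []; _∷_)
import Data.List.Relation.Unary.All.Properties as AllP
open import Data.List.Relation.Unary.AllPairs using ([]; _∷_)
open import Data.List.Relation.Unary.Any using (here; there)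
open import Data.List.Relation.Unary.Linked using (Linked; []; [-]; _∷_)
open import Data.List.Relation.Unary.Unique.Propositional using (Unique)
import Data.List.Relation.Unary.Unique.Propositional.Properties as UniqueP
open import Data.Nat
import Data.Nat.Coprimality as Coprimality
open import Data.Nat.ListAction using (sum)
open import Data.Nat.Properties
open import Data.Nat.Solver using (module +-*-Solver)
open import Data.Product using (Σ; Σ-syntax; ∃-syntax; _×_; _,_; proj₁; proj₂; swap)
open import Data.Rational as ℚ using (ℚ; 0ℚ)
import Data.Rational.Properties as ℚP
import Data.Rational.Unnormalised as ℚᵘ
import Data.Rational.Unnormalised.Properties as ℚᵘP
open import Data.Sum using (_⊎_; inj₁; inj₂; [_,_]′)
open import Data.Unit using (⊤; tt)
open import Data.Vec as Vec using ([]; _∷_)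
open import Defs
open import Function using (_∘_; id; case_of_)
open import Function.Bundles using (mk⇔; module Equivalence)
open import Relation.Binary.Construct.Closure.ReflexiveTransitive as Star using (Star; ε; _◅_; _◅◅_)
open import Relation.Binary.Definitions using (tri<; tri≈; tri>)
open import Relation.Binary.PropositionalEquality using (_≡_; _≢_; ≢-sym; refl; sym; trans; cong; cong₂; subst; subst₂; module ≡-Reasoning)
open import Relation.Nullary using (¬_; Dec; yes; no; contradiction)
open import Relation.Nullary.Decidable using (_×-dec_)

open DecMembership _≟_ using (_∈?_)

-- The tree decomposition serves the analysis only: the program sees adjacency lists and constants
-- computed from `k`, and never builds a decomposition. Sparsity comes from rooting the tree: of two
-- vertices in a common bag, one lies in the bag at the topmost node of the other, and bags have at
-- most `K` members. Removing vertices in bulk lets every round recount all degrees from scratch;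
-- the cost of the rounds is then a geometric series, and no dynamic degree structure is needed. The
-- added edges exclude two patterns: a vertex with two out-neighbours of one colour, and a directed
-- path of two edges whose ends share a colour. Hence a vertex has at most one out-neighbour of each
-- colour, that one has no further out-neighbour in the two colours, and the centre of a star is
-- read off from the out-list of a leaf. Vertices with a common head stay unjoined, since in-degrees
-- are unbounded. The machine has no multiplication: products with constants are unrolled into sums,
-- and multiples of `n` are tabulated.

unique-⊆⇒length≤ : {A : Set} {xs ys : List A} → Unique xs →
                   (∀ {x} → x ∈ xs → x ∈ ys) → length xs ≤ length ys
unique-⊆⇒length≤ {xs = []} _ _ = z≤n
unique-⊆⇒length≤ {A} {x ∷ xs} (x∉xs ∷ u) incl with ∈-∃++ (incl (here refl))
... | as , bs , refl = begin
  suc (length xs)                ≤⟨ s≤s (unique-⊆⇒length≤ u incl′) ⟩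
  suc (length (as ++ bs))        ≡⟨ cong suc (length-++ as) ⟩
  suc (length as + length bs)    ≡⟨ +-suc (length as) (length bs) ⟨
  length as + length (x ∷ bs)    ≡⟨ length-++ as ⟨
  length (as ++ x ∷ bs)          ∎
  where
  open ≤-Reasoning
  incl′ : ∀ {y} → y ∈ xs → y ∈ as ++ bs
  incl′ y∈xs with ∈-++⁻ as (incl (there y∈xs))
  ... | inj₁ y∈as = ∈-++⁺ˡ y∈as
  ... | inj₂ (there y∈bs) = ∈-++⁺ʳ as y∈bs
  ... | inj₂ (here refl) = contradiction refl (All.lookup x∉xs y∈xs)

length-concatMap-≤ : {A B : Set} (f : A → List B) {K : ℕ} → (∀ x → length (f x) ≤ K) →
                     ∀ xs → length (concatMap f xs) ≤ K * length xs
length-concatMap-≤ f {K} f≤K [] = z≤n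
length-concatMap-≤ f {K} f≤K (x ∷ xs) = begin
  length (f x ++ concatMap f xs)          ≡⟨ length-++ (f x) ⟩
  length (f x) + length (concatMap f xs)  ≤⟨ +-mono-≤ (f≤K x) (length-concatMap-≤ f f≤K xs) ⟩
  K + K * length xs                       ≡⟨ *-suc K (length xs) ⟨
  K * suc (length xs)                     ∎
  where open ≤-Reasoning

∈-concatMap : {A B : Set} (f : A → List B) {x : A} {y : B} {xs : List A} →
              x ∈ xs → y ∈ f x → y ∈ concatMap f xs
∈-concatMap f (here refl) y∈ = ∈-++⁺ˡ y∈
∈-concatMap f {xs = z ∷ _} (there x∈) y∈ = ∈-++⁺ʳ (f z) (∈-concatMap f x∈ y∈)

∈-concatMap⁻¹ : {A B : Set} (f : A → List B) {y : B} (xs : List A) →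
                y ∈ concatMap f xs → ∃[ x ] (x ∈ xs × y ∈ f x)
∈-concatMap⁻¹ f (x ∷ xs) y∈ with ∈-++⁻ (f x) y∈
... | inj₁ y∈fx = x , here refl , y∈fx
... | inj₂ y∈r with ∈-concatMap⁻¹ f xs y∈r
...   | x′ , x′∈ , y∈fx′ = x′ , there x′∈ , y∈fx′

-- Sparsity and degree counting

Cell : Set
Cell = ℕ × ℕ

Orients : (ℕ → List ℕ) → ℕ → ℕ → Set
Orients own x y = y ∈ own x ⊎ x ∈ own y

-- Cells are ordered pairs. Each is either an arc from a member of `S` to an entry of its `own` list
-- or the reversal of such an arc, and there are at most `K * length S` arcs; hence the factor 2.
cells-sparse : (own : ℕ → List ℕ) {K : ℕ} → (∀ x → length (own x) ≤ K) →
  (S : List ℕ) {C : List Cell} → Unique C →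
  (∀ {x y} → (x , y) ∈ C → x ∈ S × y ∈ S × Orients own x y) →
  length C ≤ 2 * K * length S
cells-sparse own {K} own≤K S {C} uniq inside = begin
  length C                       ≤⟨ unique-⊆⇒length≤ uniq covered ⟩
  length (X ++ map swap X)       ≡⟨ length-++ X ⟩
  length X + length (map swap X) ≡⟨ cong (length X +_) (length-map swap X) ⟩
  length X + length X            ≤⟨ +-mono-≤ X≤ X≤ ⟩
  K * s + K * s                  ≡⟨ *-distribʳ-+ s K K ⟨
  (K + K) * s                    ≡⟨ cong (λ z → (K + z) * s) (sym (+-identityʳ K)) ⟩
  2 * K * s                      ∎
  where
  open ≤-Reasoning
  s = length S
  out : ℕ → List Cell
  out x = map (x ,_) (own x)
  X = concatMap out S
  X≤ : length X ≤ K * s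
  X≤ = length-concatMap-≤ out (λ x → ≤-trans (≤-reflexive (length-map (x ,_) (own x))) (own≤K x)) S
  covered : ∀ {p} → p ∈ C → p ∈ X ++ map swap X
  covered {x , y} p∈ with inside p∈
  ... | x∈S , _ , inj₁ y∈ = ∈-++⁺ˡ (∈-concatMap out x∈S (∈-map⁺ (x ,_) y∈))
  ... | _ , y∈S , inj₂ x∈ = ∈-++⁺ʳ X (∈-map⁺ swap (∈-concatMap out y∈S (∈-map⁺ (y ,_) x∈)))

δ : ℕ → ℕ → ℕ
δ v u = if v ≡ᵇ u then 1 else 0

≡ᵇ-refl : ∀ n → (n ≡ᵇ n) ≡ true
≡ᵇ-refl zero = refl
≡ᵇ-refl (suc n) = ≡ᵇ-refl n

≢⇒≡ᵇ-false : ∀ {m n} → m ≢ n → (m ≡ᵇ n) ≡ false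
≢⇒≡ᵇ-false {zero} {zero} m≢n = contradiction refl m≢n
≢⇒≡ᵇ-false {zero} {suc n} m≢n = refl
≢⇒≡ᵇ-false {suc m} {zero} m≢n = refl
≢⇒≡ᵇ-false {suc m} {suc n} m≢n = ≢⇒≡ᵇ-false (m≢n ∘ cong suc)

δ-same : ∀ v → δ v v ≡ 1
δ-same v rewrite ≡ᵇ-refl v = refl

δ-other : ∀ {v u} → v ≢ u → δ v u ≡ 0
δ-other v≢u rewrite ≢⇒≡ᵇ-false v≢u = refl

outdeg : ℕ → List Cell → ℕ
outdeg v [] = 0
outdeg v ((u , _) ∷ C) = δ v u + outdeg v C

sum-map-+ : {A : Set} (f g : A → ℕ) (xs : List A) →
            sum (map (λ x → f x + g x) xs) ≡ sum (map f xs) + sum (map g xs)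
sum-map-+ f g [] = refl
sum-map-+ f g (x ∷ xs) rewrite sum-map-+ f g xs = begin
  f x + g x + (F + G)     ≡⟨ +-assoc (f x) (g x) (F + G) ⟩
  f x + (g x + (F + G))   ≡⟨ cong (f x +_) (+-assoc (g x) F G) ⟨
  f x + (g x + F + G)     ≡⟨ cong (λ z → f x + (z + G)) (+-comm (g x) F) ⟩
  f x + (F + g x + G)     ≡⟨ cong (f x +_) (+-assoc F (g x) G) ⟩
  f x + (F + (g x + G))   ≡⟨ +-assoc (f x) F (g x + G) ⟨
  f x + F + (g x + G)     ∎
  where
  open ≡-Reasoning
  F = sum (map f xs)
  G = sum (map g xs)

sum-map-const : {A : Set} (f : A → ℕ) {c : ℕ} (xs : List A) → (∀ {x} → x ∈ xs → c ≤ f x) →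
                c * length xs ≤ sum (map f xs)
sum-map-const f {c} [] _ = ≤-reflexive (*-zeroʳ c)
sum-map-const f {c} (x ∷ xs) c≤ = ≤-trans (≤-reflexive (*-suc c (length xs)))
  (+-mono-≤ (c≤ (here refl)) (sum-map-const f xs (c≤ ∘ there)))

sum-δ-∉ : ∀ u (A : List ℕ) → All (u ≢_) A → sum (map (λ v → δ v u) A) ≡ 0
sum-δ-∉ u [] [] = refl
sum-δ-∉ u (v ∷ A) (u≢v ∷ u∉A) = cong₂ _+_ (δ-other (u≢v ∘ sym)) (sum-δ-∉ u A u∉A)

sum-δ≤1 : ∀ u {A : List ℕ} → Unique A → sum (map (λ v → δ v u) A) ≤ 1
sum-δ≤1 u [] = z≤n
sum-δ≤1 u {v ∷ A} (v∉A ∷ uA) with v ≟ u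
... | yes refl = ≤-reflexive (cong₂ _+_ (δ-same u) (sum-δ-∉ u A v∉A))
... | no v≢u = ≤-trans (≤-reflexive (cong (_+ sum (map (λ w → δ w u) A)) (δ-other v≢u))) (sum-δ≤1 u uA)

-- Double counting: a cell contributes only at its first component, which occurs at most once in
-- `A`.
sum-outdeg≤ : {A : List ℕ} → Unique A → ∀ C → sum (map (λ v → outdeg v C) A) ≤ length C
sum-outdeg≤ {A} uA [] = ≤-reflexive (zeros A)
  where
  zeros : ∀ xs → sum (map (λ _ → 0) xs) ≡ 0
  zeros [] = refl
  zeros (_ ∷ xs) = zeros xs
sum-outdeg≤ {A} uA ((u , _) ∷ C) = ≤-trans
  (≤-reflexive (sum-map-+ (λ v → δ v u) (λ v → outdeg v C) A))
  (+-mono-≤ (sum-δ≤1 u uA) (sum-outdeg≤ uA C))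

-- Rooted structure of a finite tree

least : (P : ℕ → Set) → (∀ l → Dec (P l)) → ∀ l → P l →
        ∃[ m ] (P m × (∀ l′ → P l′ → m ≤ l′))
least P P? l Pl with P? 0
... | yes P0 = 0 , P0 , λ _ _ → z≤n
least P P? zero P0 | no ¬P0 = contradiction P0 ¬P0
least P P? (suc l) Pl | no ¬P0 with least (P ∘ suc) (P? ∘ suc) l Pl
... | m , Pm , min = suc m , Pm , λ where
  zero P0 → contradiction P0 ¬P0
  (suc l′) Pl′ → s≤s (min l′ Pl′)

Linked-∷ʳ : {A : Set} {R : A → A → Set} {x y : A} (xs : List A) →
            Linked R (xs ∷ʳ x) → R x y → Linked R (xs ∷ʳ x ∷ʳ y)
Linked-∷ʳ [] [-] r = r ∷ [-]
Linked-∷ʳ (_ ∷ []) (p ∷ [-]) r = p ∷ r ∷ [-]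
Linked-∷ʳ (_ ∷ z ∷ xs) (p ∷ l) r = p ∷ Linked-∷ʳ (z ∷ xs) l r

Unique-∷ʳ : {A : Set} {x : A} {xs : List A} → Unique xs → All (_≢ x) xs → Unique (xs ∷ʳ x)
Unique-∷ʳ [] [] = [] ∷ []
Unique-∷ʳ (y∉ ∷ u) (y≢x ∷ xs≢x) = AllP.∷ʳ⁺ y∉ y≢x ∷ Unique-∷ʳ u xs≢x

module RootedTree {N : ℕ} (G : Graph N) (isTree : IsTree G) where
  open Graph G

  Adj-sym : ∀ {x y} → Adj x y → Adj y x
  Adj-sym {x} {y} = subst T (edge-sym x y)

  root : Fin N
  root = Fin.fromℕ< (proj₁ (proj₁ isTree))

  -- Walks of exactly `l` steps instead of paths: this is decidable by recursion on `l`, and the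
  -- least such `l` is the distance to the root all the same.
  Reaches : ℕ → Fin N → Set
  Reaches zero x = x ≡ root
  Reaches (suc l) x = ∃[ y ] (Adj x y × Reaches l y)

  reaches? : ∀ l x → Dec (Reaches l x)
  reaches? zero x = x Fin.≟ root
  reaches? (suc l) x = any? λ y → T? (edge x y) ×-dec reaches? l y

  walk-reaches : ∀ {x} → Star Adj x root → ∃[ l ] Reaches l x
  walk-reaches ε = 0 , refl
  walk-reaches (e ◅ w) with walk-reaches w
  ... | l , r = suc l , _ , e , r

  distance : ∀ x → ∃[ m ] (Reaches m x × (∀ l → Reaches l x → m ≤ l))
  distance x with walk-reaches (proj₂ (proj₁ isTree) x root)
  ... | l , r = least (λ l′ → Reaches l′ x) (λ l′ → reaches? l′ x) l r

  depth : Fin N → ℕ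
  depth x = proj₁ (distance x)

  depth-reaches : ∀ x → Reaches (depth x) x
  depth-reaches x = proj₁ (proj₂ (distance x))

  depth-min : ∀ x l → Reaches l x → depth x ≤ l
  depth-min x = proj₂ (proj₂ (distance x))

  depth-adj : ∀ {x y} → Adj x y → depth x ≤ suc (depth y)
  depth-adj {x} {y} e = depth-min x _ (y , e , depth-reaches y)

  -- The second vertex of a shortest walk to the root.
  parent : ∀ x {d} → depth x ≡ suc d → ∃[ y ] (Adj x y × depth y ≡ d)
  parent x {d} eq with subst (λ l → Reaches l x) eq (depth-reaches x)
  ... | y , e , r = y , e , ≤-antisym (depth-min y d r)
    (s≤s⁻¹ (≤-trans (≤-reflexive (sym eq)) (depth-adj e)))

  depth-0 : ∀ x → depth x ≡ 0 → x ≡ root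
  depth-0 x eq = subst (λ l → Reaches l x) eq (depth-reaches x)

  deeper-≢ : ∀ {x y d} → depth x < d → depth y ≡ d → x ≢ y
  deeper-≢ x<d y≡d refl = <-irrefl y≡d x<d

  -- Both vertices climb through their parents until they meet, at the root at the latest. Each
  -- round adds two vertices deeper than everything found so far, which makes the path simple. A
  -- nonempty interior is recorded because a cycle needs at least three vertices.
  join : ∀ d {a b} → depth a ≡ d → depth b ≡ d → a ≢ b →
         ∃[ zs ] (Linked Adj (a ∷ zs ∷ʳ b) × Unique zs × All (λ z → depth z < d) zs × 1 ≤ length zs)
  join zero {a} {b} da db a≢b = contradiction (trans (depth-0 a da) (sym (depth-0 b db))) a≢b
  join (suc d) {a} {b} da db a≢b with parent a da | parent b db
  ... | p , ap , dp | q , bq , dq with p Fin.≟ q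
  ...   | yes refl = p ∷ [] , ap ∷ Adj-sym bq ∷ [-] , [] ∷ [] , s≤s (≤-reflexive dp) ∷ [] , s≤s z≤n
  ...   | no p≢q with join d dp dq p≢q
  ...     | zs , linked , uniq , below , _ =
    p ∷ zs ∷ʳ q , ap ∷ Linked-∷ʳ (p ∷ zs) linked (Adj-sym bq)
    , AllP.∷ʳ⁺ (All.map (λ lt eq → deeper-≢ lt dp (sym eq)) below) p≢q
      ∷ Unique-∷ʳ uniq (All.map (λ lt → deeper-≢ lt dq) below)
    , s≤s (≤-reflexive dp) ∷ AllP.∷ʳ⁺ (All.map m<n⇒m<1+n below) (s≤s (≤-reflexive dq))
    , s≤s z≤n

  length-∷ʳ≥ : {A : Set} (zs : List A) (z : A) {m : ℕ} → m ≤ length zs → suc m ≤ length (zs ∷ʳ z)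
  length-∷ʳ≥ zs z m≤ = ≤-trans (s≤s m≤) (≤-reflexive
    (trans (+-comm 1 (length zs)) (sym (length-++ zs))))

  -- Such an edge would close the path of `join` to a cycle.
  no-level-edge : ∀ {a b} → Adj a b → depth a ≢ depth b
  no-level-edge {a} {b} e eq with a Fin.≟ b
  ... | yes refl = subst T (edge-irrefl a) e
  ... | no a≢b with join (depth b) eq refl a≢b
  ...   | zs , linked , uniq , below , nonempty = proj₂ isTree a (zs ∷ʳ b)
    ( length-∷ʳ≥ zs b nonempty
    , AllP.∷ʳ⁺ (All.map (λ lt p → deeper-≢ lt eq (sym p)) below) a≢b
      ∷ Unique-∷ʳ uniq (All.map (λ lt → deeper-≢ lt refl) below)
    , Linked-∷ʳ (a ∷ zs) linked (Adj-sym e))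

  -- Two parents have equal depth, and the path of `join` between them avoids the deeper vertex `x`,
  -- which would close it to a cycle.
  parent-unique : ∀ {x y z} → Adj x y → Adj x z → depth x ≡ suc (depth y) → depth x ≡ suc (depth z) → y ≡ z
  parent-unique {x} {y} {z} xy xz dy dz with y Fin.≟ z
  ... | yes y≡z = y≡z
  ... | no y≢z with join (depth z) (suc-injective (trans (sym dy) dz)) refl y≢z
  ...   | zs , linked , uniq , below , nonempty = ⊥-elim (proj₂ isTree x (y ∷ zs ∷ʳ z)
    ( ≤-trans (length-∷ʳ≥ zs z nonempty) (n≤1+n _)
    , (x≢ dy ∷ AllP.∷ʳ⁺ (All.map (λ lt p → deeper-≢ (m<n⇒m<1+n lt) dz (sym p)) below) (x≢ dz))
      ∷ AllP.∷ʳ⁺ (All.map (λ lt p → deeper-≢ lt (suc-injective (trans (sym dy) dz)) (sym p)) below) y≢z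
      ∷ Unique-∷ʳ uniq (All.map (λ lt → deeper-≢ lt refl) below)
    , xy ∷ Linked-∷ʳ (y ∷ zs) linked (Adj-sym xz)))
    where
    x≢ : ∀ {w} → depth x ≡ suc (depth w) → x ≢ w
    x≢ d refl = 1+n≢n (sym d)

  edge-cases : ∀ {x y} → Adj x y → depth x ≡ suc (depth y) ⊎ depth y ≡ suc (depth x)
  edge-cases {x} {y} e with <-cmp (depth x) (depth y)
  ... | tri< lt _ _ = inj₂ (≤-antisym (depth-adj (Adj-sym e)) lt)
  ... | tri≈ _ eq _ = contradiction eq (no-level-edge e)
  ... | tri> _ _ gt = inj₁ (≤-antisym (depth-adj e) gt)

  -- A path inside `A` that only descends, starting at `t`. Walks are brought into this form because
  -- descending paths with a common end can be compared step by step from that end.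
  data Chain (A : Fin N → Set) (t : Fin N) : Fin N → Set where
    stop : A t → Chain A t t
    step : ∀ {y z} → Chain A t y → Adj z y → depth z ≡ suc (depth y) → A z → Chain A t z

  chain-end : ∀ {A t x} → Chain A t x → A x
  chain-end (stop a) = a
  chain-end (step _ _ _ a) = a

  chain-depth : ∀ {A t x} → Chain A t x → depth t ≤ depth x
  chain-depth (stop _) = ≤-refl
  chain-depth (step c _ d _) = ≤-trans (chain-depth c) (≤-trans (n≤1+n _) (≤-reflexive (sym d)))

  IsTop : (Fin N → Set) → Fin N → Set
  IsTop A t = A t × (∀ x → A x → depth t ≤ depth x)

  -- A step down extends the chain. A step up leads to the unique parent and hence removes the last
  -- link; it cannot leave from `t`, the highest node of `A`.
  walk-chain : ∀ {A t} → IsTop A t → ∀ {x y} → Chain A t x → WalkInside G A x y → Chain A t y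
  walk-chain top c ε = c
  walk-chain top c ((e , _ , Az) ◅ w) with edge-cases e
  walk-chain top c ((e , _ , Az) ◅ w) | inj₂ down = walk-chain top (step c (Adj-sym e) down Az) w
  walk-chain top (stop _) ((e , _ , Az) ◅ w) | inj₁ up =
    contradiction (≤-trans (≤-reflexive (sym up)) (proj₂ top _ Az)) (n≮n _)
  walk-chain top (step c e′ d _) ((e , _ , Az) ◅ w) | inj₁ up with parent-unique e′ e d up
  ... | refl = walk-chain top c w

  -- Followed upwards from the common end `x`, both chains run through the same parents. The one
  -- from the higher start `s` therefore passes through `t`.
  chain-through : ∀ {A B s t x} → Chain A t x → Chain B s x → depth s ≤ depth t → B t
  chain-through (stop _) cB _ = chain-end cB
  chain-through (step cA e d _) (stop _) s≤t =
    contradiction (≤-trans (≤-reflexive (sym d)) (≤-trans s≤t (chain-depth cA))) (n≮n _)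
  chain-through (step cA e d _) (step cB e′ d′ _) s≤t with parent-unique e e′ d d′
  ... | refl = chain-through cA cB s≤t

  topmost : {A : Fin N → Set} → (∀ x → Dec (A x)) → ∀ x → A x → ∃[ t ] IsTop A t
  topmost {A} A? x Ax with least (λ l → ∃[ y ] (A y × depth y ≡ l))
                              (λ l → any? λ y → A? y ×-dec (depth y ≟ l)) (depth x) (x , Ax , refl)
  ... | .(depth t) , (t , At , refl) , min = t , At , λ y Ay → min (depth y) (y , Ay , refl)

-- Vertices are plain numbers, as in the memory of the machine. The record fits both the given
-- decomposition and the one with enlarged bags; `K` bounds bag sizes, thus it exceeds the width by
-- one.
record BagTree (K : ℕ) : Set where
  field
    nodes   : ℕ
    tree    : Graph nodes
    isTree  : IsTree tree
    bag     : Fin nodes → List ℕ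
    bag≤K   : ∀ i → length (bag i) ≤ K
    subtree : ∀ v i j → v ∈ bag i → v ∈ bag j → WalkInside tree (λ l → v ∈ bag l) i j

  Share : ℕ → ℕ → Set
  Share x y = ∃[ i ] (x ∈ bag i × y ∈ bag i)

module Ownership {K : ℕ} (B : BagTree K) where
  open BagTree B
  open RootedTree tree isTree

  -- The bag at the topmost node containing `x`. It catches every vertex that shares a bag with `x`
  -- and whose own topmost node is not deeper. Numbers in no bag get the empty list, to make the
  -- function total.
  own : ℕ → List ℕ
  own x with any? (λ i → x ∈? bag i)
  ... | yes (i , x∈) = bag (proj₁ (topmost (λ j → x ∈? bag j) i x∈))
  ... | no _ = []

  own≤K : ∀ x → length (own x) ≤ K
  own≤K x with any? (λ i → x ∈? bag i)
  ... | yes _ = bag≤K _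
  ... | no _ = z≤n

  own-top : ∀ {x i} → x ∈ bag i → ∃[ t ] (IsTop (λ j → x ∈ bag j) t × own x ≡ bag t)
  own-top {x} {i} x∈ with any? (λ j → x ∈? bag j)
  ... | yes (j , x∈j) = _ , proj₂ (topmost (λ l → x ∈? bag l) j x∈j) , refl
  ... | no ¬x = contradiction (i , x∈) ¬x

  -- Both tops are ancestors of a common node, so the deeper one lies on the
  -- path from that node to the other top.
  share-oriented : ∀ {x y} → Share x y → Orients own x y
  share-oriented {x} {y} (i , x∈ , y∈) with own-top x∈ | own-top y∈
  ... | s , tops , eqs | t , topt , eqt with ≤-total (depth s) (depth t)
  ...   | inj₁ s≤t = inj₂ (subst (x ∈_) (sym eqt) (chain-through
          (walk-chain topt (stop (proj₁ topt)) (subtree y t i (proj₁ topt) y∈))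
          (walk-chain tops (stop (proj₁ tops)) (subtree x s i (proj₁ tops) x∈)) s≤t))
  ...   | inj₂ t≤s = inj₁ (subst (y ∈_) (sym eqs) (chain-through
          (walk-chain tops (stop (proj₁ tops)) (subtree x s i (proj₁ tops) x∈))
          (walk-chain topt (stop (proj₁ topt)) (subtree y t i (proj₁ topt) y∈)) t≤s))

  share-sparse : (S : List ℕ) {C : List Cell} → Unique C →
    (∀ {x y} → (x , y) ∈ C → x ∈ S × y ∈ S × Share x y) →
    length C ≤ 2 * K * length S
  share-sparse S uniq inside = cells-sparse own own≤K S uniq λ p →
    let x∈ , y∈ , sh = inside p in x∈ , y∈ , share-oriented sh

-- Timed runs of programs

-- Syntactic and per array instead of per cell: on the programs below it computes, so that each
-- frame condition is discharged by `refl`.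
writes : Program → ℕ → Bool
writes skip          a = false
writes (store b _ _) a = a ≡ᵇ b
writes (P ⨟ Q)       a = writes P a ∨ writes Q a
writes (ifnz _ P Q)  a = writes P a ∨ writes Q a
writes (while _ P)   a = writes P a

Frame : Program → Memory → Memory → Set
Frame P σ τ = ∀ a → writes P a ≡ false → ∀ i → τ a i ≡ σ a i

∨-false : ∀ {x y} → x ∨ y ≡ false → x ≡ false × y ≡ false
∨-false {false} eq = refl , eq

frame : ∀ {P σ t τ} → ⟨ P , σ ⟩⇓[ t ] τ → Frame P σ τ
frame skip a w i = refl
frame store a w i rewrite w = refl
frame (sequence d e) a w i =
  let wd , we = ∨-false w in trans (frame e a we i) (frame d a wd i)
frame (if-true {P = P} _ d) a w i = frame d a (proj₁ (∨-false {writes P a} w)) i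
frame (if-false {P = P} _ d) a w i = frame d a (proj₂ (∨-false {writes P a} w)) i
frame (while-stop _) a w i = refl
frame (while-step _ d e) a w i = trans (frame e a w i) (frame d a w i)

frame-trans : ∀ {P σ τ υ} → Frame P σ τ → Frame P τ υ → Frame P σ υ
frame-trans f g a w i = trans (g a w i) (f a w i)

-- A total-correctness triple with a time bound. The initial memory is fixed, so postconditions and
-- invariants may refer to its contents directly.
record Run (P : Program) (σ : Memory) (B : ℕ) (Q : Memory → Set) : Set where
  constructor run
  field
    {final}    : Memory
    {time}     : ℕ
    derivation : ⟨ P , σ ⟩⇓[ time ] final
    time≤      : time ≤ B
    post       : Q final

weaken : ∀ {P σ B B′ Q Q′} → B ≤ B′ → (∀ {τ} → Frame P σ τ → Q τ → Q′ τ) →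
         Run P σ B Q → Run P σ B′ Q′
weaken B≤ imp (run d t≤ q) = run d (≤-trans t≤ B≤) (imp (frame d) q)

infixr 4 _then_

_then_ : ∀ {P R σ B B′ Q Q′} → Run P σ B Q →
         (∀ {τ} → Frame P σ τ → Q τ → Run R τ B′ Q′) → Run (P ⨟ R) σ (B + B′) Q′
run d t≤ q then k with k (frame d) q
... | run e u≤ q′ = run (sequence d e) (+-mono-≤ t≤ u≤) q′

-- The sum of the two bounds is charged, not their maximum, so that the result agrees with
-- `duration` by computation.
branch : ∀ {e P R σ B B′ Q} → (eval σ e ≢ 0 → Run P σ B Q) → (eval σ e ≡ 0 → Run R σ B′ Q) →
         Run (ifnz e P R) σ (suc (cost e + (B + B′))) Q
branch {e} {σ = σ} {B} {B′} yes′ no′ with eval σ e ≟ 0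
... | yes z with no′ z
...   | run d t≤ q = run (if-false z d) (s≤s (+-monoʳ-≤ (cost e) (≤-trans t≤ (m≤n+m B′ B)))) q
branch {e} {σ = σ} {B} {B′} yes′ no′ | no nz with yes′ nz
...   | run d t≤ q = run (if-true nz d) (s≤s (+-monoʳ-≤ (cost e) (≤-trans t≤ (m≤m+n B B′)))) q

IsStores : Program → Set
IsStores skip = ⊤
IsStores (store _ _ _) = ⊤
IsStores (P ⨟ Q) = IsStores P × IsStores Q
IsStores (ifnz _ _ _) = ⊥
IsStores (while _ _) = ⊥

-- For straight-line code the final memory computes, so postconditions reduce to statements about
-- single cells. The clauses for conditionals and loops are placeholders; `exec-derivation` excludes
-- them by `IsStores`.
exec : Program → Memory → Memory
exec skip σ = σ
exec (store a e f) σ = σ [ a , eval σ e ]≔ eval σ f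
exec (P ⨟ Q) σ = exec Q (exec P σ)
exec (ifnz _ _ _) σ = σ
exec (while _ _) σ = σ

duration : Program → ℕ
duration skip = 1
duration (store _ e f) = suc (cost e + cost f)
duration (P ⨟ Q) = duration P + duration Q
duration (ifnz e P Q) = suc (cost e + (duration P + duration Q))
duration (while _ _) = 0

exec-derivation : ∀ P {σ} → IsStores P → ⟨ P , σ ⟩⇓[ duration P ] (exec P σ)
exec-derivation skip _ = skip
exec-derivation (store _ _ _) _ = store
exec-derivation (P ⨟ Q) (p , q) = sequence (exec-derivation P p) (exec-derivation Q q)

stores : ∀ P {σ Q} {p : IsStores P} → Q (exec P σ) → Run P σ (duration P) Q
stores P {p = p} q = run (exec-derivation P p) ≤-refl q

stores-then : ∀ P {R σ B Q} {p : IsStores P} → Run R (exec P σ) B Q → Run (P ⨟ R) σ (duration P + B) Q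
stores-then P {p = p} (run d t≤ q) = run (sequence (exec-derivation P p) d) (+-monoʳ-≤ (duration P) t≤) q

-- The invariant is indexed by the items still ahead, and the guard evaluates to their number; the
-- loop thus becomes structural recursion on a list. The cost may vary with the item, as it does for
-- vertices of different degree.
for-each : ∀ {A : Set} {g P σ} (Inv : List A → Memory → Set) (w : A → ℕ) →
  (∀ {ys τ} → Inv ys τ → eval τ g ≡ length ys) →
  (∀ {y ys τ} → Frame P σ τ → Inv (y ∷ ys) τ → Run P τ (w y) (Inv ys)) →
  ∀ xs → Inv xs σ →
  Run (while g P) σ (sum (map w xs) + suc (length xs) * suc (cost g)) (Inv [])
for-each {A} {g} {P} {σ} Inv w guard body xs = loop xs (λ _ _ _ → refl)
  where
  c = suc (cost g)
  loop : ∀ xs {τ} → Frame P σ τ → Inv xs τ →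
         Run (while g P) τ (sum (map w xs) + suc (length xs) * c) (Inv [])
  loop [] fr inv = run (while-stop (guard inv)) (≤-reflexive (sym (+-identityʳ c))) inv
  loop (x ∷ xs) {τ} fr inv with body fr inv
  ... | run {τ′} {t} d t≤ inv′ with loop xs (frame-trans {P} fr (frame d)) inv′
  ...   | run {time = u} e u≤ q =
    run (while-step (λ z → 1+n≢0 (trans (sym (guard inv)) z)) d e) bound q
    where
    open ≤-Reasoning
    s = sum (map w xs)
    bound : suc (cost g + (t + u)) ≤ w x + s + suc (suc (length xs)) * c
    bound = begin
      c + (t + u)                            ≤⟨ +-monoʳ-≤ c (+-mono-≤ t≤ u≤) ⟩
      c + (w x + (s + suc (length xs) * c))  ≡⟨ cong (c +_) (+-assoc (w x) s _) ⟨
      c + (w x + s + suc (length xs) * c)    ≡⟨ +-assoc c (w x + s) _ ⟨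
      c + (w x + s) + suc (length xs) * c    ≡⟨ cong (_+ suc (length xs) * c) (+-comm c (w x + s)) ⟩
      w x + s + c + suc (length xs) * c      ≡⟨ +-assoc (w x + s) c _ ⟩
      w x + s + suc (suc (length xs)) * c    ∎

sum-map-≡ : {A : Set} (c : ℕ) (xs : List A) → sum (map (λ _ → c) xs) ≡ length xs * c
sum-map-≡ c [] = refl
sum-map-≡ c (_ ∷ xs) = cong (c +_) (sum-map-≡ c xs)

-- One surplus execution of the body is charged, which turns the bound into a product.
for-each-const : ∀ {A : Set} {g P σ B} (Inv : List A → Memory → Set) →
  (∀ {ys τ} → Inv ys τ → eval τ g ≡ length ys) →
  (∀ {y ys τ} → Frame P σ τ → Inv (y ∷ ys) τ → Run P τ B (Inv ys)) →
  ∀ {M} xs → length xs ≤ M → Inv xs σ →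
  Run (while g P) σ (suc M * (B + suc (cost g))) (Inv [])
for-each-const {g = g} {B = B} Inv guard body {M} xs xs≤M inv =
  weaken bound (λ _ q → q) (for-each Inv (λ _ → B) guard body xs inv)
  where
  open ≤-Reasoning
  l = length xs
  bound : sum (map (λ _ → B) xs) + suc l * suc (cost g) ≤ suc M * (B + suc (cost g))
  bound = begin
    sum (map (λ _ → B) xs) + suc l * suc (cost g) ≡⟨ cong (_+ suc l * suc (cost g)) (sum-map-≡ B xs) ⟩
    l * B + suc l * suc (cost g)                  ≤⟨ +-monoˡ-≤ _ (m≤n+m (l * B) B) ⟩
    suc l * B + suc l * suc (cost g)              ≡⟨ *-distribˡ-+ (suc l) B (suc (cost g)) ⟨
    suc l * (B + suc (cost g))                    ≤⟨ *-monoˡ-≤ (B + suc (cost g)) (s≤s xs≤M) ⟩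
    suc M * (B + suc (cost g))                    ∎

for-below : ∀ {g P σ B} N {M} → N ≤ M → (Inv : ℕ → Memory → Set) →
  (∀ {i τ} → Inv i τ → eval τ g ≡ N ∸ i) →
  (∀ {i τ} → i < N → Frame P σ τ → Inv i τ → Run P τ B (Inv (suc i))) →
  Inv 0 σ →
  Run (while g P) σ (suc M * (B + suc (cost g))) (Inv N)
for-below {g} {P} {σ} {B} N {M} N≤M Inv guard body inv₀ = weaken (*-monoˡ-≤ c (s≤s N≤M)) (λ _ q → q)
  (loop N 0 (+-identityʳ N) (λ _ _ _ → refl) inv₀)
  where
  c = B + suc (cost g)
  loop : ∀ k i {τ} → k + i ≡ N → Frame P σ τ → Inv i τ → Run (while g P) τ (suc k * c) (Inv N)
  loop zero i refl fr inv = run (while-stop (trans (guard inv) (n∸n≡0 i)))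
    (≤-trans (m≤n+m (suc (cost g)) B) (≤-reflexive (sym (+-identityʳ c)))) inv
  loop (suc k) i {τ} eq fr inv with body (≤-trans (s≤s (m≤n+m i k)) (≤-reflexive eq)) fr inv
  ... | run {time = t} d t≤ inv′ with loop k (suc i) (trans (+-suc k i) eq) (frame-trans {P} fr (frame d)) inv′
  ...   | run {time = u} e u≤ q = run (while-step nz d e) bound q
    where
    open ≤-Reasoning
    nz : eval τ g ≢ 0
    nz z = 1+n≢0 (trans (sym (m+n∸n≡m (suc k) i)) (trans (cong (_∸ i) eq) (trans (sym (guard inv)) z)))
    bound : suc (cost g) + (t + u) ≤ suc (suc k) * c
    bound = begin
      suc (cost g) + (t + u)        ≡⟨ +-assoc (suc (cost g)) t u ⟨
      suc (cost g) + t + u          ≡⟨ cong (_+ u) (+-comm (suc (cost g)) t) ⟩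
      t + suc (cost g) + u          ≤⟨ +-mono-≤ (+-monoˡ-≤ (suc (cost g)) t≤) u≤ ⟩
      c + suc k * c                 ∎

-- The cost of a round proportional to s is paid for by the at least s / 2 units of s it consumes.
while-halving : ∀ {g P σ B} (Inv : ℕ → Memory → Set) →
  (∀ {s τ} → Inv s τ → eval τ g ≡ s) →
  (∀ {s τ} → 0 < s → Frame P σ τ → Inv s τ → Run P τ (s * B) (λ υ → ∃[ s′ ] (2 * s′ ≤ s × Inv s′ υ))) →
  ∀ s → Inv s σ →
  Run (while g P) σ (s * (2 * (B + suc (cost g))) + suc (cost g)) (Inv 0)
while-halving {g} {P} {σ} {B} Inv guard body s inv₀ = loop s s ≤-refl (λ _ _ _ → refl) inv₀
  where
  c = suc (cost g)
  -- Halving is not structural, so an upper bound on `s` drives the recursion; `shrink` shows that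
  -- half of a positive number is strictly smaller.
  loop : ∀ fuel s {τ} → s ≤ fuel → Frame P σ τ → Inv s τ →
         Run (while g P) τ (s * (2 * (B + c)) + c) (Inv 0)
  loop _ zero _ fr inv = run (while-stop (guard inv)) ≤-refl inv
  loop (suc fuel) (suc s) (s≤s s≤) fr inv with body z<s fr inv
  ... | run {time = t} d t≤ (s′ , half , inv′)
      with loop fuel s′ (≤-trans (s≤s⁻¹ (shrink s′ half)) s≤) (frame-trans {P} fr (frame d)) inv′
    where
    shrink : ∀ s′ → 2 * s′ ≤ suc s → suc s′ ≤ suc s
    shrink zero _ = s≤s z≤n
    shrink (suc s′) h = ≤-trans (s≤s (≤-trans (≤-reflexive (+-comm 1 s′)) (+-monoʳ-≤ s′ (s≤s z≤n)))) h
  ...   | run {time = u} e u≤ q = run (while-step (λ z → 1+n≢0 (trans (sym (guard inv)) z)) d e) bound q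
    where
    open ≤-Reasoning
    X = B + c
    bound : c + (t + u) ≤ suc s * (2 * X) + c
    bound = begin
      c + (t + u)                                    ≤⟨ +-monoʳ-≤ c (+-mono-≤ t≤ u≤) ⟩
      c + (suc s * B + (s′ * (2 * X) + c))           ≡⟨ +-assoc c (suc s * B) _ ⟨
      c + suc s * B + (s′ * (2 * X) + c)             ≡⟨ +-assoc (c + suc s * B) (s′ * (2 * X)) c ⟨
      c + suc s * B + s′ * (2 * X) + c               ≤⟨ +-monoˡ-≤ c (+-mono-≤ (+-monoˡ-≤ (suc s * B) (m≤m+n c (s * c))) (≤-reflexive (sym (*-assoc s′ 2 X)))) ⟩
      suc s * c + suc s * B + s′ * 2 * X + c         ≡⟨ cong (λ z → z + s′ * 2 * X + c) (trans (+-comm (suc s * c) (suc s * B)) (sym (*-distribˡ-+ (suc s) B c))) ⟩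
      suc s * X + s′ * 2 * X + c                     ≤⟨ +-monoˡ-≤ c (+-monoʳ-≤ (suc s * X) (*-monoˡ-≤ X (≤-trans (≤-reflexive (*-comm s′ 2)) half))) ⟩
      suc s * X + suc s * X + c                      ≡⟨ cong (_+ c) (*-distribˡ-+ (suc s) X X) ⟨
      suc s * (X + X) + c                            ≡⟨ cong (λ z → suc s * (X + z) + c) (sym (+-identityʳ X)) ⟩
      suc s * (2 * X) + c                            ∎

-- Array segments

-- The predicate is left general so that one array, two parallel arrays of cells and mere statements
-- about indices are all treated by the same lemmas.
Segment : {A : Set} → (ℕ → A → Set) → ℕ → List A → Set
Segment P o [] = ⊤
Segment P o (x ∷ xs) = P o x × Segment P (suc o) xs

segment-map : {A : Set} {P Q : ℕ → A → Set} → ∀ o xs →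
  (∀ {i x} → o ≤ i → i < o + length xs → P i x → Q i x) → Segment P o xs → Segment Q o xs
segment-map o [] f _ = tt
segment-map o (x ∷ xs) f (p , ps) = f ≤-refl (m<m+n o z<s) p ,
  segment-map (suc o) xs (λ {i} o<i i< → f (<⇒≤ o<i) (≤-trans i< (≤-reflexive (sym (+-suc o (length xs)))))) ps

segment-∷ʳ : {A : Set} {P : ℕ → A → Set} → ∀ o xs {x} →
  Segment P o xs → P (o + length xs) x → Segment P o (xs ∷ʳ x)
segment-∷ʳ {P = P} o [] {x} _ p = subst (λ i → P i x) (+-identityʳ o) p , tt
segment-∷ʳ {P = P} o (y ∷ ys) {x} (q , qs) p = q ,
  segment-∷ʳ (suc o) ys qs (subst (λ i → P i x) (+-suc o (length ys)) p)

segment-tabulate : ∀ {A : Set} {P : ℕ → A → Set} {n} o (f : Fin n → A) →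
  (∀ i → P (o + toℕ i) (f i)) → Segment P o (tabulate f)
segment-tabulate {n = zero} o f h = tt
segment-tabulate {P = P} {n = suc n} o f h = subst (λ i → P i (f Fin.zero)) (+-identityʳ o) (h Fin.zero) ,
  segment-tabulate (suc o) (f ∘ Fin.suc) λ i → subst (λ j → P j (f (Fin.suc i))) (+-suc o (toℕ i)) (h (Fin.suc i))

-- Registers, products with constants and row-major slots

reg : ℕ → Expr
reg r = load r (const 0)

set : ℕ → Expr → Program
set r e = store r (const 0) e

-- Multiplication by a constant, unrolled. Its cost is proportional to the factor, which depends on
-- `k` alone.
times : ℕ → Expr → Expr
times zero e = const 0
times (suc d) e = add e (times d e)

eval-times : ∀ σ d e → eval σ (times d e) ≡ d * eval σ e
eval-times σ zero e = refl
eval-times σ (suc d) e = cong (eval σ e +_) (eval-times σ d e)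

-- Uniqueness of division with remainder. It keeps the rows of out-slots, of the table `MARK` and of
-- the output apart.
slot-injective : ∀ {D} u u′ {a a′} → a < D → a′ < D → D * u + a ≡ D * u′ + a′ → u ≡ u′ × a ≡ a′
slot-injective {D} zero zero {a} {a′} _ _ eq rewrite *-zeroʳ D = refl , eq
slot-injective {D} zero (suc u′) {a} {a′} a<D _ eq rewrite *-zeroʳ D | *-suc D u′ =
  contradiction (≤-trans (≤-trans (m≤m+n D (D * u′)) (m≤m+n _ a′)) (≤-reflexive (sym eq))) (<⇒≱ a<D)
slot-injective {D} (suc u) zero {a} {a′} _ a′<D eq rewrite *-zeroʳ D | *-suc D u =
  contradiction (≤-trans (≤-trans (m≤m+n D (D * u)) (m≤m+n _ a)) (≤-reflexive eq)) (<⇒≱ a′<D)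
slot-injective {D} (suc u) (suc u′) {a} {a′} a<D a′<D eq rewrite *-suc D u | *-suc D u′
  with slot-injective {D} u u′ a<D a′<D (+-cancelˡ-≡ D _ _ (trans (sym (+-assoc D _ a)) (trans eq (+-assoc D _ a′))))
... | refl , a≡ = refl , a≡

slot-< : ∀ {D n x a} → x < n → a < D → D * x + a < D * n
slot-< {D} {n} {x} {a} x<n a<D = ≤-trans (+-monoʳ-< (D * x) a<D)
  (≤-trans (≤-reflexive (trans (+-comm (D * x) D) (sym (*-suc D x)))) (*-monoʳ-≤ D x<n))

-- Memory layout (registers are cells 0 of arrays of their own)

IN OUTPUT SRC DST ALIVE DEG RANK ORD OUT CNT OUT₁ CNT₁ MARK BASE COL USED COMP : ℕ
IN = 0
OUTPUT = 1
SRC = 2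
DST = 3
ALIVE = 4
DEG = 5
RANK = 6
ORD = 7
OUT = 8
CNT = 9
OUT₁ = 10
CNT₁ = 11
MARK = 12
BASE = 13
COL = 14
USED = 15
COMP = 16

nReg mReg sReg iReg jReg leftReg uReg vReg xReg yReg aReg bReg qReg : ℕ
nReg = 20
mReg = 21
sReg = 22
iReg = 23
jReg = 24
leftReg = 25
uReg = 26
vReg = 27
xReg = 28
yReg = 29
aReg = 30
bReg = 31
qReg = 32

increment : ℕ → Program
increment r = set r (add (const 1) (reg r))

-- The view of `_[_,_]≔_` on a single array: once the array names are literals, a store into the
-- array reduces to this.
upd : (ℕ → ℕ) → ℕ → ℕ → ℕ → ℕ
upd f i x j = if j ≡ᵇ i then x else f j

upd-same : ∀ f i x → upd f i x i ≡ x
upd-same f i x rewrite ≡ᵇ-refl i = refl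

upd-other : ∀ f {i j} x → j ≢ i → upd f i x j ≡ f j
upd-other f x j≢i rewrite ≢⇒≡ᵇ-false j≢i = refl

Holds : (ℕ → ℕ) → ℕ → List ℕ → Set
Holds f = Segment (λ i x → f i ≡ x)

HoldsCells : (ℕ → ℕ) → (ℕ → ℕ) → ℕ → List Cell → Set
HoldsCells f g = Segment (λ i c → f i ≡ proj₁ c × g i ≡ proj₂ c)

holds-push : ∀ {f j v} xs → j ≡ length xs → Holds f 0 xs → Holds (upd f j v) 0 (xs ∷ʳ v)
holds-push {f} {v = v} xs refl h = segment-∷ʳ 0 xs
  (segment-map 0 xs (λ _ i< p → trans (upd-other f v (<⇒≢ i<)) p) h) (upd-same f (length xs) v)

-- Together with `holds-push` this justifies compaction in place: the write position `j` lies before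
-- the unread part, which starts at `o`.
holds-skip : ∀ {f j o v} xs → j < o → Holds f o xs → Holds (upd f j v) o xs
holds-skip {f} {v = v} xs j<o = segment-map _ xs λ o≤i _ p →
  trans (upd-other f v (≢-sym (<⇒≢ (≤-trans j<o o≤i)))) p

cells-push : ∀ {f g j u w} C → j ≡ length C → HoldsCells f g 0 C →
             HoldsCells (upd f j u) (upd g j w) 0 (C ∷ʳ (u , w))
cells-push {f} {g} {u = u} {w} C refl h = segment-∷ʳ 0 C
  (segment-map 0 C (λ _ i< (p , q) → trans (upd-other f u (<⇒≢ i<)) p , trans (upd-other g w (<⇒≢ i<)) q) h)
  (upd-same f (length C) u , upd-same g (length C) w)

cells-skip : ∀ {f g j o u w} C → j < o → HoldsCells f g o C → HoldsCells (upd f j u) (upd g j w) o C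
cells-skip {f} {g} {u = u} {w} C j<o = segment-map _ C λ o≤i _ (p , q) →
  let ne = ≢-sym (<⇒≢ (≤-trans j<o o≤i)) in trans (upd-other f u ne) p , trans (upd-other g w ne) q

length-∷ʳ : {A : Set} (xs : List A) (x : A) → length (xs ∷ʳ x) ≡ suc (length xs)
length-∷ʳ [] x = refl
length-∷ʳ (_ ∷ xs) x = cong suc (length-∷ʳ xs x)

∈-middle : {A : Set} (xs : List A) {x y : A} {ys : List A} → y ∈ xs ++ x ∷ ys → y ≡ x ⊎ y ∈ xs ++ ys
∈-middle [] (here eq) = inj₁ eq
∈-middle [] (there y∈) = inj₂ y∈
∈-middle (z ∷ xs) (here eq) = inj₂ (here eq)
∈-middle (z ∷ xs) (there y∈) with ∈-middle xs y∈
... | inj₁ eq = inj₁ eq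
... | inj₂ y∈′ = inj₂ (there y∈′)

∈-insert : {A : Set} (xs : List A) {x y : A} {ys : List A} → y ∈ xs ++ ys → y ∈ xs ++ x ∷ ys
∈-insert [] y∈ = there y∈
∈-insert (z ∷ xs) (here eq) = here eq
∈-insert (z ∷ xs) (there y∈) = there (∈-insert xs y∈)

unique-middle : {A : Set} (xs : List A) {x : A} {ys : List A} → Unique (xs ++ x ∷ ys) →
                Unique (xs ++ ys) × (∀ {y} → y ∈ xs ++ ys → y ≢ x)
unique-middle [] (x∉ ∷ u) = u , λ y∈ eq → All.lookup x∉ y∈ (sym eq)
unique-middle (z ∷ xs) {x} (z∉ ∷ u) with unique-middle xs u
... | u′ , ne = All.tabulate (λ y∈ → All.lookup z∉ (∈-insert xs y∈)) ∷ u′ , λ where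
  (here refl) eq → All.lookup z∉ (∈-++⁺ʳ xs (here refl)) eq
  (there y∈) eq → ne y∈ eq

-- Peeling: an acyclic orientation of bounded out-degree

module Peeling (n D : ℕ) (Cs : List Cell) (Cs<n : ∀ {u w} → (u , w) ∈ Cs → u < n × w < n) where

  -- Ranks are handed out from n downwards, so vertices still alive, of rank 0, rank below all
  -- removed ones and edges point from larger to smaller rank.
  record Ranked (rank ord : ℕ → ℕ) (alive : List ℕ) (left : ℕ) : Set where
    field
      unique-alive : Unique alive
      alive-zero   : ∀ {v} → v ∈ alive → v < n × rank v ≡ 0
      status       : ∀ {v} → v < n → v ∈ alive ⊎ (left < rank v × rank v ≤ n × ord (rank v) ≡ v)
      filled       : ∀ {r} → left < r → r ≤ n → ord r < n × rank (ord r) ≡ r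
      left≤n       : left ≤ n

  -- The three ways in which a cell leaves the pending list: it is a loop, its reverse leaves the
  -- vertex of higher rank, or it has been given an out-slot.
  Settled : (rank out cnt : ℕ → ℕ) → ℕ → ℕ → Set
  Settled rank out cnt u w = u ≡ w ⊎ rank u < rank w ⊎ ∃[ a ] (a < cnt u × out (D * u + a) ≡ w)

  record Oriented (rank out cnt : ℕ → ℕ) (pending : List Cell) : Set where
    field
      cnt≤D    : ∀ {u} → u < n → cnt u ≤ D
      sound    : ∀ {u a} → u < n → a < cnt u → (u , out (D * u + a)) ∈ Cs × rank (out (D * u + a)) < rank u
      complete : ∀ {u w} → (u , w) ∈ Cs → (u , w) ∈ pending ⊎ Settled rank out cnt u w

  module _ {rank ord alive left} (R : Ranked rank ord alive left) where
    open Ranked R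

    dead : ∀ {v} → v < n → rank v ≢ 0 → left < rank v × rank v ≤ n × ord (rank v) ≡ v
    dead v<n nz with status v<n
    ... | inj₁ v∈ = contradiction (proj₂ (alive-zero v∈)) nz
    ... | inj₂ d = d

    rank-injective : ∀ {u w} → u < n → w < n → rank u ≢ 0 → rank u ≡ rank w → u ≡ w
    rank-injective u<n w<n nz eq with dead u<n nz | dead w<n (nz ∘ trans eq)
    ... | _ , _ , ou | _ , _ , ow = trans (sym ou) (trans (cong ord eq) ow)

  module Removal {rank ord A v rest left} (R : Ranked rank ord (A ++ v ∷ rest) left) (0<left : 0 < left) where
    open Ranked R

    rank′ ord′ : ℕ → ℕ
    rank′ = upd rank v left
    ord′ = upd ord left v

    v-zero : rank v ≡ 0
    v-zero = proj₂ (alive-zero (∈-++⁺ʳ A (here refl)))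

    v<n : v < n
    v<n = proj₁ (alive-zero (∈-++⁺ʳ A (here refl)))

    pred< : left ∸ 1 < left
    pred< = ∸-monoʳ-< z<s 0<left

    others : ∀ {y} → y ∈ A ++ rest → y ≢ v
    others = proj₂ (unique-middle A unique-alive)

    removed : Ranked rank′ ord′ (A ++ rest) (left ∸ 1)
    removed = record
      { unique-alive = proj₁ (unique-middle A unique-alive)
      ; alive-zero = λ {y} y∈ → let y<n , z = alive-zero (∈-insert A y∈) in
          y<n , trans (upd-other rank left (others y∈)) z
      ; status = status′
      ; filled = filled′
      ; left≤n = ≤-trans (<⇒≤ pred<) left≤n
      }
      where
      status′ : ∀ {y} → y < n → y ∈ A ++ rest ⊎ (left ∸ 1 < rank′ y × rank′ y ≤ n × ord′ (rank′ y) ≡ y)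
      status′ {y} y<n with y ≟ v
      ... | yes refl rewrite upd-same rank v left = inj₂ (pred< , left≤n , upd-same ord left v)
      ... | no y≢v with status y<n
      ...   | inj₁ y∈ = [ (λ eq → contradiction eq y≢v) , inj₁ ]′ (∈-middle A y∈)
      ...   | inj₂ (l< , ≤n , o) rewrite upd-other rank left y≢v =
        inj₂ (<-trans pred< l< , ≤n , trans (upd-other ord v (≢-sym (<⇒≢ l<))) o)
      filled′ : ∀ {r} → left ∸ 1 < r → r ≤ n → ord′ r < n × rank′ (ord′ r) ≡ r
      filled′ {r} l<r r≤n with r ≟ left
      ... | yes refl rewrite upd-same ord left v = v<n , upd-same rank v left
      ... | no r≢left rewrite upd-other ord v r≢left =
        let left<r = ≤∧≢⇒< (≤-trans (suc-pred≤ left) l<r) (≢-sym r≢left)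
            o<n , eq = filled left<r r≤n
        in o<n , trans (upd-other rank left (λ o≡v → 0≢r left<r (trans (sym v-zero) (trans (cong rank (sym o≡v)) eq)))) eq
        where
        suc-pred≤ : ∀ l → l ≤ suc (l ∸ 1)
        suc-pred≤ zero = z≤n
        suc-pred≤ (suc l) = ≤-refl
        0≢r : left < r → 0 ≢ r
        0≢r lt refl = contradiction lt λ ()

    -- Only the rank of `v` changes, from 0 to `left`. With rank 0 it was never the larger side, and
    -- as the smaller side it stays below all ranks already given, which exceed `left`.
    rank-<-stable : ∀ {x y} → y < n → rank x < rank y → rank′ x < rank′ y
    rank-<-stable {x} {y} y<n lt with y ≟ v
    ... | yes refl = contradiction (≤-trans lt (≤-reflexive v-zero)) λ ()
    ... | no y≢v rewrite upd-other rank left y≢v with x ≟ v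
    ...   | yes refl rewrite upd-same rank v left = proj₁ (dead R y<n (λ z → contradiction (≤-trans lt (≤-reflexive z)) λ ()))
    ...   | no x≢v rewrite upd-other rank left x≢v = lt

    still-oriented : ∀ {out cnt pending} → Oriented rank out cnt pending → Oriented rank′ out cnt pending
    still-oriented {out} {cnt} O = record
      { cnt≤D = cnt≤D
      ; sound = λ u<n a< → let p , lt = sound u<n a< in p , rank-<-stable u<n lt
      ; complete = λ p → [ inj₁ , inj₂ ∘ settled (proj₂ (Cs<n p)) ]′ (complete p)
      }
      where
      open Oriented O
      settled : ∀ {u w} → w < n → Settled rank out cnt u w → Settled rank′ out cnt u w
      settled w<n (inj₁ eq) = inj₁ eq
      settled w<n (inj₂ (inj₁ lt)) = inj₂ (inj₁ (rank-<-stable w<n lt))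
      settled w<n (inj₂ (inj₂ s)) = inj₂ (inj₂ s)

  module _ {rank out cnt : ℕ → ℕ} {B rest : List Cell} {u w : ℕ} (O : Oriented rank out cnt (B ++ (u , w) ∷ rest)) where
    open Oriented O

    settle : Settled rank out cnt u w → Oriented rank out cnt (B ++ rest)
    settle s = record { cnt≤D = cnt≤D ; sound = sound ; complete = λ p → complete′ (complete p) }
      where
      complete′ : ∀ {x y} → (x , y) ∈ B ++ (u , w) ∷ rest ⊎ Settled rank out cnt x y → (x , y) ∈ B ++ rest ⊎ Settled rank out cnt x y
      complete′ (inj₂ s′) = inj₂ s′
      complete′ (inj₁ p) with ∈-middle B p
      ... | inj₁ refl = inj₂ s
      ... | inj₂ p′ = inj₁ p′

    push-out : u < n → (u , w) ∈ Cs → rank w < rank u → cnt u < D →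
      Oriented rank (upd out (D * u + cnt u) w) (upd cnt u (suc (cnt u))) (B ++ rest)
    push-out u<n uw∈ lt cnt< = record { cnt≤D = cnt≤D′ ; sound = sound′ ; complete = λ p → complete′ p (complete p) }
      where
      out′ = upd out (D * u + cnt u) w
      cnt′ = upd cnt u (suc (cnt u))
      cnt≤D′ : ∀ {x} → x < n → cnt′ x ≤ D
      cnt≤D′ {x} x<n with x ≟ u
      ... | yes refl rewrite upd-same cnt u (suc (cnt u)) = cnt<
      ... | no x≢u rewrite upd-other cnt (suc (cnt u)) x≢u = cnt≤D x<n
      out′-old : ∀ {x a} → x < n → a < cnt x → out′ (D * x + a) ≡ out (D * x + a)
      -- No slot in use is overwritten: a collision would give `x ≡ u` and `a ≡ cnt u`, against
      -- `a < cnt x`.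
      out′-old {x} x<n a< = upd-other out w λ eq →
        let x≡u , a≡ = slot-injective {D} x u (≤-trans a< (cnt≤D x<n)) cnt< eq
        in <-irrefl (trans a≡ (cong cnt (sym x≡u))) a<
      sound′ : ∀ {x a} → x < n → a < cnt′ x → (x , out′ (D * x + a)) ∈ Cs × rank (out′ (D * x + a)) < rank x
      sound′ {x} {a} x<n a< with x ≟ u
      ... | no x≢u rewrite upd-other cnt (suc (cnt u)) x≢u | out′-old x<n a< = sound x<n a<
      ... | yes refl rewrite upd-same cnt u (suc (cnt u)) with a ≟ cnt u
      ...   | yes refl rewrite upd-same out (D * u + cnt u) w = uw∈ , lt
      ...   | no a≢ rewrite out′-old x<n (≤∧≢⇒< (s≤s⁻¹ a<) a≢) = sound x<n (≤∧≢⇒< (s≤s⁻¹ a<) a≢)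
      settled-old : ∀ {x y} → (x , y) ∈ Cs → Settled rank out cnt x y → Settled rank out′ cnt′ x y
      settled-old p (inj₁ eq) = inj₁ eq
      settled-old p (inj₂ (inj₁ l)) = inj₂ (inj₁ l)
      settled-old {x} p (inj₂ (inj₂ (a , a< , eq))) =
        inj₂ (inj₂ (a , grow , trans (out′-old (proj₁ (Cs<n p)) a<) eq))
        where
        grow : a < cnt′ x
        grow with x ≟ u
        ... | yes refl rewrite upd-same cnt u (suc (cnt u)) = m<n⇒m<1+n a<
        ... | no x≢u rewrite upd-other cnt (suc (cnt u)) x≢u = a<
      new : Settled rank out′ cnt′ u w
      new = inj₂ (inj₂ (cnt u , ≤-reflexive (sym (upd-same cnt u (suc (cnt u)))) , upd-same out (D * u + cnt u) w))
      complete′ : ∀ {x y} → (x , y) ∈ Cs → (x , y) ∈ B ++ (u , w) ∷ rest ⊎ Settled rank out cnt x y → (x , y) ∈ B ++ rest ⊎ Settled rank out′ cnt′ x y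
      complete′ xy∈ (inj₂ s) = inj₂ (settled-old xy∈ s)
      complete′ _ (inj₁ p) with ∈-middle B p
      ... | inj₁ refl = inj₂ new
      ... | inj₂ p′ = inj₁ p′

-- Scans and runs of linear cost

below : ℕ → Expr
below r = sub (reg r) (reg iReg)

scan : Program → ℕ → Program → Program
scan init r body = init ⨟ while (below r) body

-- For scans of at most `k * s` items, as a multiple of `s`: the 6 is one test of `below r`, and
-- `suc k` also covers the final test.
scanTime : Program → Program → ℕ → ℕ
scanTime init body k = duration init + suc k * (duration body + 6)

-- A record keeps the size `s` and the factor `c` apart, which unification could not recover from
-- the product `s * c`.
record LinearRun (s c : ℕ) (P : Program) (σ : Memory) (Q : Memory → Set) : Set where
  constructor linear
  field
    steps : Run P σ (s * c) Q

open LinearRun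

lift-const : ∀ {P σ c Q s} → 0 < s → Run P σ c Q → LinearRun s c P σ Q
lift-const {c = c} {s = suc s} _ = linear ∘ weaken (m≤m+n c (s * c)) (λ _ q → q)

lift-loop : ∀ {P σ c Q s} k → 0 < s → Run P σ (suc (k * s) * c) Q → LinearRun s (suc k * c) P σ Q
lift-loop {c = c} {s = s} k 0<s = linear ∘ weaken bound (λ _ q → q)
  where
  open ≤-Reasoning
  bound : suc (k * s) * c ≤ s * (suc k * c)
  bound = begin
    suc (k * s) * c   ≤⟨ *-monoˡ-≤ c (+-monoˡ-≤ (k * s) 0<s) ⟩
    suc k * s * c     ≡⟨ cong (_* c) (*-comm (suc k) s) ⟩
    s * suc k * c     ≡⟨ *-assoc s (suc k) c ⟩
    s * (suc k * c)   ∎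

infixr 4 _thenˡ_

_thenˡ_ : ∀ {P R σ s c c′ Q Q′} → LinearRun s c P σ Q →
  (∀ {τ} → Frame P σ τ → Q τ → LinearRun s c′ R τ Q′) → LinearRun s (c + c′) (P ⨟ R) σ Q′
_thenˡ_ {s = s} {c} {c′} (linear r) k = linear (weaken (≤-reflexive (sym (*-distribˡ-+ s c c′))) (λ _ q → q)
  (r then λ fr q → steps (k fr q)))

conclude : ∀ {s c P σ Q Q′} → (∀ {τ} → Q τ → Q′ τ) → LinearRun s c P σ Q → LinearRun s c P σ Q′
conclude imp (linear r) = linear (weaken ≤-refl (λ _ → imp) r)

scan-each : ∀ {A : Set} {init r body σ s} k {p : IsStores init} → 0 < s → (Inv : List A → Memory → Set) →
  (∀ {ys τ} → Inv ys τ → τ iReg 0 + length ys ≡ τ r 0) →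
  (∀ {y ys τ} → Inv (y ∷ ys) τ → Run body τ (duration body) (Inv ys)) →
  ∀ xs → length xs ≤ k * s → Inv xs (exec init σ) →
  LinearRun s (scanTime init body k) (scan init r body) σ (Inv [])
scan-each {init = init} {r} {body} {σ} {s} k {p} 0<s Inv guard step xs xs≤ inv =
  lift-const 0<s (stores init {Q = _≡ exec init σ} {p} refl) thenˡ λ where
    _ refl → lift-loop k 0<s (for-each-const Inv guard′ (λ _ → step) xs xs≤ inv)
  where
  guard′ : ∀ {ys τ} → Inv ys τ → τ r 0 ∸ τ iReg 0 ≡ length ys
  guard′ {ys} {τ} i = trans (cong (_∸ τ iReg 0) (sym (guard i))) (m+n∸m≡n (τ iReg 0) (length ys))

scan-below : ∀ {init r body σ s B N} k {p : IsStores init} → 0 < s → N ≤ k * s → (Inv : ℕ → Memory → Set) →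
  (∀ {i τ} → Inv i τ → τ r 0 ≡ N × τ iReg 0 ≡ i) →
  (∀ {i τ} → i < N → Frame body (exec init σ) τ → Inv i τ → Run body τ B (Inv (suc i))) →
  Inv 0 (exec init σ) →
  LinearRun s (duration init + suc k * (B + 6)) (scan init r body) σ (Inv N)
scan-below {init} {r} {body} {σ} {s} {B} {N} k {p} 0<s N≤ Inv guard step inv =
  lift-const 0<s (stores init {Q = _≡ exec init σ} {p} refl) thenˡ λ where
    _ refl → lift-loop k 0<s (for-below N N≤ Inv (λ i → let r≡ , i≡ = guard i in cong₂ _∸_ r≡ i≡) step inv)

-- Outside the peeling rounds the size is `suc n`, positive even for the empty graph, so that
-- constant costs can be absorbed.
n≤1*suc : ∀ n → n ≤ 1 * suc n
n≤1*suc n = ≤-trans (n≤1+n n) (≤-reflexive (sym (+-identityʳ (suc n))))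

-- The peeling program and its analysis

resetBody countBody keepVertex dropVertex keepCell : Program
resetBody = store DEG (load ALIVE (reg iReg)) (const 0) ⨟ increment iReg
countBody = store DEG (load SRC (reg iReg)) (add (const 1) (load DEG (load SRC (reg iReg)))) ⨟ increment iReg
keepVertex = store ALIVE (reg jReg) (reg vReg) ⨟ increment jReg
dropVertex = store RANK (reg vReg) (reg leftReg) ⨟ store ORD (reg leftReg) (reg vReg) ⨟
  set leftReg (sub (reg leftReg) (const 1))
keepCell = store SRC (reg jReg) (reg uReg) ⨟ store DST (reg jReg) (reg vReg) ⨟ increment jReg

siftInit sieveInit startScan : Program
startScan = set iReg (const 0)
sieveInit = startScan ⨟ set jReg (const 0) ⨟ set leftReg (reg sReg)
siftInit = set sReg (reg jReg) ⨟ startScan ⨟ set jReg (const 0)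

-- Truncated subtraction serves as comparison: the sieve keeps a vertex when its degree exceeds `D`,
-- and the sift orients a cell when its first end has the larger rank. Otherwise the cell is dropped
-- if its second end is ranked, and if not, both ends are alive and it is kept.
sieveBody orientCell siftBody peelRound peel : ℕ → Program
sieveBody D = (set vReg (load ALIVE (reg iReg)) ⨟ increment iReg) ⨟
  ifnz (sub (load DEG (reg vReg)) (const D)) keepVertex dropVertex
orientCell D = store OUT (add (times D (reg uReg)) (load CNT (reg uReg))) (reg vReg) ⨟
  store CNT (reg uReg) (add (const 1) (load CNT (reg uReg)))
siftBody D = (set uReg (load SRC (reg iReg)) ⨟ set vReg (load DST (reg iReg)) ⨟ increment iReg) ⨟
  ifnz (sub (load RANK (reg uReg)) (load RANK (reg vReg))) (orientCell D)
    (ifnz (load RANK (reg vReg)) skip keepCell)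
peelRound D = scan startScan sReg resetBody ⨟ scan startScan mReg countBody ⨟
  scan sieveInit sReg (sieveBody D) ⨟ scan siftInit mReg (siftBody D) ⨟ set mReg (reg jReg)

-- Peeling runs twice on the same arrays, so `RANK` and `CNT` are cleared explicitly instead of
-- being trusted to be zero.
peelInitBody : Program
peelInitBody = store ALIVE (reg iReg) (reg iReg) ⨟ store RANK (reg iReg) (const 0) ⨟
  store CNT (reg iReg) (const 0) ⨟ increment iReg

peel D = scan startScan nReg peelInitBody ⨟ set sReg (reg nReg) ⨟ while (reg sReg) (peelRound D)

-- `2 * K` bounds the cells per alive vertex and `4 * K` is the degree threshold. In `peelTime` each
-- 3 is a test of `reg sReg`, and the outer factor 2 sums the geometric series of rounds.
roundTime peelTime : ℕ → ℕ
roundTime K = scanTime startScan resetBody 1 + (scanTime startScan countBody (2 * K) +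
  (scanTime sieveInit (sieveBody (4 * K)) 1 + (scanTime siftInit (siftBody (4 * K)) (2 * K) +
  duration (set mReg (reg jReg)))))
peelTime K = scanTime startScan peelInitBody 1 + (duration (set sReg (reg nReg)) + (2 * (roundTime K + 3) + 3))

module PeelingRun (n K : ℕ) (Cs : List Cell) (Cs<n : ∀ {u w} → (u , w) ∈ Cs → u < n × w < n)
  (sparse : ∀ S {C} → Unique C → (∀ {x y} → (x , y) ∈ C → (x , y) ∈ Cs × x ∈ S × y ∈ S) →
            length C ≤ 2 * K * length S) where

  -- Twice the bound `2 * K` on the average out-degree: by the inequality of Markov at most half of
  -- the vertices exceed it.
  D : ℕ
  D = 4 * K

  open Peeling n D Cs Cs<n

  record State (al src dst rank ord out cnt : ℕ → ℕ) (s m : ℕ) (S : List ℕ) (C : List Cell) : Set where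
    field
      s≡       : s ≡ length S
      m≡       : m ≡ length C
      vertices : Holds al 0 S
      cells    : HoldsCells src dst 0 C
      ranked   : Ranked rank ord S (length S)
      oriented : Oriented rank out cnt C
      unique   : Unique C
      inside   : ∀ {u w} → (u , w) ∈ C → (u , w) ∈ Cs × u ∈ S × w ∈ S

  StateOf : Memory → List ℕ → List Cell → Set
  StateOf σ = State (σ ALIVE) (σ SRC) (σ DST) (σ RANK) (σ ORD) (σ OUT) (σ CNT) (σ sReg 0) (σ mReg 0)

  module Round {S : List ℕ} {C : List Cell} (0<s : 0 < length S) where

    s = length S

    -- Only the entries of `S` are cleared, since a round must cost time proportional to `s`; other
    -- entries of `DEG` may be stale.
    ResetInv : List ℕ → Memory → Set
    ResetInv rest τ = StateOf τ S C × Holds (τ ALIVE) (τ iReg 0) rest × τ iReg 0 + length rest ≡ τ sReg 0 ×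
      (∀ {v} → v ∈ S → v ∈ rest ⊎ τ DEG v ≡ 0)

    reset : ∀ {σ} → StateOf σ S C →
      LinearRun s (scanTime startScan resetBody 1) (scan startScan sReg resetBody) σ (ResetInv [])
    reset {σ} st = scan-each 1 0<s ResetInv (λ (_ , _ , g , _) → g) body S (≤-reflexive (sym (+-identityʳ s)))
      (st , State.vertices st , sym (State.s≡ st) , inj₁)
      where
      body : ∀ {y ys τ} → ResetInv (y ∷ ys) τ → Run resetBody τ (duration resetBody) (ResetInv ys)
      body {y} {ys} {τ} (st , (refl , h) , g , z) = stores resetBody
        (st , h , trans (sym (+-suc _ (length ys))) g , z′)
        where
        z′ : ∀ {v} → v ∈ S → v ∈ ys ⊎ upd (τ DEG) y 0 v ≡ 0
        z′ {v} v∈ with v ≟ y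
        ... | yes refl = inj₂ (upd-same (τ DEG) v 0)
        ... | no v≢y with z v∈
        ...   | inj₁ (here eq) = contradiction eq v≢y
        ...   | inj₁ (there v∈ys) = inj₁ v∈ys
        ...   | inj₂ eq = inj₂ (trans (upd-other (τ DEG) 0 v≢y) eq)

    CountInv : List Cell → Memory → Set
    CountInv rest τ = StateOf τ S C × HoldsCells (τ SRC) (τ DST) (τ iReg 0) rest ×
      τ iReg 0 + length rest ≡ τ mReg 0 × (∀ {v} → v ∈ S → τ DEG v + outdeg v rest ≡ outdeg v C)

    C≤ : ∀ σ → StateOf σ S C → length C ≤ 2 * K * s
    C≤ _ st = sparse S (State.unique st) (State.inside st)

    count : ∀ {σ} → ResetInv [] σ →
      LinearRun s (scanTime startScan countBody (2 * K)) (scan startScan mReg countBody) σ (CountInv [])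
    count {σ} (st , _ , _ , z) = scan-each (2 * K) 0<s CountInv (λ (_ , _ , g , _) → g) body C (C≤ σ st)
      (st , State.cells st , sym (State.m≡ st) , λ {v} v∈ → cong (_+ outdeg v C) ([ (λ ()) , id ]′ (z v∈)))
      where
      body : ∀ {y ys τ} → CountInv (y ∷ ys) τ → Run countBody τ (duration countBody) (CountInv ys)
      body {u , _} {ys} {τ} (st , ((refl , _) , h) , g , c) = stores countBody
        (st , h , trans (sym (+-suc _ (length ys))) g , c′)
        where
        c′ : ∀ {v} → v ∈ S → upd (τ DEG) u (1 + τ DEG u) v + outdeg v ys ≡ outdeg v C
        c′ {v} v∈ with v ≟ u | c v∈
        ... | yes refl | eq rewrite upd-same (τ DEG) v (1 + τ DEG v) | δ-same v = trans (sym (+-suc _ _)) eq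
        ... | no v≢u | eq rewrite upd-other (τ DEG) (1 + τ DEG u) v≢u | δ-other v≢u = eq

    -- Survivors are compacted into the front of `ALIVE`, behind the reading position. `fate` later
    -- shows that every vertex of `S` with a nonzero rank was light.
    record Sieved (al src dst deg rank ord out cnt : ℕ → ℕ) (i j s′ m left : ℕ) (rest : List ℕ) : Set where
      field
        {kept}   : List ℕ
        m≡       : m ≡ length C
        cells    : HoldsCells src dst 0 C
        degrees  : ∀ {v} → v ∈ S → deg v ≡ outdeg v C
        prefix   : Holds al 0 kept
        suffix   : Holds al i rest
        j≡       : j ≡ length kept
        j≤i      : j ≤ i
        i+rest   : i + length rest ≡ s′
        left≡    : left ≡ length (kept ++ rest)
        ranked   : Ranked rank ord (kept ++ rest) left
        oriented : Oriented rank out cnt C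
        fate     : ∀ {v} → v ∈ S → v ∈ rest ⊎ (v ∈ kept × D < outdeg v C) ⊎ (rank v ≢ 0 × outdeg v C ≤ D)
        within   : ∀ {v} → v ∈ kept ++ rest → v ∈ S
        heavy    : ∀ {v} → v ∈ kept → D < outdeg v C
        cnt-zero : ∀ {v} → v ∈ S → cnt v ≡ 0

    SieveInv : List ℕ → Memory → Set
    SieveInv rest τ = Sieved (τ ALIVE) (τ SRC) (τ DST) (τ DEG) (τ RANK) (τ ORD) (τ OUT) (τ CNT)
      (τ iReg 0) (τ jReg 0) (τ sReg 0) (τ mReg 0) (τ leftReg 0) rest

    sieve-body : ∀ {y ys τ} → SieveInv (y ∷ ys) τ → Run (sieveBody D) τ (duration (sieveBody D)) (SieveInv ys)
    sieve-body {y} {ys} {τ} inv with Sieved.suffix inv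
    ... | refl , suffix′ = stores-then _ (branch keep drop)
      where
      open Sieved inv
      v = τ ALIVE (τ iReg 0)
      σ₁ = exec (set vReg (load ALIVE (reg iReg)) ⨟ increment iReg) τ
      v∈S : v ∈ S
      v∈S = within (∈-++⁺ʳ kept (here refl))
      keep : τ DEG v ∸ D ≢ 0 → Run keepVertex σ₁ (duration keepVertex) (SieveInv ys)
      keep nz = stores keepVertex record
        { kept = kept ∷ʳ v
        ; m≡ = m≡ ; cells = cells ; degrees = degrees
        ; prefix = holds-push kept j≡ prefix
        ; suffix = holds-skip ys (s≤s j≤i) suffix′
        ; j≡ = trans (cong suc j≡) (sym (length-∷ʳ kept v))
        ; j≤i = s≤s j≤i
        ; i+rest = trans (sym (+-suc _ (length ys))) i+rest
        ; left≡ = trans left≡ (cong length (sym (∷ʳ-++ kept v ys)))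
        ; ranked = subst (λ xs → Ranked (τ RANK) (τ ORD) xs (τ leftReg 0)) (sym (∷ʳ-++ kept v ys)) ranked
        ; oriented = oriented
        ; fate = λ u∈ → fate′ (fate u∈)
        ; within = λ u∈ → within (subst (_ ∈_) (∷ʳ-++ kept v ys) u∈)
        ; heavy = heavy′
        ; cnt-zero = cnt-zero
        }
        where
        D<v : D < outdeg v C
        D<v = subst (D <_) (degrees v∈S) (m∸n≢0⇒n<m {_} {D} nz)
        fate′ : ∀ {u} → u ∈ v ∷ ys ⊎ (u ∈ kept × D < outdeg u C) ⊎ (τ RANK u ≢ 0 × outdeg u C ≤ D) →
                u ∈ ys ⊎ (u ∈ kept ∷ʳ v × D < outdeg u C) ⊎ (τ RANK u ≢ 0 × outdeg u C ≤ D)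
        fate′ (inj₁ (here refl)) = inj₂ (inj₁ (∈-++⁺ʳ kept (here refl) , D<v))
        fate′ (inj₁ (there u∈)) = inj₁ u∈
        fate′ (inj₂ (inj₁ (u∈ , h))) = inj₂ (inj₁ (∈-++⁺ˡ u∈ , h))
        fate′ (inj₂ (inj₂ f)) = inj₂ (inj₂ f)
        heavy′ : ∀ {u} → u ∈ kept ∷ʳ v → D < outdeg u C
        heavy′ u∈ with ∈-++⁻ kept u∈
        ... | inj₁ u∈′ = heavy u∈′
        ... | inj₂ (here refl) = D<v
      drop : τ DEG v ∸ D ≡ 0 → Run dropVertex σ₁ (duration dropVertex) (SieveInv ys)
      drop z = stores dropVertex record
        { kept = kept
        ; m≡ = m≡ ; cells = cells ; degrees = degrees
        ; prefix = prefix
        ; suffix = suffix′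
        ; j≡ = j≡
        ; j≤i = m≤n⇒m≤1+n j≤i
        ; i+rest = trans (sym (+-suc _ (length ys))) i+rest
        ; left≡ = cong (_∸ 1) (trans left≡ length≡)
        ; ranked = removed
        ; oriented = still-oriented oriented
        ; fate = λ {u} u∈ → fate′ u (fate u∈)
        ; within = λ u∈ → within (∈-insert kept u∈)
        ; heavy = heavy
        ; cnt-zero = cnt-zero
        }
        where
        length≡ : length (kept ++ v ∷ ys) ≡ suc (length (kept ++ ys))
        length≡ = trans (length-++ kept) (trans (+-suc (length kept) (length ys)) (cong suc (sym (length-++ kept))))
        0<left : 0 < τ leftReg 0
        0<left = ≤-trans (s≤s z≤n) (≤-reflexive (sym (trans left≡ length≡)))
        open Removal {A = kept} ranked 0<left
        v≤D : outdeg v C ≤ D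
        v≤D = subst (_≤ D) (degrees v∈S) (m∸n≡0⇒m≤n z)
        fate′ : ∀ u → u ∈ v ∷ ys ⊎ (u ∈ kept × D < outdeg u C) ⊎ (τ RANK u ≢ 0 × outdeg u C ≤ D) →
                u ∈ ys ⊎ (u ∈ kept × D < outdeg u C) ⊎ (rank′ u ≢ 0 × outdeg u C ≤ D)
        fate′ u (inj₁ (there u∈)) = inj₁ u∈
        fate′ u (inj₂ (inj₁ f)) = inj₂ (inj₁ f)
        fate′ u (inj₁ (here refl)) = inj₂ (inj₂ ((λ eq → <-irrefl (sym (trans (sym (upd-same (τ RANK) v _)) eq)) 0<left) , v≤D))
        fate′ u (inj₂ (inj₂ (nz , l))) = inj₂ (inj₂ ((λ eq → nz (trans (sym (upd-other (τ RANK) _ u≢v)) eq)) , l))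
          where
          u≢v : u ≢ v
          u≢v refl = nz v-zero

    sieve : ∀ {σ} → CountInv [] σ →
      LinearRun s (scanTime sieveInit (sieveBody D) 1) (scan sieveInit sReg (sieveBody D)) σ (SieveInv [])
    sieve {σ} (st , _ , _ , c) = scan-each 1 0<s SieveInv Sieved.i+rest sieve-body S (≤-reflexive (sym (+-identityʳ s)))
      record
        { kept = []
        ; m≡ = m≡ ; cells = cells
        ; degrees = λ v∈ → trans (sym (+-identityʳ _)) (c v∈)
        ; prefix = tt
        ; suffix = vertices
        ; j≡ = refl ; j≤i = z≤n ; i+rest = sym s≡ ; left≡ = s≡
        ; ranked = subst (Ranked (σ RANK) (σ ORD) S) (sym s≡) ranked
        ; oriented = oriented
        ; fate = inj₁
        ; within = id
        ; heavy = λ ()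
        ; cnt-zero = cnt-zero
        }
      where
      open State st
      cnt-zero : ∀ {v} → v ∈ S → σ CNT v ≡ 0
      -- An alive vertex has rank 0, and an out-neighbour would need a smaller rank.
      cnt-zero {v} v∈ with σ CNT v in eq | Ranked.alive-zero ranked v∈
      ... | zero | _ = refl
      ... | suc c′ | v<n , rz = contradiction
        (≤-trans (proj₂ (Oriented.sound oriented {a = 0} v<n (≤-trans z<s (≤-reflexive (sym eq))))) (≤-reflexive rz)) λ ()

    -- `room` guarantees a free slot: a vertex ranked in this round starts with no slots and at most
    -- `D` cells, and slots filled plus cells ahead never grow.
    record Sifted (al src dst rank ord out cnt : ℕ → ℕ) (i j s′ m : ℕ) (kept : List ℕ) (rest : List Cell) : Set where
      field
        {kept-cells} : List Cell
        s≡       : s′ ≡ length kept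
        vertices : Holds al 0 kept
        prefix   : HoldsCells src dst 0 kept-cells
        suffix   : HoldsCells src dst i rest
        j≡       : j ≡ length kept-cells
        j≤i      : j ≤ i
        i+rest   : i + length rest ≡ m
        ranked   : Ranked rank ord kept (length kept)
        oriented : Oriented rank out cnt (kept-cells ++ rest)
        unique   : Unique (kept-cells ++ rest)
        within   : ∀ {c} → c ∈ kept-cells ++ rest → c ∈ C
        alive    : ∀ {u w} → (u , w) ∈ kept-cells → rank u ≡ 0 × rank w ≡ 0
        room     : ∀ {u} → u ∈ S → rank u ≢ 0 → cnt u + outdeg u rest ≤ D
        half     : 2 * length kept ≤ s

    module Sift (inside : ∀ {u w} → (u , w) ∈ C → (u , w) ∈ Cs × u ∈ S × w ∈ S) where

      SiftInv : List Cell → Memory → Set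
      SiftInv rest τ = ∃[ kept ] Sifted (τ ALIVE) (τ SRC) (τ DST) (τ RANK) (τ ORD) (τ OUT) (τ CNT)
        (τ iReg 0) (τ jReg 0) (τ sReg 0) (τ mReg 0) kept rest

      sift-body : ∀ {y ys τ} → SiftInv (y ∷ ys) τ → Run (siftBody D) τ (duration (siftBody D)) (SiftInv ys)
      sift-body {u , w} {ys} {τ} (kept , inv) with Sifted.suffix inv
      ... | (refl , refl) , suffix′ = stores-then _ (branch orient (λ z → branch (forget z) (keep z)))
        where
        open Sifted inv
        σ₁ = exec (set uReg (load SRC (reg iReg)) ⨟ set vReg (load DST (reg iReg)) ⨟ increment iReg) τ
        uw∈C : (u , w) ∈ C
        uw∈C = within (∈-++⁺ʳ kept-cells (here refl))
        uw∈Cs = proj₁ (inside uw∈C)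
        u<n = proj₁ (Cs<n uw∈Cs)
        w<n = proj₂ (Cs<n uw∈Cs)
        i+rest′ = trans (sym (+-suc (τ iReg 0) (length ys))) i+rest
        room′ : ∀ {x} → x ∈ S → τ RANK x ≢ 0 → τ CNT x + outdeg x ys ≤ D
        room′ {x} x∈ nz = ≤-trans (+-monoʳ-≤ (τ CNT x) (m≤n+m (outdeg x ys) (δ x u))) (room x∈ nz)
        orient : τ RANK u ∸ τ RANK w ≢ 0 → Run (orientCell D) σ₁ (duration (orientCell D)) (SiftInv ys)
        orient nz = stores (orientCell D) (kept , record
          { s≡ = s≡ ; vertices = vertices ; prefix = prefix ; suffix = suffix′ ; j≡ = j≡
          ; j≤i = m≤n⇒m≤1+n j≤i ; i+rest = i+rest′ ; ranked = ranked
          ; oriented = subst (λ k → Oriented (τ RANK) (upd (τ OUT) (k + τ CNT u) w) (upd (τ CNT) u (suc (τ CNT u))) (kept-cells ++ ys))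
              (sym (eval-times σ₁ D (reg uReg))) (push-out {B = kept-cells} oriented u<n uw∈Cs lt cnt<)
          ; unique = proj₁ (unique-middle kept-cells unique)
          ; within = within ∘ ∈-insert kept-cells
          ; alive = alive
          ; room = room″
          ; half = half
          })
          where
          lt : τ RANK w < τ RANK u
          lt = m∸n≢0⇒n<m nz
          ru≢0 : τ RANK u ≢ 0
          ru≢0 z = contradiction (≤-trans lt (≤-reflexive z)) λ ()
          room-u : suc (τ CNT u + outdeg u ys) ≤ D
          room-u = ≤-trans (≤-reflexive (trans (sym (+-suc (τ CNT u) (outdeg u ys)))
            (cong (λ k → τ CNT u + (k + outdeg u ys)) (sym (δ-same u))))) (room (proj₁ (proj₂ (inside uw∈C))) ru≢0)
          cnt< : τ CNT u < D
          cnt< = ≤-trans (s≤s (m≤m+n (τ CNT u) (outdeg u ys))) room-u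
          room″ : ∀ {x} → x ∈ S → τ RANK x ≢ 0 → upd (τ CNT) u (suc (τ CNT u)) x + outdeg x ys ≤ D
          room″ {x} x∈ nz with x ≟ u
          ... | yes refl rewrite upd-same (τ CNT) x (suc (τ CNT x)) = room-u
          ... | no x≢u rewrite upd-other (τ CNT) (suc (τ CNT u)) x≢u = room′ x∈ nz
        forget : τ RANK u ∸ τ RANK w ≡ 0 → τ RANK w ≢ 0 → Run skip σ₁ 1 (SiftInv ys)
        forget z nz = stores skip (kept , record
          { s≡ = s≡ ; vertices = vertices ; prefix = prefix ; suffix = suffix′ ; j≡ = j≡
          ; j≤i = m≤n⇒m≤1+n j≤i ; i+rest = i+rest′ ; ranked = ranked
          ; oriented = settle {B = kept-cells} oriented settled
          ; unique = proj₁ (unique-middle kept-cells unique)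
          ; within = within ∘ ∈-insert kept-cells
          ; alive = alive
          ; room = room′
          ; half = half
          })
          where
          settled : Settled (τ RANK) (τ OUT) (τ CNT) u w
          -- Either the reverse cell takes care of the edge, or the ranks are equal and nonzero,
          -- hence the cell is a loop.
          settled with m≤n⇒m<n∨m≡n (m∸n≡0⇒m≤n {τ RANK u} z)
          ... | inj₁ lt = inj₂ (inj₁ lt)
          ... | inj₂ eq = inj₁ (sym (rank-injective ranked w<n u<n nz (sym eq)))
        keep : τ RANK u ∸ τ RANK w ≡ 0 → τ RANK w ≡ 0 → Run keepCell σ₁ (duration keepCell) (SiftInv ys)
        keep z wz = stores keepCell (kept , record
          { kept-cells = kept-cells ∷ʳ (u , w)
          ; s≡ = s≡ ; vertices = vertices
          ; prefix = cells-push kept-cells j≡ prefix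
          ; suffix = cells-skip ys (s≤s j≤i) suffix′
          ; j≡ = trans (cong suc j≡) (sym (length-∷ʳ kept-cells (u , w)))
          ; j≤i = s≤s j≤i ; i+rest = i+rest′ ; ranked = ranked
          ; oriented = subst (Oriented (τ RANK) (τ OUT) (τ CNT)) (sym assoc) oriented
          ; unique = subst Unique (sym assoc) unique
          ; within = λ c∈ → within (subst (_ ∈_) assoc c∈)
          ; alive = alive′
          ; room = room′
          ; half = half
          })
          where
          assoc = ∷ʳ-++ kept-cells (u , w) ys
          alive′ : ∀ {x y} → (x , y) ∈ kept-cells ∷ʳ (u , w) → τ RANK x ≡ 0 × τ RANK y ≡ 0
          alive′ p with ∈-++⁻ kept-cells p
          ... | inj₁ p′ = alive p′
          ... | inj₂ (here refl) = n≤0⇒n≡0 (≤-trans (m∸n≡0⇒m≤n {τ RANK u} z) (≤-reflexive wz)) , wz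

    -- A majority of heavy vertices would have more outgoing cells than there are.
    few-heavy : ∀ {kept} → Unique kept → (∀ {v} → v ∈ kept → D < outdeg v C) → length C ≤ 2 * K * s →
                2 * length kept ≤ s
    few-heavy {kept} uniq heavy C≤ = ≮⇒≥ λ lt → <-irrefl refl (begin-strict
      4 * K * a              <⟨ m<n+m (4 * K * a) (a>0 lt) ⟩
      suc (4 * K) * a        ≤⟨ sum-map-const (λ v → outdeg v C) kept heavy ⟩
      sum (map (λ v → outdeg v C) kept) ≤⟨ sum-outdeg≤ uniq C ⟩
      length C               ≤⟨ C≤ ⟩
      2 * K * s              ≤⟨ *-monoʳ-≤ (2 * K) (<⇒≤ lt) ⟩
      2 * K * (2 * a)        ≡⟨ *-assoc (2 * K) 2 a ⟨
      2 * K * 2 * a          ≡⟨ cong (_* a) (trans (*-comm (2 * K) 2) (sym (*-assoc 2 2 K))) ⟩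
      4 * K * a              ∎)
      where
      open ≤-Reasoning
      a = length kept
      a>0 : s < 2 * a → 0 < a
      a>0 lt = *-cancelˡ-< 2 0 a (≤-trans (s≤s z≤n) lt)

    sift : ∀ {σ} → length C ≤ 2 * K * s → Unique C →
      (ins : ∀ {u w} → (u , w) ∈ C → (u , w) ∈ Cs × u ∈ S × w ∈ S) → SieveInv [] σ →
      LinearRun s (scanTime siftInit (siftBody D) (2 * K)) (scan siftInit mReg (siftBody D)) σ (Sift.SiftInv ins [])
    sift {σ} C≤ uniqC ins inv = scan-each (2 * K) 0<s SiftInv (λ (_ , i) → Sifted.i+rest i) sift-body C C≤
      (kept , record
        { kept-cells = []
        ; s≡ = j≡ ; vertices = prefix ; prefix = tt ; suffix = cells ; j≡ = refl ; j≤i = z≤n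
        ; i+rest = sym m≡
        ; ranked = ranked′
        ; oriented = oriented ; unique = uniqC ; within = id ; alive = λ ()
        ; room = room
        ; half = few-heavy (Ranked.unique-alive ranked′) heavy C≤
        })
      where
      open Sift ins
      open Sieved inv
      kept≡ : kept ++ [] ≡ kept
      kept≡ = ++-identityʳ kept
      ranked′ : Ranked (σ RANK) (σ ORD) kept (length kept)
      ranked′ = subst₂ (Ranked (σ RANK) (σ ORD)) kept≡ (trans left≡ (cong length kept≡)) ranked
      room : ∀ {u} → u ∈ S → σ RANK u ≢ 0 → σ CNT u + outdeg u C ≤ D
      room u∈ nz with fate u∈
      ... | inj₂ (inj₁ (u∈k , _)) = contradiction (proj₂ (Ranked.alive-zero ranked′ u∈k)) nz
      ... | inj₂ (inj₂ (_ , le)) = ≤-trans (≤-reflexive (cong (_+ outdeg _ C) (cnt-zero u∈))) le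

    round : ∀ {σ} → StateOf σ S C → LinearRun s (roundTime K) (peelRound D) σ
      (λ τ → ∃[ s′ ] (2 * s′ ≤ s × ∃[ S′ ] ∃[ C′ ] (s′ ≡ length S′ × StateOf τ S′ C′)))
    round {σ} st = reset st thenˡ λ _ r → count r thenˡ λ _ c → sieve c thenˡ λ _ v →
      sift (C≤ σ st) (State.unique st) (State.inside st) v thenˡ λ _ → finish
      where
      open Sift (State.inside st)
      finish : ∀ {τ} → SiftInv [] τ → LinearRun s (duration (set mReg (reg jReg))) (set mReg (reg jReg)) τ
        (λ υ → ∃[ s′ ] (2 * s′ ≤ s × ∃[ S′ ] ∃[ C′ ] (s′ ≡ length S′ × StateOf υ S′ C′)))
      finish {τ} (kept , inv) = lift-const 0<s (stores (set mReg (reg jReg))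
        (length kept , half , kept , kept-cells , refl , record
          { s≡ = s≡ ; m≡ = j≡ ; vertices = vertices ; cells = prefix ; ranked = ranked
          ; oriented = subst (Oriented (τ RANK) (τ OUT) (τ CNT)) (++-identityʳ kept-cells) oriented
          ; unique = subst Unique (++-identityʳ kept-cells) unique
          ; inside = λ c∈ → inside′ c∈ (proj₁ (State.inside st (within (∈-++⁺ˡ c∈))))
          }))
        where
        open Sifted inv
        -- Kept cells have two ends of rank 0, and those are the survivors; so sparsity applies
        -- again in the next round.
        survivor : ∀ {x} → x < n → τ RANK x ≡ 0 → x ∈ kept
        survivor x<n z with Ranked.status ranked x<n
        ... | inj₁ x∈ = x∈
        ... | inj₂ (lt , _) = contradiction (≤-trans lt (≤-reflexive z)) λ ()
        inside′ : ∀ {u w} → (u , w) ∈ kept-cells → (u , w) ∈ Cs → (u , w) ∈ Cs × u ∈ kept × w ∈ kept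
        inside′ c∈ c∈Cs = c∈Cs , survivor (proj₁ (Cs<n c∈Cs)) (proj₁ (alive c∈)) ,
          survivor (proj₂ (Cs<n c∈Cs)) (proj₂ (alive c∈))

  record Peeled (rank ord out cnt : ℕ → ℕ) : Set where
    field
      ranked   : Ranked rank ord [] 0
      oriented : Oriented rank out cnt []

  PeeledOf : Memory → Set
  PeeledOf σ = Peeled (σ RANK) (σ ORD) (σ OUT) (σ CNT)

  InitInv : ℕ → Memory → Set
  InitInv i τ = τ nReg 0 ≡ n × τ mReg 0 ≡ length Cs × HoldsCells (τ SRC) (τ DST) 0 Cs × τ iReg 0 ≡ i ×
    (∀ {v} → v < i → τ ALIVE v ≡ v × τ RANK v ≡ 0 × τ CNT v ≡ 0)

  peel-run : ∀ {σ} → σ nReg 0 ≡ n → σ mReg 0 ≡ length Cs → HoldsCells (σ SRC) (σ DST) 0 Cs → Unique Cs →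
    LinearRun (suc n) (peelTime K) (peel D) σ PeeledOf
  peel-run {σ} n≡ m≡ cells uniq =
    initialise thenˡ λ {τ} _ init →
    lift-const z<s (stores (set sReg (reg nReg)) {Q = RoundInv n} (start {τ} init)) thenˡ λ _ inv →
    rounds inv
    where
    RoundInv : ℕ → Memory → Set
    RoundInv s τ = ∃[ S ] ∃[ C ] (s ≡ length S × StateOf τ S C)
    guard : ∀ {s τ} → RoundInv s τ → τ sReg 0 ≡ s
    guard (_ , _ , eq , st) = trans (State.s≡ st) (sym eq)
    round′ : ∀ {s τ} → 0 < s → RoundInv s τ → Run (peelRound D) τ (s * roundTime K)
               (λ υ → ∃[ s′ ] (2 * s′ ≤ s × RoundInv s′ υ))
    round′ 0<s (S , C , refl , st) = steps (Round.round 0<s st)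
    body : ∀ {i τ} → InitInv i τ → Run peelInitBody τ (duration peelInitBody) (InitInv (suc i))
    body {i} {τ} (n≡′ , m≡′ , cells′ , refl , h) = stores peelInitBody (n≡′ , m≡′ , cells′ , refl , h′)
      where
      h′ : ∀ {v} → v < suc i → upd (τ ALIVE) i i v ≡ v × upd (τ RANK) i 0 v ≡ 0 × upd (τ CNT) i 0 v ≡ 0
      h′ {v} v< with v ≟ i
      ... | yes refl = upd-same (τ ALIVE) v v , upd-same (τ RANK) v 0 , upd-same (τ CNT) v 0
      ... | no v≢i with h (≤∧≢⇒< (s≤s⁻¹ v<) v≢i)
      ...   | p , q , r = trans (upd-other (τ ALIVE) i v≢i) p , trans (upd-other (τ RANK) 0 v≢i) q ,
                          trans (upd-other (τ CNT) 0 v≢i) r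
    initialise : LinearRun (suc n) (scanTime startScan peelInitBody 1) (scan startScan nReg peelInitBody) σ (InitInv n)
    initialise = scan-below 1 z<s (n≤1*suc n) InitInv (λ (n≡′ , _ , _ , i≡ , _) → n≡′ , i≡) (λ _ _ → body)
      (n≡ , m≡ , cells , refl , λ ())
    start : ∀ {τ} → InitInv n τ → RoundInv n (exec (set sReg (reg nReg)) τ)
    start {τ} (n≡′ , m≡′ , cells′ , _ , h) = upTo n , Cs , sym (length-upTo n) , record
      { s≡ = trans n≡′ (sym (length-upTo n))
      ; m≡ = m≡′
      ; vertices = holds-upTo
      ; cells = cells′
      ; ranked = record
        { unique-alive = UniqueP.upTo⁺ n
        ; alive-zero = λ v∈ → ∈-upTo⁻ v∈ , proj₁ (proj₂ (h (∈-upTo⁻ v∈)))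
        ; status = λ v<n → inj₁ (∈-upTo⁺ v<n)
        ; filled = λ l<r r≤n → contradiction r≤n (<⇒≱ (subst (_< _) (length-upTo n) l<r))
        ; left≤n = ≤-reflexive (length-upTo n)
        }
      ; oriented = record
        { cnt≤D = λ u<n → subst (_≤ D) (sym (proj₂ (proj₂ (h u<n)))) z≤n
        ; sound = λ u<n a< → contradiction (subst (_ <_) (proj₂ (proj₂ (h u<n))) a<) λ ()
        ; complete = inj₁
        }
      ; unique = uniq
      ; inside = λ c∈ → c∈ , ∈-upTo⁺ (proj₁ (Cs<n c∈)) , ∈-upTo⁺ (proj₂ (Cs<n c∈))
      }
      where
      holds-applyUpTo : ∀ m (f : ℕ → ℕ) o → (∀ {i} → i < m → τ ALIVE (o + i) ≡ f i) →
                        Holds (τ ALIVE) o (applyUpTo f m)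
      holds-applyUpTo zero f o g = tt
      holds-applyUpTo (suc m) f o g = trans (cong (τ ALIVE) (sym (+-identityʳ o))) (g z<s) ,
        holds-applyUpTo m (f ∘ suc) (suc o) λ {i} i< → trans (cong (τ ALIVE) (sym (+-suc o i))) (g (s≤s i<))
      holds-upTo : Holds (τ ALIVE) 0 (upTo n)
      holds-upTo = holds-applyUpTo n id 0 (λ i< → proj₁ (h i<))
    finish : ∀ {τ} → RoundInv 0 τ → PeeledOf τ
    finish {τ} ([] , C , refl , st) = record { ranked = State.ranked st ; oriented = oriented′ }
      where
      open Oriented (State.oriented st)
      oriented′ : Oriented (τ RANK) (τ OUT) (τ CNT) []
      -- A pending cell would have its ends in the empty list of alive vertices.
      oriented′ = record { cnt≤D = cnt≤D ; sound = sound ; complete = λ p →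
        [ (λ q → contradiction (proj₁ (proj₂ (State.inside st q))) λ ()) , inj₂ ]′ (complete p) }
    rounds : ∀ {τ} → RoundInv n τ → LinearRun (suc n) (2 * (roundTime K + 3) + 3) (while (reg sReg) (peelRound D)) τ PeeledOf
    rounds inv = linear (weaken bound (λ {τ} _ → finish {τ})
      (while-halving {B = roundTime K} RoundInv (λ {_} {τ} → guard {_} {τ}) (λ 0<s _ → round′ 0<s) n inv))
      where
      X = 2 * (roundTime K + 3)
      bound : n * X + 3 ≤ suc n * (X + 3)
      bound = ≤-trans (+-mono-≤ (*-monoˡ-≤ X (n≤1+n n)) (m≤m+n 3 (n * 3))) (≤-reflexive (sym (*-distribˡ-+ (suc n) X 3)))

-- From a tree decomposition to a tree of lists

elements : ∀ {n} → Subset n → List ℕ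
elements [] = []
elements (true ∷ p) = 0 ∷ map suc (elements p)
elements (false ∷ p) = map suc (elements p)

length-elements : ∀ {n} (p : Subset n) → length (elements p) ≡ ∣ p ∣
length-elements [] = refl
length-elements (true ∷ p) = cong suc (trans (length-map suc (elements p)) (length-elements p))
length-elements (false ∷ p) = trans (length-map suc (elements p)) (length-elements p)

∈-elements⁺ : ∀ {n} {v : Fin n} (p : Subset n) → v ∈ₛ p → toℕ v ∈ elements p
∈-elements⁺ (true ∷ p) Vec.here = here refl
∈-elements⁺ (true ∷ p) (Vec.there v∈) = there (∈-map⁺ suc (∈-elements⁺ p v∈))
∈-elements⁺ (false ∷ p) (Vec.there v∈) = ∈-map⁺ suc (∈-elements⁺ p v∈)

∈-elements⁻ : ∀ {n x} (p : Subset n) → x ∈ elements p → ∃[ v ] (toℕ v ≡ x × v ∈ₛ p)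
∈-elements⁻ (true ∷ p) (here refl) = Fin.zero , refl , Vec.here
∈-elements⁻ (true ∷ p) (there x∈) with ∈-map⁻ suc x∈
... | y , y∈ , refl with ∈-elements⁻ p y∈
...   | v , refl , v∈ = Fin.suc v , refl , Vec.there v∈
∈-elements⁻ (false ∷ p) x∈ with ∈-map⁻ suc x∈
... | y , y∈ , refl with ∈-elements⁻ p y∈
...   | v , refl , v∈ = Fin.suc v , refl , Vec.there v∈

-- A negative `k` leaves only `m ≡ 0`, so the absolute value gives a valid bound among the naturals.
pred-≤ : ∀ m k → ℤ.+ m ℤ.- ℤ.1ℤ ℤ.≤ k → m ≤ suc ℤ.∣ k ∣
pred-≤ zero k _ = z≤n
pred-≤ (suc m) (ℤ.+ k) (ℤ.+≤+ m≤k) = s≤s m≤k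

module FromDecomposition {n : ℕ} {G : Graph n} (D : TreeDecomposition G) {k : ℤ}
  (width≤k : TreeDecomposition.width D ℤ.≤ k) where
  open TreeDecomposition D

  bagTree : BagTree (suc ℤ.∣ k ∣)
  bagTree = record
    { nodes = nodes ; tree = tree ; isTree = isTree
    ; bag = elements ∘ bag
    ; bag≤K = λ i → ≤-trans (≤-reflexive (length-elements (bag i)))
        (≤-trans (All.lookup (xs≤max 0 (map (λ j → ∣ bag j ∣) (allFin nodes))) (∈-map⁺ (λ j → ∣ bag j ∣) (∈-allFin i)))
          (pred-≤ _ k width≤k))
    ; subtree = walk
    }
    where
    walk : ∀ x i j → x ∈ elements (bag i) → x ∈ elements (bag j) →
           WalkInside tree (λ l → x ∈ elements (bag l)) i j
    walk x i j x∈i x∈j with ∈-elements⁻ (bag i) x∈i | ∈-elements⁻ (bag j) x∈j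
    ... | v , refl , v∈i | w , w≡v , w∈j with toℕ-injective w≡v
    ...   | refl = Star.map (λ (e , p , q) → e , ∈-elements⁺ (bag _) p , ∈-elements⁺ (bag _) q) (subtree v i j v∈i w∈j)

  edge-shares : ∀ {u v} → Graph.Adj G u v → BagTree.Share bagTree (toℕ u) (toℕ v)
  edge-shares {u} {v} e with coversE u v e
  ... | i , u∈ , v∈ = i , ∈-elements⁺ (bag i) u∈ , ∈-elements⁺ (bag i) v∈

-- Reading the input

readCell readVertex readInit readInput : Program
readCell = store SRC (reg mReg) (reg iReg) ⨟ store DST (reg mReg) (load IN (reg qReg)) ⨟
  increment mReg ⨟ increment qReg ⨟ set jReg (sub (reg jReg) (const 1))
readVertex = (set jReg (load IN (reg qReg)) ⨟ increment qReg) ⨟ while (reg jReg) readCell ⨟ increment iReg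
readInit = set nReg (load IN (const 0)) ⨟ set qReg (const 1)
readInput = readInit ⨟ while (below nReg) readVertex

-- The 3 tests `jReg`. The 17 is 11 for fetching the degree plus 6 for advancing `iReg`; the
-- additional `cellTime` pays for the last test of the inner loop.
cellTime vertexTime : ℕ
cellTime = duration readCell + 3
vertexTime = 17 + cellTime

readTime : ℕ → ℕ
readTime K = duration readInit + (vertexTime + 2 * K * cellTime + 6)

holds-nth : ∀ {f} xs o → (∀ i → f (o + i) ≡ nth xs i) → Holds f o xs
holds-nth [] o h = tt
holds-nth {f} (x ∷ xs) o h = trans (cong f (sym (+-identityʳ o))) (h 0) ,
  holds-nth xs (suc o) (λ i → trans (cong f (sym (+-suc o i))) (h (suc i)))

visit-sum : ∀ a b c l L r → a + (suc l * c + b) + (L * (a + b + c) + r * c) ≡ suc L * (a + b + c) + (l + r) * c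
visit-sum = solve 6 (λ a b c l L r →
  a :+ ((con 1 :+ l) :* c :+ b) :+ (L :* (a :+ b :+ c) :+ r :* c) := (con 1 :+ L) :* (a :+ b :+ c) :+ (l :+ r) :* c) refl
  where open +-*-Solver

module Reading {n : ℕ} {G : Graph n} (L : AdjacencyLists G) where
  open AdjacencyLists L
  open Graph G using (Adj)

  vertexCells : Fin n → List Cell
  vertexCells u = map (λ w → toℕ u , toℕ w) (neighbours u)

  inputCells : List Cell
  inputCells = concatMap vertexCells (allFin n)

  inputCells⁻ : ∀ {x y} → (x , y) ∈ inputCells → ∃[ u ] ∃[ v ] (toℕ u ≡ x × toℕ v ≡ y × Adj u v)
  inputCells⁻ p with ∈-concatMap⁻¹ vertexCells (allFin n) p
  ... | u , _ , p∈ with ∈-map⁻ _ p∈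
  ...   | v , v∈ , refl = u , v , refl , refl , Equivalence.to (correct u v) v∈

  inputCells⁺ : ∀ {u v} → Adj u v → (toℕ u , toℕ v) ∈ inputCells
  inputCells⁺ {u} {v} e = ∈-concatMap vertexCells (∈-allFin u)
    (∈-map⁺ (λ w → toℕ u , toℕ w) (Equivalence.from (correct u v) e))

  inputCells<n : ∀ {x y} → (x , y) ∈ inputCells → x < n × y < n
  inputCells<n p with inputCells⁻ p
  ... | u , v , refl , refl , _ = toℕ<n u , toℕ<n v

  unique-concatMap : ∀ us → Unique us → Unique (concatMap vertexCells us)
  unique-concatMap [] [] = []
  unique-concatMap (u ∷ us) (u∉ ∷ uus) = UniqueP.++⁺
    (UniqueP.map⁺ (λ eq → toℕ-injective (cong proj₂ eq)) (unique u)) (unique-concatMap us uus) disjoint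
    where
    disjoint : ∀ {c} → ¬ (c ∈ vertexCells u × c ∈ concatMap vertexCells us)
    disjoint (c∈u , c∈us) with ∈-map⁻ _ c∈u | ∈-concatMap⁻¹ vertexCells us c∈us
    ... | w , _ , refl | u′ , u′∈ , c∈u′ with ∈-map⁻ _ c∈u′
    ...   | w′ , _ , eq = All.lookup u∉ u′∈ (toℕ-injective (cong proj₁ eq))

  inputCells-unique : Unique inputCells
  inputCells-unique = unique-concatMap (allFin n) (UniqueP.allFin⁺ n)

  words : List (Fin n) → List ℕ
  words = concatMap (λ u → length (neighbours u) ∷ map toℕ (neighbours u))

  -- us are the vertices to come, after the words ws, which encode the cells ahead; the current
  -- vertex (present when pending = 1) is number i.
  record Progress (input src dst : ℕ → ℕ) (q i m n′ : ℕ) (ws : List ℕ) (ahead : List Cell)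
                  (us : List (Fin n)) (pending : ℕ) : Set where
    field
      {done}  : List Cell
      text    : Holds input q (ws ++ words us)
      cells   : HoldsCells src dst 0 done
      m≡      : m ≡ length done
      total   : done ++ ahead ++ concatMap vertexCells us ≡ inputCells
      indices : Segment (λ j u → j ≡ toℕ u) (pending + i) us
      i+us    : pending + i + length us ≡ n′
      n≡      : n′ ≡ n

  ProgressOf : Memory → List ℕ → List Cell → List (Fin n) → ℕ → Set
  ProgressOf τ = Progress (τ IN) (τ SRC) (τ DST) (τ qReg 0) (τ iReg 0) (τ mReg 0) (τ nReg 0)

  read-cells : ∀ u us {τ} → τ iReg 0 ≡ toℕ u → τ jReg 0 ≡ length (neighbours u) →
    ProgressOf τ (map toℕ (neighbours u)) (vertexCells u) us 1 →
    Run (while (reg jReg) readCell) τ (suc (length (neighbours u)) * cellTime)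
      (λ υ → ProgressOf υ [] [] us 1)
  read-cells u us {τ} i≡ j≡ pr = weaken ≤-refl (λ _ (_ , _ , q) → q) (for-each-const Inv (λ (_ , j , _) → j)
      (λ _ → body) (neighbours u) ≤-refl (i≡ , j≡ , pr))
    where
    Inv : List (Fin n) → Memory → Set
    Inv ws υ = υ iReg 0 ≡ toℕ u × υ jReg 0 ≡ length ws ×
      ProgressOf υ (map toℕ ws) (map (λ w → toℕ u , toℕ w) ws) us 1
    body : ∀ {w ws υ} → Inv (w ∷ ws) υ → Run readCell υ (duration readCell) (Inv ws)
    body {w} {ws} {υ} (i≡ , j≡ , pr) = stores readCell (i≡ , cong (_∸ 1) j≡ , record
      { done = done ∷ʳ (toℕ u , toℕ w)
      ; text = proj₂ text
      ; cells = subst₂ (λ x y → HoldsCells (upd (υ SRC) (υ mReg 0) x) (upd (υ DST) (υ mReg 0) y) 0 (done ∷ʳ (toℕ u , toℕ w)))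
          (sym i≡) (sym (proj₁ text)) (cells-push done m≡ cells)
      ; m≡ = trans (cong suc m≡) (sym (length-∷ʳ done _))
      ; total = trans (∷ʳ-++ done _ _) total
      ; indices = indices ; i+us = i+us ; n≡ = n≡
      })
      where open Progress pr

  VertexInv : List (Fin n) → Memory → Set
  VertexInv us τ = ProgressOf τ [] [] us 0

  visitTime : Fin n → ℕ
  visitTime u = 11 + (suc (length (neighbours u)) * cellTime + 6)

  read-vertex : ∀ {u us τ} → VertexInv (u ∷ us) τ → Run readVertex τ (visitTime u) (VertexInv us)
  read-vertex {u} {us} {τ} pr = stores-then (set jReg (load IN (reg qReg)) ⨟ increment qReg)
    (read-cells u us (proj₁ indices) (proj₁ text) (record
      { text = proj₂ text ; cells = cells ; m≡ = m≡ ; total = total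
      ; indices = proj₂ indices ; i+us = trans (sym (+-suc _ (length us))) i+us ; n≡ = n≡ })
    then λ _ pr′ → let module Next = Progress pr′ in stores (increment iReg) (record
      { text = Next.text ; cells = Next.cells ; m≡ = Next.m≡ ; total = Next.total
      ; indices = Next.indices ; i+us = Next.i+us ; n≡ = Next.n≡ }))
    where open Progress pr

  -- Single vertices may have large degree, so the inner loops are charged to the cells they read;
  -- sparsity makes their total linear.
  total-time : ∀ us → sum (map visitTime us) ≡ length us * vertexTime + length (concatMap vertexCells us) * cellTime
  total-time [] = refl
  total-time (u ∷ us) = trans (cong (visitTime u +_) (total-time us))
    (trans (visit-sum 11 6 cellTime (length (neighbours u)) (length us) r)
      (cong (λ z → suc (length us) * vertexTime + z * cellTime)
        {length (neighbours u) + r} {length (concatMap vertexCells (u ∷ us))} (sym l+r)))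
    where
    r = length (concatMap vertexCells us)
    l+r : length (concatMap vertexCells (u ∷ us)) ≡ length (neighbours u) + r
    l+r = trans (length-++ (vertexCells u)) (cong (_+ r) (length-map _ (neighbours u)))

  CellsOf : List Cell → Memory → Set
  CellsOf C τ = τ nReg 0 ≡ n × τ mReg 0 ≡ length C × HoldsCells (τ SRC) (τ DST) 0 C

  read-run : ∀ K → length inputCells ≤ 2 * K * n →
    LinearRun (suc n) (readTime K) readInput (initial (encode L)) (CellsOf inputCells)
  read-run K sparse = lift-const z<s (stores readInit {Q = VertexInv (allFin n)} start) thenˡ λ _ inv →
    linear (weaken bound (λ {τ} _ → finish {τ}) (for-each VertexInv visitTime (λ {us} {τ} → guard {us} {τ}) (λ _ → read-vertex) (allFin n) inv))
    where
    start : VertexInv (allFin n) (exec readInit (initial (encode L)))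
    start = record
      { done = [] ; text = holds-nth (words (allFin n)) 1 (λ i → refl) ; cells = tt ; m≡ = refl ; total = refl
      ; indices = segment-tabulate 0 id (λ _ → refl) ; i+us = length-allFin ; n≡ = refl }
      where
      length-allFin : length (allFin n) ≡ n
      length-allFin = length-tabulate id
    guard : ∀ {us τ} → VertexInv us τ → τ nReg 0 ∸ τ iReg 0 ≡ length us
    guard {us} {τ} pr = trans (cong (_∸ τ iReg 0) (sym (Progress.i+us pr))) (m+n∸m≡n (τ iReg 0) (length us))
    finish : ∀ {τ} → VertexInv [] τ → CellsOf inputCells τ
    finish {τ} pr = n≡ , trans m≡ (cong length done≡) , subst (HoldsCells (τ SRC) (τ DST) 0) done≡ cells
      where
      open Progress pr
      done≡ : done ≡ inputCells
      done≡ = trans (sym (++-identityʳ done)) total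
    bound : sum (map visitTime (allFin n)) + suc (length (allFin n)) * 6 ≤
            suc n * (vertexTime + 2 * K * cellTime + 6)
    bound = begin
      sum (map visitTime (allFin n)) + suc (length (allFin n)) * 6 ≡⟨ cong₂ (λ x y → x + suc y * 6) (total-time (allFin n)) len ⟩
      length (allFin n) * vertexTime + length inputCells * cellTime + suc n * 6 ≡⟨ cong (λ z → z * vertexTime + length inputCells * cellTime + suc n * 6) len ⟩
      n * vertexTime + length inputCells * cellTime + suc n * 6 ≤⟨ +-monoˡ-≤ (suc n * 6) (+-mono-≤ (*-monoˡ-≤ vertexTime (n≤1+n n)) cells≤) ⟩
      suc n * vertexTime + suc n * (2 * K * cellTime) + suc n * 6 ≡⟨ cong (_+ suc n * 6) (*-distribˡ-+ (suc n) vertexTime (2 * K * cellTime)) ⟨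
      suc n * (vertexTime + 2 * K * cellTime) + suc n * 6 ≡⟨ *-distribˡ-+ (suc n) (vertexTime + 2 * K * cellTime) 6 ⟨
      suc n * (vertexTime + 2 * K * cellTime + 6) ∎
      where
      open ≤-Reasoning
      len : length (allFin n) ≡ n
      len = length-tabulate id
      cells≤ : length inputCells * cellTime ≤ suc n * (2 * K * cellTime)
      cells≤ = begin
        length inputCells * cellTime ≤⟨ *-monoˡ-≤ cellTime (≤-trans sparse (*-monoʳ-≤ (2 * K) (n≤1+n n))) ⟩
        2 * K * suc n * cellTime     ≡⟨ cong (_* cellTime) (*-comm (2 * K) (suc n)) ⟩
        suc n * (2 * K) * cellTime   ≡⟨ *-assoc (suc n) (2 * K) cellTime ⟩
        suc n * (2 * K * cellTime)   ∎

-- The augmented graph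

-- The second peeling overwrites `OUT` and `CNT`, while the boxes need the first orientation. `BASE`
-- is filled by repeated addition of `n`, which is not a constant and thus out of reach of `times`.
copyVertexInit copyVertex copySlot : Program
copyVertexInit = startScan ⨟ set bReg (const 0)
copyVertex = store CNT₁ (reg iReg) (load CNT (reg iReg)) ⨟ store BASE (reg iReg) (reg bReg) ⨟
  set bReg (add (reg nReg) (reg bReg)) ⨟ increment iReg
copySlot = store OUT₁ (reg iReg) (load OUT (reg iReg)) ⨟ increment iReg

copySlotInit copyOut : ℕ → Program
copySlotInit D = startScan ⨟ set sReg (times D (reg nReg))
copyOut D = scan copyVertexInit nReg copyVertex ⨟ scan (copySlotInit D) sReg copySlot

copyTime : ℕ → ℕ
copyTime D = scanTime copyVertexInit copyVertex 1 + scanTime (copySlotInit D) copySlot D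

copy-run : ∀ n D {σ} → σ nReg 0 ≡ n →
  LinearRun (suc n) (copyTime D) (copyOut D) σ (λ τ →
    (∀ {v} → v < n → τ CNT₁ v ≡ σ CNT v × τ BASE v ≡ n * v) × (∀ {i} → i < D * n → τ OUT₁ i ≡ σ OUT i))
copy-run n D {σ} n≡ =
  scan-below 1 z<s (n≤1*suc n) Inv (λ (n≡′ , i≡ , _) → n≡′ , i≡) (λ _ _ → body)
    (n≡ , refl , sym (*-zeroʳ n) , (λ _ → refl) , (λ _ → refl) , λ ()) thenˡ λ {τ} _ (n≡′ , _ , _ , _ , out≡ , h) →
  conclude (λ (_ , _ , h′ , _ , g) → h′ , g) (scan-below D z<s (*-monoʳ-≤ D (n≤1+n n)) Inv′ (λ (s≡ , i≡ , _) → s≡ , i≡) (λ _ _ → body′)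
    (trans (eval-times (exec startScan τ) D (reg nReg)) (cong (D *_) n≡′) , refl , h , out≡ , λ ()))
  where
  Inv : ℕ → Memory → Set
  Inv i τ = τ nReg 0 ≡ n × τ iReg 0 ≡ i × τ bReg 0 ≡ n * i × (∀ v → τ CNT v ≡ σ CNT v) × (∀ j → τ OUT j ≡ σ OUT j) ×
    (∀ {v} → v < i → τ CNT₁ v ≡ σ CNT v × τ BASE v ≡ n * v)
  body : ∀ {i τ} → Inv i τ → Run copyVertex τ (duration copyVertex) (Inv (suc i))
  body {i} {τ} (n≡′ , refl , b≡ , cnt≡ , out≡ , h) = stores copyVertex
    (n≡′ , refl , trans (cong₂ _+_ n≡′ b≡) (sym (*-suc n i)) , cnt≡ , out≡ , h′)
    where
    h′ : ∀ {v} → v < suc i → upd (τ CNT₁) i (τ CNT i) v ≡ σ CNT v × upd (τ BASE) i (τ bReg 0) v ≡ n * v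
    h′ {v} v< with v ≟ i
    ... | yes refl = trans (upd-same (τ CNT₁) v _) (cnt≡ v) , trans (upd-same (τ BASE) v _) b≡
    ... | no v≢i with h (≤∧≢⇒< (s≤s⁻¹ v<) v≢i)
    ...   | p , q = trans (upd-other (τ CNT₁) _ v≢i) p , trans (upd-other (τ BASE) _ v≢i) q
  Inv′ : ℕ → Memory → Set
  Inv′ i τ = τ sReg 0 ≡ D * n × τ iReg 0 ≡ i × (∀ {v} → v < n → τ CNT₁ v ≡ σ CNT v × τ BASE v ≡ n * v) ×
    (∀ j → τ OUT j ≡ σ OUT j) × (∀ {j} → j < i → τ OUT₁ j ≡ σ OUT j)
  body′ : ∀ {i τ} → Inv′ i τ → Run copySlot τ (duration copySlot) (Inv′ (suc i))
  body′ {i} {τ} (s≡ , refl , h , out≡ , g) = stores copySlot (s≡ , refl , h , out≡ , g′)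
    where
    g′ : ∀ {j} → j < suc i → upd (τ OUT₁) i (τ OUT i) j ≡ σ OUT j
    g′ {j} j< with j ≟ i
    ... | yes refl = trans (upd-same (τ OUT₁) j _) (out≡ j)
    ... | no j≢i = trans (upd-other (τ OUT₁) _ j≢i) (g (≤∧≢⇒< (s≤s⁻¹ j<) j≢i))

-- MARK is an n × n table, cheap because memory starts out as zero; BASE holds the multiples of n.
cellIndex : Expr
cellIndex = add (load BASE (reg uReg)) (reg vReg)

markCell emitOne flip emitBoth pairInit : Program
markCell = store MARK cellIndex (const 1) ⨟ store SRC (reg mReg) (reg uReg) ⨟
  store DST (reg mReg) (reg vReg) ⨟ increment mReg
emitOne = ifnz (load MARK cellIndex) skip markCell
flip = set yReg (reg uReg) ⨟ set uReg (reg vReg) ⨟ set vReg (reg yReg)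
emitBoth = emitOne ⨟ flip ⨟ emitOne
pairInit = set bReg (const 0)

-- `pairLoop` joins the vertex in `leftReg` to every out-neighbour of the vertex in `jReg`. The
-- loads `siblingLoad` and `farLoad` make it produce pairs of out-neighbours and ends of two-step
-- paths respectively. Loops may be emitted; peeling discards them.
pairLoad pairBody pairLoop augmentSlot augmentVertex augment : ℕ → Program
pairLoad D = set uReg (reg leftReg) ⨟ set vReg (load OUT₁ (add (times D (reg jReg)) (reg bReg)))
pairBody D = pairLoad D ⨟ emitBoth ⨟ increment bReg
pairLoop D = pairInit ⨟ while (sub (load CNT₁ (reg jReg)) (reg bReg)) (pairBody D)

slotLoad : ℕ → Program
slotLoad D = set xReg (load OUT₁ (add (times D (reg iReg)) (reg aReg))) ⨟ set uReg (reg iReg) ⨟ set vReg (reg xReg)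

siblingLoad farLoad : Program
siblingLoad = set leftReg (reg xReg) ⨟ set jReg (reg iReg)
farLoad = set leftReg (reg iReg) ⨟ set jReg (reg xReg)

augmentSlot D = slotLoad D ⨟ emitBoth ⨟ siblingLoad ⨟ pairLoop D ⨟ farLoad ⨟ pairLoop D ⨟ increment aReg
augmentVertex D = set aReg (const 0) ⨟ while (sub (load CNT₁ (reg iReg)) (reg aReg)) (augmentSlot D) ⨟ increment iReg
augment D = scan (startScan ⨟ set mReg (const 0)) nReg (augmentVertex D)

pairTime slotTime augmentTime : ℕ → ℕ
pairTime D = duration pairInit + suc D * (duration (pairBody D) + 7)
slotTime D = duration (slotLoad D) + (duration emitBoth + (duration siblingLoad + (pairTime D +
  (duration farLoad + (pairTime D + duration (increment aReg))))))
augmentTime D = duration (startScan ⨟ set mReg (const 0)) +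
  2 * (duration (set aReg (const 0)) + (suc D * (slotTime D + 7) + duration (increment iReg)) + 6)

module Augment (n D : ℕ) (out cnt : ℕ → ℕ) (cnt≤D : ∀ {v} → v < n → cnt v ≤ D)
  (out<n : ∀ {v a} → v < n → a < cnt v → out (D * v + a) < n)
  (R : ℕ → ℕ → Set) (R-sym : ∀ {x y} → R x y → R y x)
  (near : ∀ {v a} → v < n → a < cnt v → R v (out (D * v + a)))
  (siblings : ∀ {v a b} → v < n → a < cnt v → b < cnt v → R (out (D * v + a)) (out (D * v + b)))
  (far : ∀ {v a b} → v < n → a < cnt v → b < cnt (out (D * v + a)) → R v (out (D * out (D * v + a) + b))) where

  -- `MARK` keeps the list free of repetitions. Sparsity bounds the number of distinct cells, so
  -- without this the list could be too long.
  record Emitted (src dst mark base out₁ cnt₁ : ℕ → ℕ) (m n′ : ℕ) (C : List Cell) : Set where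
    field
      m≡       : m ≡ length C
      n≡       : n′ ≡ n
      cells    : HoldsCells src dst 0 C
      unique   : Unique C
      sound    : ∀ {x y} → (x , y) ∈ C → x < n × y < n × R x y
      marked⁻  : ∀ {x y} → x < n → y < n → mark (n * x + y) ≢ 0 → (x , y) ∈ C
      marked⁺  : ∀ {x y} → (x , y) ∈ C → mark (n * x + y) ≢ 0
      base≡    : ∀ {x} → x < n → base x ≡ n * x
      cnt≡     : ∀ {x} → x < n → cnt₁ x ≡ cnt x
      out≡     : ∀ {x a} → x < n → a < cnt x → out₁ (D * x + a) ≡ out (D * x + a)

  EmittedOf : Memory → List Cell → Set
  EmittedOf τ = Emitted (τ SRC) (τ DST) (τ MARK) (τ BASE) (τ OUT₁) (τ CNT₁) (τ mReg 0) (τ nReg 0)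

  -- The list itself is hidden; `Old` collects the cells it is guaranteed to contain, and grows
  -- along the program.
  Emit : (Cell → Set) → Memory → Set
  Emit Old τ = ∃[ C ] (EmittedOf τ C × (∀ {p} → Old p → p ∈ C))

  emit-one : ∀ {Old τ x y} → τ uReg 0 ≡ x → τ vReg 0 ≡ y → x < n → y < n → R x y → Emit Old τ →
    Run emitOne τ (duration emitOne) (Emit (λ p → Old p ⊎ p ≡ (x , y)))
  emit-one {Old} {τ} {x} {y} refl refl x<n y<n r (C , em , old) = branch seen fresh
    where
    open Emitted em
    e = τ BASE x + y
    e≡ : e ≡ n * x + y
    e≡ = cong (_+ y) (base≡ x<n)
    seen : τ MARK e ≢ 0 → Run skip τ 1 (Emit (λ p → Old p ⊎ p ≡ (x , y)))
    seen nz = stores skip (C , em , λ where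
      (inj₁ o) → old o
      (inj₂ refl) → marked⁻ x<n y<n (subst (λ i → τ MARK i ≢ 0) e≡ nz))
    fresh : τ MARK e ≡ 0 → Run markCell τ (duration markCell) (Emit (λ p → Old p ⊎ p ≡ (x , y)))
    fresh z = stores markCell (C ∷ʳ (x , y) , record
      { m≡ = trans (cong suc m≡) (sym (length-∷ʳ C _))
      ; n≡ = n≡
      ; cells = cells-push C m≡ cells
      ; unique = Unique-∷ʳ unique (All.tabulate (λ c∈ eq → marked⁺ (subst (_∈ C) eq c∈) (subst (λ i → τ MARK i ≡ 0) e≡ z)))
      ; sound = sound′
      ; marked⁻ = marked⁻′
      ; marked⁺ = marked⁺′
      ; base≡ = base≡ ; cnt≡ = cnt≡ ; out≡ = out≡
      } , λ where
        (inj₁ o) → ∈-++⁺ˡ (old o)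
        (inj₂ refl) → ∈-++⁺ʳ C (here refl))
      where
      sound′ : ∀ {x′ y′} → (x′ , y′) ∈ C ∷ʳ (x , y) → x′ < n × y′ < n × R x′ y′
      sound′ c∈ with ∈-++⁻ C c∈
      ... | inj₁ c∈C = sound c∈C
      ... | inj₂ (here refl) = x<n , y<n , r
      marked⁻′ : ∀ {x′ y′} → x′ < n → y′ < n → upd (τ MARK) e 1 (n * x′ + y′) ≢ 0 → (x′ , y′) ∈ C ∷ʳ (x , y)
      marked⁻′ {x′} {y′} x′<n y′<n nz with n * x′ + y′ ≟ e
      ... | no ne = ∈-++⁺ˡ (marked⁻ x′<n y′<n (nz ∘ trans (upd-other (τ MARK) 1 ne)))
      ... | yes eq with slot-injective {n} x′ x y′<n y<n (trans eq e≡)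
      ...   | refl , refl = ∈-++⁺ʳ C (here refl)
      marked⁺′ : ∀ {x′ y′} → (x′ , y′) ∈ C ∷ʳ (x , y) → upd (τ MARK) e 1 (n * x′ + y′) ≢ 0
      marked⁺′ {x′} {y′} c∈ with n * x′ + y′ ≟ e
      ... | yes eq rewrite eq = λ z′ → 1+n≢0 (trans (sym (upd-same (τ MARK) e 1)) z′)
      ... | no ne with ∈-++⁻ C c∈
      ...   | inj₁ c∈C = marked⁺ c∈C ∘ trans (sym (upd-other (τ MARK) 1 ne))
      ...   | inj₂ (here refl) = contradiction (sym e≡) ne

  emit-both : ∀ {Old τ x y} → τ uReg 0 ≡ x → τ vReg 0 ≡ y → x < n → y < n → R x y → Emit Old τ →
    Run emitBoth τ (duration emitBoth) (Emit (λ p → Old p ⊎ (p ≡ (x , y) ⊎ p ≡ (y , x))))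
  emit-both {τ = τ} u≡ v≡ x<n y<n r em =
    emit-one u≡ v≡ x<n y<n r em then λ fr em₁ →
    stores-then flip (weaken ≤-refl (λ _ (C , em₂ , old) → C , em₂ , λ where
        (inj₁ o) → old (inj₁ (inj₁ o))
        (inj₂ (inj₁ eq)) → old (inj₁ (inj₂ eq))
        (inj₂ (inj₂ eq)) → old (inj₂ eq))
      (emit-one (trans (fr vReg refl 0) v≡) (trans (fr uReg refl 0) u≡) y<n x<n (R-sym r) em₁))

  Pairs : ℕ → ℕ → ℕ → Cell → Set
  Pairs f c i p = ∃[ b ] (b < i × (p ≡ (f , out (D * c + b)) ⊎ p ≡ (out (D * c + b) , f)))

  pair-loop : ∀ {Old τ f c} → τ leftReg 0 ≡ f → τ jReg 0 ≡ c → f < n → c < n →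
    (∀ {b} → b < cnt c → R f (out (D * c + b))) → Emit Old τ →
    Run (pairLoop D) τ (pairTime D) (Emit (λ p → Old p ⊎ Pairs f c (cnt c) p))
  pair-loop {Old} {τ} {f} {c} f≡ c≡ f<n c<n r (C , em , old) = stores-then pairInit
    (weaken ≤-refl (λ _ (_ , _ , _ , q) → q) (for-below (cnt c) (cnt≤D c<n) Inv (λ {_} {υ} → guard {υ = υ}) (λ b< _ → body b<)
      (f≡ , c≡ , refl , C , em , λ where
        (inj₁ o) → old o
        (inj₂ (_ , () , _)))))
    where
    Inv : ℕ → Memory → Set
    Inv b υ = υ leftReg 0 ≡ f × υ jReg 0 ≡ c × υ bReg 0 ≡ b × Emit (λ p → Old p ⊎ Pairs f c b p) υ
    guard : ∀ {b υ} → Inv b υ → υ CNT₁ (υ jReg 0) ∸ υ bReg 0 ≡ cnt c ∸ b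
    guard {υ = υ} (_ , j≡ , b≡ , _ , em , _) = cong₂ _∸_ (trans (cong (υ CNT₁) j≡) (Emitted.cnt≡ em c<n)) b≡
    body : ∀ {b υ} → b < cnt c → Inv b υ → Run (pairBody D) υ (duration (pairBody D)) (Inv (suc b))
    body {b} {υ} b< (f≡′ , j≡ , b≡ , C , em , old) = stores-then (pairLoad D)
      (emit-both {x = f} {y = out (D * c + b)} f≡′ v≡ f<n (out<n c<n b<) (r b<) (C , em , old) then λ fr (C′ , em′ , old′) →
        stores (increment bReg) (trans (fr leftReg refl 0) f≡′ , trans (fr jReg refl 0) j≡ ,
          cong suc (trans (fr bReg refl 0) b≡) , C′ , em′ , λ where
            (inj₁ o) → old′ (inj₁ (inj₁ o))
            (inj₂ (b′ , b′< , eq)) → case m≤n⇒m<n∨m≡n (s≤s⁻¹ b′<) of λ where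
              (inj₁ lt) → old′ (inj₁ (inj₂ (b′ , lt , eq)))
              (inj₂ refl) → old′ (inj₂ eq)))
      where
      σ₁ = exec (set uReg (reg leftReg)) υ
      v≡ : υ OUT₁ (eval σ₁ (times D (reg jReg)) + υ bReg 0) ≡ out (D * c + b)
      v≡ = trans (cong (υ OUT₁) (cong₂ _+_ (trans (eval-times σ₁ D (reg jReg)) (cong (D *_) j≡)) b≡))
        (Emitted.out≡ em c<n b<)

  NewAt : ℕ → ℕ → Cell → Set
  NewAt v a p = (p ≡ (v , x) ⊎ p ≡ (x , v)) ⊎ Pairs x v (cnt v) p ⊎ Pairs v x (cnt x) p
    where x = out (D * v + a)

  SlotsBelow : ℕ → ℕ → Cell → Set
  SlotsBelow v i p = ∃[ a ] (a < i × NewAt v a p)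

  slot-run : ∀ {Old τ v a} → τ iReg 0 ≡ v → τ aReg 0 ≡ a → v < n → a < cnt v → Emit Old τ →
    Run (augmentSlot D) τ (slotTime D) (λ υ → υ iReg 0 ≡ v × υ aReg 0 ≡ suc a × Emit (λ p → Old p ⊎ NewAt v a p) υ)
  slot-run {Old} {τ} {v} {a} i≡ a≡ v<n a< (C , em , old) =
    stores-then (slotLoad D)
    (emit-both {x = v} {y = x} i≡ x≡ v<n x<n (near v<n a<) (C , em , old) then λ fr₁ em₁ →
     stores-then siblingLoad
     (pair-loop (trans (fr₁ xReg refl 0) x≡) (trans (fr₁ iReg refl 0) i≡) x<n v<n (siblings v<n a<) em₁ then λ fr₂ em₂ →
      stores-then farLoad
      (pair-loop (trans (fr₂ iReg refl 0) (trans (fr₁ iReg refl 0) i≡)) (trans (fr₂ xReg refl 0) (trans (fr₁ xReg refl 0) x≡))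
         v<n x<n (far v<n a<) em₂ then λ fr₃ (C′ , em′ , old′) →
       stores (increment aReg)
         ( trans (fr₃ iReg refl 0) (trans (fr₂ iReg refl 0) (trans (fr₁ iReg refl 0) i≡))
         , cong suc (trans (fr₃ aReg refl 0) (trans (fr₂ aReg refl 0) (trans (fr₁ aReg refl 0) a≡)))
         , C′ , em′ , λ where
             (inj₁ o) → old′ (inj₁ (inj₁ (inj₁ o)))
             (inj₂ (inj₁ p)) → old′ (inj₁ (inj₁ (inj₂ p)))
             (inj₂ (inj₂ (inj₁ p))) → old′ (inj₁ (inj₂ p))
             (inj₂ (inj₂ (inj₂ p))) → old′ (inj₂ p)))))
    where
    x = out (D * v + a)
    x<n : x < n
    x<n = out<n v<n a<
    x≡ : τ OUT₁ (eval τ (times D (reg iReg)) + τ aReg 0) ≡ x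
    x≡ = trans (cong (τ OUT₁) (cong₂ _+_ (trans (eval-times τ D (reg iReg)) (cong (D *_) i≡)) a≡)) (Emitted.out≡ em v<n a<)

  Augmented : ℕ → Cell → Set
  Augmented i p = ∃[ v ] (v < i × SlotsBelow v (cnt v) p)

  AugmentInv : ℕ → Memory → Set
  AugmentInv i τ = τ iReg 0 ≡ i × Emit (Augmented i) τ

  vertex-run : ∀ {v τ} → v < n → AugmentInv v τ →
    Run (augmentVertex D) τ (duration (set aReg (const 0)) + (suc D * (slotTime D + 7) + duration (increment iReg)))
      (AugmentInv (suc v))
  vertex-run {v} {τ} v<n (i≡ , C , em , old) = stores-then (set aReg (const 0))
    (for-below (cnt v) (cnt≤D v<n) Inv (λ {_} {υ} → guard {υ = υ}) (λ a< _ (i≡′ , a≡ , em′) → step (slot-run i≡′ a≡ v<n a< em′))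
      (i≡ , refl , C , em , λ where
        (inj₁ o) → old o
        (inj₂ (_ , () , _)))
     then λ _ (i≡′ , _ , C′ , em′ , old′) → stores (increment iReg) (cong suc i≡′ , C′ , em′ , λ where
       (w , w< , p) → case m≤n⇒m<n∨m≡n (s≤s⁻¹ w<) of λ where
         (inj₁ lt) → old′ (inj₁ (w , lt , p))
         (inj₂ refl) → old′ (inj₂ p)))
    where
    Inv : ℕ → Memory → Set
    Inv a υ = υ iReg 0 ≡ v × υ aReg 0 ≡ a × Emit (λ p → Augmented v p ⊎ SlotsBelow v a p) υ
    guard : ∀ {a υ} → Inv a υ → υ CNT₁ (υ iReg 0) ∸ υ aReg 0 ≡ cnt v ∸ a
    guard {υ = υ} (i≡′ , a≡ , _ , em′ , _) = cong₂ _∸_ (trans (cong (υ CNT₁) i≡′) (Emitted.cnt≡ em′ v<n)) a≡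
    step : ∀ {a υ P T} →
      Run P υ T (λ ω → ω iReg 0 ≡ v × ω aReg 0 ≡ suc a × Emit (λ p → (Augmented v p ⊎ SlotsBelow v a p) ⊎ NewAt v a p) ω) →
      Run P υ T (Inv (suc a))
    step {a} = weaken ≤-refl λ _ (i≡′ , a≡ , C′ , em′ , old′) → i≡′ , a≡ , C′ , em′ , λ where
      (inj₁ o) → old′ (inj₁ (inj₁ o))
      (inj₂ (a′ , a′< , p)) → case m≤n⇒m<n∨m≡n (s≤s⁻¹ a′<) of λ where
        (inj₁ lt) → old′ (inj₁ (inj₂ (a′ , lt , p)))
        (inj₂ refl) → old′ (inj₂ p)

  augment-run : ∀ {σ} → σ nReg 0 ≡ n → (∀ e → σ MARK e ≡ 0) →
    (∀ {v} → v < n → σ CNT₁ v ≡ cnt v × σ BASE v ≡ n * v) → (∀ {i} → i < D * n → σ OUT₁ i ≡ out i) →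
    LinearRun (suc n) (augmentTime D) (augment D) σ (Emit (Augmented n))
  augment-run n≡ marks h g = conclude proj₂
    (scan-below 1 z<s (n≤1*suc n) AugmentInv (λ (i≡ , _ , em , _) → Emitted.n≡ em , i≡)
      (λ v< _ → vertex-run v<)
      (refl , [] , record
        { m≡ = refl ; n≡ = n≡ ; cells = tt ; unique = [] ; sound = λ ()
        ; marked⁻ = λ _ _ nz → contradiction (marks _) nz
        ; marked⁺ = λ ()
        ; base≡ = proj₂ ∘ h ; cnt≡ = proj₁ ∘ h
        ; out≡ = λ x<n a< → g (slot-< {D} x<n (≤-trans a< (cnt≤D x<n)))
        } , λ where (_ , () , _)))

-- Greedy colouring

stampInit chooseInit : Program
stampInit = set leftReg (add (const 1) (reg iReg)) ⨟ set vReg (load ORD (reg leftReg)) ⨟ set aReg (const 0)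
chooseInit = set bReg (const 0)

-- A colour is blocked by stamping it with the rank of the current vertex. Ranks increase from
-- vertex to vertex, so old stamps lapse and `USED` is never cleared.
stampBody : ℕ → Program
stampBody D = store USED (load COL (load OUT (add (times D (reg vReg)) (reg aReg)))) (reg leftReg) ⨟ increment aReg

-- No stamp exceeds the current one, so the difference is nonzero exactly at free colours; the last
-- free colour found is used.
chooseBody assignColour : Program
chooseBody = ifnz (sub (reg leftReg) (load USED (reg bReg))) (set yReg (reg bReg)) skip ⨟ increment bReg
assignColour = store COL (reg vReg) (reg yReg) ⨟ increment iReg

colourVertex colour : ℕ → Program
colourVertex D = stampInit ⨟ while (sub (load CNT (reg vReg)) (reg aReg)) (stampBody D) ⨟
  chooseInit ⨟ while (sub (const (suc D)) (reg bReg)) chooseBody ⨟ assignColour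
colour D = scan startScan nReg (colourVertex D)

colourVertexTime colourTime : ℕ → ℕ
colourVertexTime D = duration stampInit + (suc D * (duration (stampBody D) + 7) +
  (duration chooseInit + (suc (suc D) * (duration chooseBody + 5) + duration assignColour)))
colourTime D = duration startScan + 2 * (colourVertexTime D + 6)

all-below : ∀ {P : ℕ → Set} {m} → (∀ {i} → i < m → P i) → P m → ∀ {i} → i < suc m → P i
all-below h p i< with m≤n⇒m<n∨m≡n (s≤s⁻¹ i<)
... | inj₁ lt = h lt
... | inj₂ refl = p

pigeonhole-list : ∀ D {xs : List ℕ} → length xs ≤ D → ¬ (∀ {c} → c < suc D → c ∈ xs)
pigeonhole-list D {xs} xs≤D all = <-irrefl refl (begin-strict
  D                        <⟨ n<1+n D ⟩
  suc D                    ≡⟨ length-upTo (suc D) ⟨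
  length (upTo (suc D))    ≤⟨ unique-⊆⇒length≤ (UniqueP.upTo⁺ (suc D)) (all ∘ ∈-upTo⁻) ⟩
  length xs                ≤⟨ xs≤D ⟩
  D                        ∎)
  where open ≤-Reasoning

module Colouring (n D : ℕ) (Cs : List Cell) (Cs<n : ∀ {u w} → (u , w) ∈ Cs → u < n × w < n) where
  open Peeling n D Cs Cs<n

  -- Both directions of a pair are assumed because a conflict is refuted from the end coloured
  -- later, whichever it is.
  Good : ℕ → (rank col : ℕ → ℕ) → Set
  Good i rank col = (∀ {v} → v < n → rank v ≤ i → col v ≤ D) ×
    (∀ {u w} → (u , w) ∈ Cs → (w , u) ∈ Cs → u ≢ w → rank u ≤ i → rank w ≤ i → col u ≢ col w)

  Core : ℕ → Memory → Set
  Core i υ = υ nReg 0 ≡ n × υ iReg 0 ≡ i × Ranked (υ RANK) (υ ORD) [] 0 × Oriented (υ RANK) (υ OUT) (υ CNT) [] ×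
    Good i (υ RANK) (υ COL)

  ColourInv : ℕ → Memory → Set
  ColourInv i υ = Core i υ × (∀ c → υ USED c ≤ i)

  module Vertex (i v N : ℕ) (v<n : v < n) (N≤D : N ≤ D) where

    Here : Memory → Set
    Here υ = Core i υ × υ vReg 0 ≡ v × υ leftReg 0 ≡ suc i × υ RANK v ≡ suc i × υ CNT v ≡ N

    Stamped : ℕ → (used col out : ℕ → ℕ) → Set
    Stamped a used col out = (∀ c → used c ≤ suc i) × (∀ {a′} → a′ < a → used (col (out (D * v + a′))) ≡ suc i) ×
      (∀ {c} → used c ≡ suc i → ∃[ a′ ] (a′ < a × col (out (D * v + a′)) ≡ c))

    StampedAt : ℕ → Memory → Set
    StampedAt a υ = Stamped a (υ USED) (υ COL) (υ OUT)

    StampInv : ℕ → Memory → Set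
    StampInv a υ = Here υ × υ aReg 0 ≡ a × StampedAt a υ

    stamp : ∀ {a υ} → StampInv a υ → Run (stampBody D) υ (duration (stampBody D)) (StampInv (suc a))
    stamp {a} {υ} ((core , v≡ , l≡ , r≡ , c≡) , a≡ , ≤i , here′ , only) = stores (stampBody D)
      ((core , v≡ , l≡ , r≡ , c≡) , cong suc a≡ , ≤i′ , here″ , only′)
      where
      e = υ COL (υ OUT (eval υ (times D (reg vReg)) + υ aReg 0))
      e≡ : e ≡ υ COL (υ OUT (D * v + a))
      e≡ = cong (λ z → υ COL (υ OUT z)) (cong₂ _+_ (trans (eval-times υ D (reg vReg)) (cong (D *_) v≡)) a≡)
      used′ = upd (υ USED) e (υ leftReg 0)
      new : used′ e ≡ suc i
      new = trans (upd-same (υ USED) e (υ leftReg 0)) l≡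
      ≤i′ : ∀ c → used′ c ≤ suc i
      ≤i′ c with c ≟ e
      ... | yes refl = ≤-reflexive new
      ... | no c≢e = ≤-trans (≤-reflexive (upd-other (υ USED) _ c≢e)) (≤i c)
      keep : ∀ {c} → υ USED c ≡ suc i → used′ c ≡ suc i
      keep {c} eq with c ≟ e
      ... | yes refl = new
      ... | no c≢e = trans (upd-other (υ USED) _ c≢e) eq
      here″ : ∀ {a′} → a′ < suc a → used′ (υ COL (υ OUT (D * v + a′))) ≡ suc i
      here″ = all-below (λ lt → keep (here′ lt)) (subst (λ z → used′ z ≡ suc i) e≡ new)
      only′ : ∀ {c} → used′ c ≡ suc i → ∃[ a′ ] (a′ < suc a × υ COL (υ OUT (D * v + a′)) ≡ c)
      only′ {c} eq with c ≟ e
      ... | yes refl = a , n<1+n a , sym e≡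
      ... | no c≢e with only (trans (sym (upd-other (υ USED) _ c≢e)) eq)
      ...   | a′ , a′< , p = a′ , m<n⇒m<1+n a′< , p

    ChooseInv : ℕ → Memory → Set
    ChooseInv b υ = Here υ × StampedAt N υ × υ bReg 0 ≡ b ×
      ((υ yReg 0 ≤ D × υ USED (υ yReg 0) ≢ suc i) ⊎ (∀ {c} → c < b → υ USED c ≡ suc i))

    choose : ∀ {b υ} → b < suc D → ChooseInv b υ → Run chooseBody υ (duration chooseBody) (ChooseInv (suc b))
    choose {b} {υ} b≤D ((core , v≡ , l≡ , r≡ , c≡) , st , refl , f) =
      branch {Q = Chosen} (λ nz → stores (set yReg (reg bReg)) (hr , st , refl , inj₁ (s≤s⁻¹ b≤D , free nz)))
             (λ z → stores skip (hr , st , refl , full z f))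
      then λ _ (hr′ , st′ , b≡ , f′) → stores (increment bReg) (hr′ , st′ , cong suc b≡ , f′)
      where
      hr : Here υ
      hr = core , v≡ , l≡ , r≡ , c≡
      Chosen : Memory → Set
      Chosen ω = Here ω × StampedAt N ω × ω bReg 0 ≡ b ×
        ((ω yReg 0 ≤ D × ω USED (ω yReg 0) ≢ suc i) ⊎ (∀ {c} → c < suc b → ω USED c ≡ suc i))
      free : υ leftReg 0 ∸ υ USED b ≢ 0 → υ USED b ≢ suc i
      free nz eq = nz (trans (cong₂ _∸_ l≡ eq) (n∸n≡0 (suc i)))
      full : υ leftReg 0 ∸ υ USED b ≡ 0 →
        (υ yReg 0 ≤ D × υ USED (υ yReg 0) ≢ suc i) ⊎ (∀ {c} → c < b → υ USED c ≡ suc i) →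
        (υ yReg 0 ≤ D × υ USED (υ yReg 0) ≢ suc i) ⊎ (∀ {c} → c < suc b → υ USED c ≡ suc i)
      full z (inj₁ g) = inj₁ g
      full z (inj₂ h) = inj₂ (all-below h (≤-antisym (proj₁ st b)
        (≤-trans (≤-reflexive (sym l≡)) (m∸n≡0⇒m≤n z))))

    -- Were all `suc D` colours stamped, each would be the colour of one of the at most `D`
    -- out-neighbours.
    found : ∀ {υ} → ChooseInv (suc D) υ → υ yReg 0 ≤ D × υ USED (υ yReg 0) ≢ suc i
    found (_ , _ , _ , inj₁ g) = g
    found {υ} (_ , (_ , _ , only) , _ , inj₂ h) = ⊥-elim (pigeonhole-list D {xs}
      (≤-trans (≤-reflexive (trans (length-map _ (upTo N)) (length-upTo N))) N≤D)
      λ c< → let a , a< , eq = only (h c<) in subst (_∈ xs) eq (∈-map⁺ _ (∈-upTo⁺ a<)))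
      where xs = map (λ a → υ COL (υ OUT (D * v + a))) (upTo N)

    finish : ∀ {υ} → ChooseInv (suc D) υ → Run assignColour υ (duration assignColour) (ColourInv (suc i))
    finish {υ} inv@(((n≡ , i≡ , rk , or , ≤D , proper) , v≡ , _ , r≡ , c≡) , (≤i , stamped , _) , _ , _) =
      stores assignColour ((n≡ , cong suc i≡ , rk , or , ≤D′ , proper′) , ≤i)
      where
      open Oriented or
      y = υ yReg 0
      col′ = upd (υ COL) (υ vReg 0) y
      col-v : col′ v ≡ y
      col-v = trans (cong col′ (sym v≡)) (upd-same (υ COL) (υ vReg 0) y)
      col-other : ∀ {x} → x ≢ v → col′ x ≡ υ COL x
      col-other x≢v = upd-other (υ COL) y (λ eq → x≢v (trans eq v≡))
      earlier : ∀ {x} → x < n → x ≢ v → υ RANK x ≤ suc i → υ RANK x ≤ i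
      -- Positive ranks are injective, so `v` is the only vertex of rank `suc i`.
      earlier x<n x≢v le = s≤s⁻¹ (≤∧≢⇒< le λ eq →
        x≢v (rank-injective rk x<n v<n (λ z → 1+n≢0 (trans (sym eq) z)) (trans eq (sym r≡))))
      ≤D′ : ∀ {x} → x < n → υ RANK x ≤ suc i → col′ x ≤ D
      ≤D′ {x} x<n le with x ≟ v
      ... | yes refl = ≤-trans (≤-reflexive col-v) (proj₁ (found {υ} inv))
      ... | no x≢v = ≤-trans (≤-reflexive (col-other x≢v)) (≤D x<n (earlier x<n x≢v le))
      new : ∀ {w} → (v , w) ∈ Cs → v ≢ w → υ RANK w ≤ suc i → y ≢ υ COL w
      -- `w` has no larger rank than `v` and differs from it, so the cell occupies a slot of `v`;
      -- then the colour of `w` bears the stamp.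
      new {w} p v≢w le eq with complete p
      ... | inj₂ (inj₁ v≡w) = v≢w v≡w
      ... | inj₂ (inj₂ (inj₁ lt)) = <⇒≱ lt (≤-trans le (≤-reflexive (sym r≡)))
      ... | inj₂ (inj₂ (inj₂ (a , a< , refl))) = proj₂ (found {υ} inv)
        (trans (cong (υ USED) eq) (stamped (≤-trans a< (≤-reflexive c≡))))
      proper′ : ∀ {u w} → (u , w) ∈ Cs → (w , u) ∈ Cs → u ≢ w → υ RANK u ≤ suc i → υ RANK w ≤ suc i → col′ u ≢ col′ w
      proper′ {u} {w} p q u≢w ru rw with u ≟ v | w ≟ v
      ... | yes refl | yes refl = contradiction refl u≢w
      ... | yes refl | no w≢v = λ eq → new p u≢w rw (trans (sym col-v) (trans eq (col-other w≢v)))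
      ... | no u≢v | yes refl = λ eq → new q (≢-sym u≢w) ru (trans (sym col-v) (trans (sym eq) (col-other u≢v)))
      ... | no u≢v | no w≢v = λ eq → proper p q u≢w (earlier (proj₁ (Cs<n p)) u≢v ru) (earlier (proj₂ (Cs<n p)) w≢v rw)
        (trans (sym (col-other u≢v)) (trans eq (col-other w≢v)))

  colour-vertex : ∀ {i τ} → i < n → ColourInv i τ → Run (colourVertex D) τ (colourVertexTime D) (ColourInv (suc i))
  colour-vertex {i} {τ} i<n (core@(n≡ , i≡ , rk , or , good) , used) = stores-then stampInit
    (for-below (τ CNT v) (Oriented.cnt≤D or v<n) StampInv
      (λ {_} {υ} ((_ , v≡ , _ , _ , c≡) , a≡ , _) → cong₂ _∸_ (trans (cong (υ CNT) v≡) c≡) a≡)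
      (λ _ _ → stamp)
      ((core , cong (τ ORD ∘ suc) i≡ , cong suc i≡ , proj₂ (Ranked.filled rk z<s i<n) , refl) , refl ,
        (λ c → m≤n⇒m≤1+n (used c)) , (λ ()) , λ {c} eq → contradiction (≤-trans (≤-reflexive (sym eq)) (used c)) (n≮n i))
     then λ _ (hr , _ , st) → stores-then chooseInit
    (for-below (suc D) ≤-refl ChooseInv (λ (_ , _ , b≡ , _) → cong (suc D ∸_) b≡) (λ b< _ → choose b<)
      (hr , st , refl , inj₂ λ ())
     then λ _ → finish))
    where
    v = τ ORD (suc i)
    v<n : v < n
    v<n = proj₁ (Ranked.filled rk z<s i<n)
    open Vertex i v (τ CNT v) v<n (Oriented.cnt≤D or v<n)

  colour-run : ∀ {σ} → σ nReg 0 ≡ n → Ranked (σ RANK) (σ ORD) [] 0 → Oriented (σ RANK) (σ OUT) (σ CNT) [] →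
    (∀ c → σ USED c ≡ 0) →
    LinearRun (suc n) (colourTime D) (colour D) σ (λ τ →
      (∀ {v} → v < n → τ COL v ≤ D) × (∀ {u w} → (u , w) ∈ Cs → (w , u) ∈ Cs → u ≢ w → τ COL u ≢ τ COL w))
  colour-run {σ} n≡ rk or used = conclude (λ {τ} → done {τ})
    (scan-below 1 z<s (n≤1*suc n) ColourInv (λ ((n≡′ , i≡ , _) , _) → n≡′ , i≡)
      (λ i<n _ → colour-vertex i<n)
      ((n≡ , refl , rk , or , (λ v<n le → contradiction le (unranked v<n)) ,
        λ p _ _ le _ → contradiction le (unranked (proj₁ (Cs<n p)))) , λ c → ≤-reflexive (used c)))
    where
    unranked : ∀ {v} → v < n → ¬ σ RANK v ≤ 0
    unranked v<n le with Ranked.status rk v<n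
    ... | inj₂ (lt , _) = <⇒≱ lt le
    done : ∀ {τ} → ColourInv n τ →
      (∀ {v} → v < n → τ COL v ≤ D) × (∀ {u w} → (u , w) ∈ Cs → (w , u) ∈ Cs → u ≢ w → τ COL u ≢ τ COL w)
    done {τ} ((_ , _ , rk′ , _ , ≤D , proper) , _) = (λ v<n → ≤D v<n (rank≤n v<n)) ,
      λ p q u≢w → proper p q u≢w (rank≤n (proj₁ (Cs<n p))) (rank≤n (proj₂ (Cs<n p)))
      where
      rank≤n : ∀ {v} → v < n → τ RANK v ≤ n
      rank≤n v<n with Ranked.status rk′ v<n
      ... | inj₂ (_ , le , _) = le

-- Writing the boxes

-- `COMP` is indexed by colours and rebuilt for each vertex: an entry starts as the vertex itself
-- and is replaced by an out-neighbour of that colour, if there is one.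
clearBody scatterInit rowInit columnInit writeEntry : Program
clearBody = store COMP (reg aReg) (reg iReg) ⨟ increment aReg
scatterInit = set aReg (const 0)
rowInit = set aReg (const 0)
columnInit = set bReg (const 0)
writeEntry = store OUTPUT (reg qReg) (reg xReg) ⨟ store OUTPUT (add (const 1) (reg qReg)) (reg yReg) ⨟
  set qReg (add (const 2) (reg qReg)) ⨟ increment bReg

-- An equality test out of truncated subtractions.
distance : Expr → Expr → Expr
distance e f = add (sub e f) (sub f e)

point : Expr → Program
point e = set xReg e ⨟ set yReg e

anywhere selectEntry entryBody : Program
anywhere = set xReg (const 0) ⨟ set yReg (reg nReg)
selectEntry = ifnz (distance (load COL (reg iReg)) (reg aReg))
  (ifnz (distance (load COL (reg iReg)) (reg bReg)) anywhere (point (load COMP (reg aReg))))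
  (point (load COMP (reg bReg)))
entryBody = selectEntry ⨟ writeEntry

rowBody : ℕ → Program
rowBody c = columnInit ⨟ while (sub (const c) (reg bReg)) entryBody ⨟ increment aReg

scatterBody : ℕ → Program
scatterBody D = set xReg (load OUT₁ (add (times D (reg iReg)) (reg aReg))) ⨟
  store COMP (load COL (reg xReg)) (reg xReg) ⨟ increment aReg

boxVertex writeBoxes : ℕ → ℕ → Program
boxVertex D c = scatterInit ⨟ while (sub (const c) (reg aReg)) clearBody ⨟
  scatterInit ⨟ while (sub (load CNT₁ (reg iReg)) (reg aReg)) (scatterBody D) ⨟
  rowInit ⨟ while (sub (const c) (reg aReg)) (rowBody c) ⨟ increment iReg

boxInit : ℕ → Program
boxInit c = store OUTPUT (const 0) (const (c * c)) ⨟ set qReg (const 1) ⨟ startScan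

writeBoxes D c = scan (boxInit c) nReg (boxVertex D c)

rowTime : ℕ → ℕ
rowTime c = duration columnInit + (suc c * (duration entryBody + 5) + duration (increment aReg))

boxVertexTime boxTime : ℕ → ℕ → ℕ
boxVertexTime D c = duration scatterInit + (suc c * (duration clearBody + 5) + (duration scatterInit +
  (suc D * (duration (scatterBody D) + 7) + (duration rowInit + (suc c * (rowTime c + 5) + duration (increment iReg))))))
boxTime D c = duration (boxInit c) + 2 * (boxVertexTime D c + 6)

distance-≡ : ∀ {m n} → m ∸ n + (n ∸ m) ≡ 0 → m ≡ n
distance-≡ {m} {n} eq = ≤-antisym (m∸n≡0⇒m≤n (m+n≡0⇒m≡0 (m ∸ n) eq)) (m∸n≡0⇒m≤n (m+n≡0⇒n≡0 (m ∸ n) eq))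

distance-≢ : ∀ {m n} → m ∸ n + (n ∸ m) ≢ 0 → m ≢ n
distance-≢ {m} nz refl = nz (cong₂ _+_ (n∸n≡0 m) (n∸n≡0 m))

module Boxes (n D c : ℕ) (out cnt col : ℕ → ℕ) (cnt≤D : ∀ {v} → v < n → cnt v ≤ D) where

  -- The component of v in the star forest spanned by its own colour and the colour o.
  CompUpTo : ℕ → ℕ → ℕ → ℕ → Set
  CompUpTo i v o z = (z ≡ v × (∀ {a} → a < i → col (out (D * v + a)) ≢ o)) ⊎
    ∃[ a ] (a < i × z ≡ out (D * v + a) × col z ≡ o)

  Comp : ℕ → ℕ → ℕ → Set
  Comp v = CompUpTo (cnt v) v

  -- The cases follow the branches of `selectEntry`. For `i ≡ j` the first one puts a vertex of
  -- colour `i` at its own number when no out-neighbour shares its colour, which separates the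
  -- colour class.
  Side : ℕ → ℕ → ℕ → ℕ → ℕ → Set
  Side v i j l h = (col v ≡ i × Comp v j l × h ≡ l) ⊎ (col v ≢ i × col v ≡ j × Comp v i l × h ≡ l) ⊎
    (col v ≢ i × col v ≢ j × l ≡ 0 × h ≡ n)

  position : ℕ → ℕ → ℕ → ℕ
  position v i j = c * c * v + (c * i + j)

  position-injective : ∀ {v v′ i i′ j j′} → i < c → j < c → i′ < c → j′ < c →
    position v i j ≡ position v′ i′ j′ → v ≡ v′ × i ≡ i′ × j ≡ j′
  position-injective {v} {v′} {i} {i′} i< j< i′< j′< eq
    with slot-injective {c * c} v v′ (slot-< i< j<) (slot-< i′< j′<) eq
  ... | refl , eq′ with slot-injective {c} i i′ j< j′< eq′
  ...   | refl , refl = refl , refl , refl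

  -- The address is decoded by an equation, which avoids division; `position-injective` makes the
  -- decoding unambiguous.
  Entry : ℕ → ℕ → ℕ → Set
  Entry e l h = ∀ {v i j} → i < c → j < c → e ≡ position v i j → Side v i j l h

  Written : ℕ → (ℕ → ℕ) → Set
  Written E f = f 0 ≡ c * c × (∀ {e} → e < E → Entry e (f (1 + 2 * e)) (f (2 + 2 * e)))

  Env : Memory → Set
  Env υ = υ nReg 0 ≡ n × (∀ x → υ COL x ≡ col x) × (∀ {x} → x < n → υ CNT₁ x ≡ cnt x) ×
    (∀ {x a} → x < n → a < cnt x → υ OUT₁ (D * x + a) ≡ out (D * x + a))

  WrittenTo : ℕ → Memory → Set
  WrittenTo E υ = υ qReg 0 ≡ 1 + 2 * E × Written E (υ OUTPUT)

  write-entry : ∀ {E f l h} → Entry E l h → Written E f →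
    Written (suc E) (upd (upd f (1 + 2 * E) l) (2 + 2 * E) h)
  write-entry {E} {f} {l} {h} entry (f0 , old) = f0 , all-below old′ new
    where
    g = upd f (1 + 2 * E) l
    before : ∀ {e} → e < E → (2 + 2 * e) < 1 + 2 * E
    before {e} e<E = s≤s (≤-trans (≤-reflexive (sym (*-suc 2 e))) (*-monoʳ-≤ 2 e<E))
    old′ : ∀ {e} → e < E → Entry e (upd g (2 + 2 * E) h (1 + 2 * e)) (upd g (2 + 2 * E) h (2 + 2 * e))
    old′ {e} e<E = subst₂ (Entry e)
      (sym (trans (upd-other g h (<⇒≢ (m<n⇒m<1+n (<-trans (n<1+n _) (before e<E))))) (upd-other f l (<⇒≢ (<-trans (n<1+n _) (before e<E))))))
      (sym (trans (upd-other g h (<⇒≢ (m<n⇒m<1+n (before e<E)))) (upd-other f l (<⇒≢ (before e<E)))))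
      (old e<E)
    new : Entry E (upd g (2 + 2 * E) h (1 + 2 * E)) (upd g (2 + 2 * E) h (2 + 2 * E))
    new = subst₂ (Entry E)
      (sym (trans (upd-other g h (<⇒≢ (n<1+n (1 + 2 * E)))) (upd-same f (1 + 2 * E) l)))
      (sym (upd-same g (2 + 2 * E) h)) entry

  module Vertex (v : ℕ) (v<n : v < n) (col<c : ∀ {a} → a < cnt v → col (out (D * v + a)) < c) where

    At : ℕ → Memory → Set
    At E υ = Env υ × υ iReg 0 ≡ v × WrittenTo E υ

    base : ℕ
    base = c * c * v

    ClearInv : ℕ → Memory → Set
    ClearInv a υ = At base υ × υ aReg 0 ≡ a × (∀ {o} → o < a → CompUpTo 0 v o (υ COMP o))

    clear : ∀ {a υ} → ClearInv a υ → Run clearBody υ (duration clearBody) (ClearInv (suc a))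
    clear {a} {υ} ((env , i≡ , w) , refl , h) = stores clearBody ((env , i≡ , w) , refl , all-below h′ new)
      where
      comp′ = upd (υ COMP) a (υ iReg 0)
      h′ : ∀ {o} → o < a → CompUpTo 0 v o (comp′ o)
      h′ {o} o<a = subst (CompUpTo 0 v o) (sym (upd-other (υ COMP) _ (<⇒≢ o<a))) (h o<a)
      new : CompUpTo 0 v a (comp′ a)
      new = inj₁ (trans (upd-same (υ COMP) a _) i≡ , λ ())

    ScatterInv : ℕ → Memory → Set
    ScatterInv a υ = At base υ × υ aReg 0 ≡ a × (∀ {o} → o < c → CompUpTo a v o (υ COMP o))

    scatter : ∀ {a υ} → a < cnt v → ScatterInv a υ → Run (scatterBody D) υ (duration (scatterBody D)) (ScatterInv (suc a))
    scatter {a} {υ} a< ((env@(_ , col≡ , _ , out≡) , i≡ , w) , a≡ , h) = stores (scatterBody D)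
      ((env , i≡ , w) , cong suc a≡ , h′)
      where
      x = out (D * v + a)
      x′ = υ OUT₁ (eval υ (times D (reg iReg)) + υ aReg 0)
      x≡ : x′ ≡ x
      x≡ = trans (cong (υ OUT₁) (cong₂ _+_ (trans (eval-times υ D (reg iReg)) (cong (D *_) i≡)) a≡)) (out≡ v<n a<)
      e≡ : υ COL x′ ≡ col x
      e≡ = trans (cong (υ COL) x≡) (col≡ x)
      h′ : ∀ {o} → o < c → CompUpTo (suc a) v o (upd (υ COMP) (υ COL x′) x′ o)
      h′ {o} o<c with o ≟ υ COL x′
      ... | yes refl = inj₂ (a , n<1+n a , trans (upd-same (υ COMP) o x′) x≡ ,
            trans (cong col (trans (upd-same (υ COMP) o x′) x≡)) (sym e≡))
      ... | no o≢ rewrite upd-other (υ COMP) x′ o≢ with h o<c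
      ...   | inj₁ (z≡ , none) = inj₁ (z≡ , all-below none (λ eq → o≢ (trans (sym eq) (sym e≡))))
      ...   | inj₂ (a′ , a′< , p) = inj₂ (a′ , m<n⇒m<1+n a′< , p)

    Ready : ℕ → Memory → Set
    Ready E υ = At E υ × (∀ {o} → o < c → Comp v o (υ COMP o))

    ColumnInv : ℕ → ℕ → Memory → Set
    ColumnInv i j υ = Ready (position v i j) υ × υ aReg 0 ≡ i × υ bReg 0 ≡ j

    entry : ∀ {i j υ} → i < c → j < c → ColumnInv i j υ → Run entryBody υ (duration entryBody) (ColumnInv i (suc j))
    entry {i} {j} {υ} i<c j<c (((env@(n≡ , col≡ , _) , i≡ , w) , comp) , refl , refl) =
      select then λ {ω} _ ((((env′ , i≡′ , q≡ , wr) , comp′) , a≡ , b≡) , side) →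
        stores writeEntry (((env′ , i≡′ , q′ q≡ , write {f = ω OUTPUT} q≡ wr side) , comp′) , a≡ , cong suc b≡)
      where
      E = position v i j
      position-suc : position v i (suc j) ≡ suc E
      position-suc = trans (cong (c * c * v +_) (+-suc (c * i) j)) (+-suc (c * c * v) (c * i + j))
      q′ : ∀ {q} → q ≡ 1 + 2 * E → 2 + q ≡ 1 + 2 * position v i (suc j)
      q′ refl = cong suc (trans (sym (*-suc 2 E)) (cong (2 *_) (sym position-suc)))
      Selected : Memory → Set
      Selected ω = ColumnInv i j ω × Side v i j (ω xReg 0) (ω yReg 0)
      write : ∀ {q f l h} → q ≡ 1 + 2 * E → Written E f → Side v i j l h →
              Written (position v i (suc j)) (upd (upd f q l) (suc q) h)
      write {f = f} {l} {h} refl wr side = subst (λ z → Written z (upd (upd f (1 + 2 * E) l) (2 + 2 * E) h)) (sym position-suc) (write-entry {E} {f} (λ {v′} {i′} {j′} i′< j′< eq → entry≡ i′< j′< eq side) wr)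
        where
        entry≡ : ∀ {v′ i′ j′ l h} → i′ < c → j′ < c → E ≡ position v′ i′ j′ → Side v i j l h → Side v′ i′ j′ l h
        entry≡ {v′} {i′} {j′} i′< j′< eq side′ with position-injective {v} {v′} i<c j<c i′< j′< eq
        ... | refl , refl , refl = side′
      inv : ColumnInv i j υ
      inv = ((env , i≡ , w) , comp) , refl , refl
      g≡ : υ COL (υ iReg 0) ≡ col v
      g≡ = trans (col≡ _) (cong col i≡)
      select : Run selectEntry υ (duration selectEntry) Selected
      select = branch
        (λ nzi → branch
          (λ nzj → stores anywhere (inv , inj₂ (inj₂ (distance-≢ nzi ∘ trans g≡ , distance-≢ nzj ∘ trans g≡ , refl , n≡))))
          (λ zj → stores (point (load COMP (reg aReg)))
            (inv , inj₂ (inj₁ (distance-≢ nzi ∘ trans g≡ , trans (sym g≡) (distance-≡ zj) , comp i<c , refl)))))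
        (λ zi → stores (point (load COMP (reg bReg))) (inv , inj₁ (trans (sym g≡) (distance-≡ zi) , comp j<c , refl)))

    RowInv : ℕ → Memory → Set
    RowInv i υ = Ready (position v i 0) υ × υ aReg 0 ≡ i

    row : ∀ {i υ} → i < c → RowInv i υ → Run (rowBody c) υ (rowTime c) (RowInv (suc i))
    row {i} {υ} i<c (((env , i≡ , w) , comp) , a≡) = stores-then columnInit
      (for-below c ≤-refl (ColumnInv i) (λ (_ , _ , b≡) → cong (c ∸_) b≡) (λ j<c _ → entry i<c j<c)
        (((env , i≡ , w) , comp) , a≡ , refl)
       then λ {ω} _ (((env′ , i≡′ , q≡ , wr) , comp′) , a≡′ , _) → stores (increment aReg)
         (((env′ , i≡′ , trans q≡ (cong (λ z → 1 + 2 * z) next) , subst (λ z → Written z (ω OUTPUT)) next wr) , comp′) , cong suc a≡′))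
      where
      next : position v i c ≡ position v (suc i) 0
      next = cong (c * c * v +_) (trans (+-comm (c * i) c) (trans (sym (*-suc c i)) (sym (+-identityʳ _))))

  BoxInv : ℕ → Memory → Set
  BoxInv v υ = Env υ × υ iReg 0 ≡ v × WrittenTo (c * c * v) υ

  box-vertex : ∀ {v τ} → v < n → (∀ {a} → a < cnt v → col (out (D * v + a)) < c) → BoxInv v τ →
    Run (boxVertex D c) τ (boxVertexTime D c) (BoxInv (suc v))
  box-vertex {v} {τ} v<n col<c (env , i≡ , w) = stores-then scatterInit
    (for-below c ≤-refl ClearInv (λ (_ , a≡ , _) → cong (c ∸_) a≡) (λ _ _ → clear) ((env , i≡ , w) , refl , λ ())
     then λ _ (at , _ , cleared) → stores-then scatterInit
    (for-below (cnt v) (cnt≤D v<n) ScatterInv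
       (λ {_} {υ} (((_ , _ , cnt≡ , _) , i≡′ , _) , a≡ , _) → cong₂ _∸_ (trans (cong (υ CNT₁) i≡′) (cnt≡ v<n)) a≡)
       (λ a< _ → scatter a<) (at , refl , cleared)
     then λ {ω₁} _ ((env₁ , i≡₁ , q≡₁ , w₁) , _ , comp) → stores-then rowInit
    (for-below c ≤-refl RowInv (λ (_ , a≡) → cong (c ∸_) a≡) (λ i<c _ → row i<c)
       (((env₁ , i≡₁ , trans q≡₁ (cong (λ z → 1 + 2 * z) first) , subst (λ z → Written z (ω₁ OUTPUT)) first w₁) , comp) , refl)
     then λ {ω₂} _ (((env₂ , i≡₂ , q≡₂ , w₂) , _) , _) → stores (increment iReg)
       (env₂ , cong suc i≡₂ , trans q≡₂ (cong (λ z → 1 + 2 * z) last) , subst (λ z → Written z (ω₂ OUTPUT)) last w₂))))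
    where
    open Vertex v v<n col<c
    first : c * c * v ≡ position v 0 0
    first = sym (trans (cong (c * c * v +_) (trans (+-identityʳ _) (*-zeroʳ c))) (+-identityʳ _))
    last : position v c 0 ≡ c * c * suc v
    last = trans (cong (c * c * v +_) (+-identityʳ (c * c))) (trans (+-comm (c * c * v) (c * c)) (sym (*-suc (c * c) v)))

  boxes-run : ∀ {σ} → Env σ → (∀ {v a} → v < n → a < cnt v → col (out (D * v + a)) < c) →
    LinearRun (suc n) (boxTime D c) (writeBoxes D c) σ (λ τ → Written (c * c * n) (τ OUTPUT))
  boxes-run {σ} env col<c = conclude (λ (_ , _ , _ , w) → w)
    (scan-below 1 z<s (n≤1*suc n) BoxInv (λ ((n≡ , _) , i≡ , _) → n≡ , i≡)
      (λ v<n _ → box-vertex v<n (col<c v<n))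
      (env , refl , cong (λ z → 1 + 2 * z) (sym (*-zeroʳ (c * c))) , refl ,
        λ {e} e< → contradiction (subst (e <_) (*-zeroʳ (c * c)) e<) λ ()))

-- Natural numbers among the reals

natℚ : ℕ → ℚ
natℚ m = ℤ.+ m ℚ./ 1

-- The reduced fraction written out: `natℚ m` normalises through a greatest common divisor and is
-- stuck for a variable `m`.
integral : ℕ → ℚ
integral m = ℚ.mkℚ (ℤ.+ m) 0 (Coprimality.sym (Coprimality.1-coprimeTo m))

natℚ≡integral : ∀ m → natℚ m ≡ integral m
natℚ≡integral m = ℚP.fromℚᵘ-toℚᵘ (integral m)

natℚ-mono-≤ : ∀ {a b} → a ≤ b → natℚ a ℚ.≤ natℚ b
natℚ-mono-≤ {a} {b} a≤b rewrite natℚ≡integral a | natℚ≡integral b =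
  ℚ.*≤* (ℤP.*-monoʳ-≤-nonNeg (ℤ.+ 1) (ℤ.+≤+ a≤b))

-- Doubling gives `a * 2 ≤ b * 2 + 1`, and parity does the rest.
natℚ-≤-½ : ∀ {a b} → natℚ a ℚ.≤ natℚ b ℚ.+ ℚ.½ → a ≤ b
natℚ-≤-½ {a} {b} le rewrite natℚ≡integral a | natℚ≡integral b
  with ℚᵘP.≤-respʳ-≃ (ℚP.toℚᵘ-homo-+ (integral b) ℚ.½) (ℚP.toℚᵘ-mono-≤ le)
... | ℚᵘ.*≤* ineq = ≮⇒≥ λ b<a → n≮n (b * 2 + 1)
      (≤-trans (≤-reflexive (double-suc b)) (≤-trans (*-monoˡ-≤ 2 b<a) doubled))
  where
  double-suc : ∀ b → suc (b * 2 + 1) ≡ suc b * 2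
  double-suc b = cong suc (+-comm (b * 2) 1)
  right : (ℤ.+ b ℤ.* ℤ.+ 2 ℤ.+ ℤ.+ 1 ℤ.* ℤ.+ 1) ℤ.* ℤ.+ 1 ≡ ℤ.+ (b * 2 + 1)
  right = trans (ℤP.*-identityʳ _) (cong (ℤ._+ ℤ.+ 1) (sym (ℤP.pos-* b 2)))
  doubled : a * 2 ≤ b * 2 + 1
  doubled = ℤP.drop‿+≤+ (subst₂ ℤ._≤_ (sym (ℤP.pos-* a 2)) right ineq)

≤+positive : ∀ q {η} → 0ℚ ℚ.< η → q ℚ.≤ q ℚ.+ η
≤+positive q {η} 0<η = subst (ℚ._≤ q ℚ.+ η) (ℚP.+-identityʳ q) (ℚP.+-monoʳ-≤ q (ℚP.<⇒≤ 0<η))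

≃ᵣ-refl : ∀ x → x ≃ᵣ x
≃ᵣ-refl x = (λ η 0<η → 0 , λ i _ → ≤+positive (ℝ.seq x i) 0<η) , (λ η 0<η → 0 , λ i _ → ≤+positive (ℝ.seq x i) 0<η)

fromℕ-mono-≤ : ∀ {a b} → a ≤ b → fromℕ a ≤ᵣ fromℕ b
fromℕ-mono-≤ {a} {b} a≤b η 0<η = 0 , λ _ _ →
  ℚP.≤-trans (natℚ-mono-≤ a≤b) (≤+positive (natℚ b) 0<η)

-- Each comparison with `p` is taken with tolerance one quarter, at a common index; the total error
-- of one half is too small to separate integers.
between⇒≤ : ∀ {a b} p → fromℕ a ≤ᵣ p → p ≤ᵣ fromℕ b → a ≤ b
between⇒≤ {a} {b} p a≤p p≤b with a≤p quarter 0<quarter | p≤b quarter 0<quarter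
  where
  quarter = ℤ.+ 1 ℚ./ 4
  0<quarter : 0ℚ ℚ.< quarter
  0<quarter = ℚ.*<* (ℤ.+<+ (s≤s z≤n))
... | N , h | M , g = natℚ-≤-½ (ℚP.≤-trans (h i (m≤m⊔n N M))
        (ℚP.≤-trans (ℚP.+-monoˡ-≤ quarter (g i (m≤n⊔m N M))) (ℚP.≤-reflexive (ℚP.+-assoc (natℚ b) quarter quarter))))
  where
  i = N ⊔ M
  quarter = ℤ.+ 1 ℚ./ 4

-- The augmented graph has bounded treewidth

module AugmentedTree {K : ℕ} (B : BagTree K) (n D : ℕ) (out cnt : ℕ → ℕ)
  (cnt≤D : ∀ {v} → v < n → cnt v ≤ D)
  (bag<n : ∀ {v} i → v ∈ BagTree.bag B i → v < n)
  (out-shares : ∀ {v a} → v < n → a < cnt v → BagTree.Share B v (out (D * v + a))) where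
  open BagTree B

  -- The minimum with `D` bounds the length for every number, while `cnt v ≤ D` is known only for
  -- `v < n`.
  closed : ℕ → List ℕ
  closed v = v ∷ map (λ a → out (D * v + a)) (upTo (D ⊓ cnt v))

  closed⁺ : ∀ {v a} → v < n → a < cnt v → out (D * v + a) ∈ closed v
  closed⁺ {v} v<n a< = there (∈-map⁺ _ (∈-upTo⁺ (⊓-glb (≤-trans a< (cnt≤D v<n)) a<)))

  closed⁻ : ∀ {v x} → x ∈ closed v → x ≡ v ⊎ ∃[ a ] (a < cnt v × x ≡ out (D * v + a))
  closed⁻ (here eq) = inj₁ eq
  closed⁻ {v} (there x∈) with ∈-map⁻ _ x∈
  ... | a , a∈ , eq = inj₂ (a , ≤-trans (∈-upTo⁻ a∈) (m⊓n≤n D (cnt v)) , eq)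

  bag′ : Fin nodes → List ℕ
  bag′ i = concatMap closed (bag i)

  ∈-bag′ : ∀ {v x i} → v ∈ bag i → x ∈ closed v → x ∈ bag′ i
  ∈-bag′ = ∈-concatMap closed

  Walk′ : ℕ → Fin nodes → Fin nodes → Set
  Walk′ x = WalkInside tree (λ l → x ∈ bag′ l)

  lift-walk : ∀ {v x i j} → x ∈ closed v → v ∈ bag i → v ∈ bag j → Walk′ x i j
  lift-walk {v} {x} {i} {j} x∈ v∈i v∈j = Star.map (λ (e , p , q) → e , ∈-bag′ p x∈ , ∈-bag′ q x∈) (subtree v i j v∈i v∈j)

  -- If `x` entered the bag as an out-neighbour of `v`, then `x` and `v` share an original bag, and
  -- the walk to it through bags of `v` stays inside enlarged bags of `x`. Connectivity follows by
  -- going through the homes.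
  home : ∀ {x i} → x ∈ bag′ i → ∃[ h ] (x ∈ bag h × Walk′ x i h × Walk′ x h i)
  home {x} {i} x∈ with ∈-concatMap⁻¹ closed (bag i) x∈
  ... | v , v∈ , x∈v with closed⁻ x∈v
  ...   | inj₁ refl = i , v∈ , ε , ε
  ...   | inj₂ (a , a< , refl) with out-shares (bag<n i v∈) a<
  ...     | h , v∈h , x∈h = h , x∈h , lift-walk x∈v v∈ v∈h , lift-walk x∈v v∈h v∈

  augmentedTree : BagTree (suc D * K)
  augmentedTree = record
    { nodes = nodes ; tree = tree ; isTree = isTree ; bag = bag′
    ; bag≤K = λ i → ≤-trans (length-concatMap-≤ closed closed≤ (bag i)) (*-monoʳ-≤ (suc D) (bag≤K i))
    ; subtree = λ x i j x∈i x∈j →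
        let h , x∈h , to , _ = home x∈i
            h′ , x∈h′ , _ , from = home x∈j
        in to ◅◅ (lift-walk (here refl) x∈h x∈h′ ◅◅ from)
    }
    where
    closed≤ : ∀ v → length (closed v) ≤ suc D
    closed≤ v = s≤s (≤-trans (≤-reflexive (trans (length-map _ (upTo (D ⊓ cnt v))) (length-upTo (D ⊓ cnt v)))) (m⊓n≤m D (cnt v)))

  open BagTree augmentedTree using () renaming (Share to Share′)

  Share′-sym : ∀ {x y} → Share′ x y → Share′ y x
  Share′-sym (i , x∈ , y∈) = i , y∈ , x∈

  near : ∀ {v a} → v < n → a < cnt v → Share′ v (out (D * v + a))
  near v<n a< with out-shares v<n a<
  ... | i , v∈ , _ = i , ∈-bag′ v∈ (here refl) , ∈-bag′ v∈ (closed⁺ v<n a<)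

  siblings : ∀ {v a b} → v < n → a < cnt v → b < cnt v → Share′ (out (D * v + a)) (out (D * v + b))
  siblings v<n a< b< with out-shares v<n a<
  ... | i , v∈ , _ = i , ∈-bag′ v∈ (closed⁺ v<n a<) , ∈-bag′ v∈ (closed⁺ v<n b<)

  -- A bag containing both ends of the first edge is enlarged by the out-neighbours of its head.
  far : ∀ {v a b} → v < n → a < cnt v → b < cnt (out (D * v + a)) → Share′ v (out (D * out (D * v + a) + b))
  far v<n a< b< with out-shares v<n a<
  ... | i , v∈ , x∈ = i , ∈-bag′ v∈ (here refl) , ∈-bag′ x∈ (closed⁺ (bag<n i x∈) b<)

-- The boxes represent the graph

module Representation {n : ℕ} (G : Graph n) (D c : ℕ) (out cnt col rank : ℕ → ℕ)
  (cnt≤D : ∀ {v} → v < n → cnt v ≤ D) (col<c : ∀ {v} → v < n → col v < c)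
  (out<n : ∀ {v a} → v < n → a < cnt v → out (D * v + a) < n)
  (descends : ∀ {v a} → v < n → a < cnt v → rank (out (D * v + a)) < rank v)
  (edge⁺ : ∀ {u v} → Graph.Adj G u v →
     (∃[ a ] (a < cnt (toℕ u) × out (D * toℕ u + a) ≡ toℕ v)) ⊎
     (∃[ a ] (a < cnt (toℕ v) × out (D * toℕ v + a) ≡ toℕ u)))
  (edge⁻ : ∀ {u v a} → a < cnt (toℕ u) → out (D * toℕ u + a) ≡ toℕ v → Graph.Adj G u v)
  (near : ∀ {v a} → v < n → a < cnt v → v ≢ out (D * v + a) → col v ≢ col (out (D * v + a)))
  (siblings : ∀ {v a b} → v < n → a < cnt v → b < cnt v → out (D * v + a) ≢ out (D * v + b) →
     col (out (D * v + a)) ≢ col (out (D * v + b)))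
  (far : ∀ {v a b} → v < n → a < cnt v → b < cnt (out (D * v + a)) → v ≢ out (D * out (D * v + a) + b) →
     col v ≢ col (out (D * out (D * v + a) + b))) where
  open Graph G
  open Boxes n D c out cnt col cnt≤D

  Out : ℕ → ℕ → Set
  Out v x = ∃[ a ] (a < cnt v × out (D * v + a) ≡ x)

  out-differs : ∀ {v a} → v < n → a < cnt v → v ≢ out (D * v + a)
  out-differs v<n a< eq = <-irrefl (cong rank (sym eq)) (descends v<n a<)

  -- Out-neighbours of `u` have pairwise different colours, so `v` is the only candidate of its
  -- colour.
  head-comp : ∀ {u v z} → u < n → Out u v → Comp u (col v) z → z ≡ v
  head-comp u<n (a , a< , refl) (inj₁ (_ , none)) = contradiction refl (none a<)
  head-comp {u} u<n (a , a< , refl) (inj₂ (b , b< , refl , eq)) with out (D * u + b) ≟ out (D * u + a)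
  ... | yes same = same
  ... | no differ = contradiction eq (siblings u<n b< a< differ)

  -- An out-neighbour of `v` with the colour of `u` would end a two-step path from `u`; colours then
  -- force it to be `u`, against the descent of ranks.
  tail-comp : ∀ {u v z} → u < n → Out u v → Comp v (col u) z → z ≡ v
  tail-comp u<n _ (inj₁ (eq , _)) = eq
  tail-comp {u} u<n (a , a< , refl) (inj₂ (b , b< , refl , eq)) = contradiction (sym eq) (far u<n a< b<
    λ same → <-asym (descends u<n a<) (subst (λ z → rank z < rank (out (D * u + a))) (sym same) (descends (out<n u<n a<) b<)))

  adjacent-comps : ∀ {u v l l′} → Adj u v → Comp (toℕ u) (col (toℕ v)) l → Comp (toℕ v) (col (toℕ u)) l′ → l ≡ l′
  adjacent-comps {u} {v} e cu cv with edge⁺ e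
  ... | inj₁ o = trans (head-comp (toℕ<n u) o cu) (sym (tail-comp (toℕ<n u) o cv))
  ... | inj₂ o = trans (tail-comp (toℕ<n v) o cu) (sym (head-comp (toℕ<n v) o cv))

  adjacent-colours : ∀ {u v} → Adj u v → col (toℕ u) ≢ col (toℕ v)
  adjacent-colours {u} {v} e with edge⁺ e
  ... | inj₁ (a , a< , eq) = subst (λ z → col (toℕ u) ≢ col z) eq (near (toℕ<n u) a< (out-differs (toℕ<n u) a<))
  ... | inj₂ (a , a< , eq) = ≢-sym (subst (λ z → col (toℕ v) ≢ col z) eq (near (toℕ<n v) a< (out-differs (toℕ<n v) a<)))

  comp≤n : ∀ {v o z} → v < n → Comp v o z → z ≤ n
  comp≤n v<n (inj₁ (refl , _)) = <⇒≤ v<n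
  comp≤n v<n (inj₂ (a , a< , refl , _)) = <⇒≤ (out<n v<n a<)

  side-≤ : ∀ {v i j l h} → v < n → Side v i j l h → l ≤ h × h ≤ n
  side-≤ v<n (inj₁ (_ , cv , refl)) = ≤-refl , comp≤n v<n cv
  side-≤ v<n (inj₂ (inj₁ (_ , _ , cv , refl))) = ≤-refl , comp≤n v<n cv
  side-≤ v<n (inj₂ (inj₂ (_ , _ , refl , refl))) = z≤n , ≤-refl

  -- If neither vertex spans everything, one has colour `i` and the other `j`, as adjacent vertices
  -- differ in colour, and both sit at the centre of their common star. Exchanging `u` and `v` gives
  -- the other inequality needed for intersection.
  sides-meet : ∀ {u v i j l h l′ h′} → Adj u v → Side (toℕ u) i j l h → Side (toℕ v) i j l′ h′ → l ≤ h′
  sides-meet e (inj₂ (inj₂ (_ , _ , refl , _))) _ = z≤n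
  sides-meet {u} e su@(inj₁ _) (inj₂ (inj₂ (_ , _ , _ , refl))) = ≤-trans (proj₁ su≤) (proj₂ su≤)
    where su≤ = side-≤ (toℕ<n u) su
  sides-meet {u} e su@(inj₂ (inj₁ _)) (inj₂ (inj₂ (_ , _ , _ , refl))) = ≤-trans (proj₁ su≤) (proj₂ su≤)
    where su≤ = side-≤ (toℕ<n u) su
  sides-meet {u} {v} e (inj₁ (cu , _)) (inj₁ (cv , _)) = contradiction (trans cu (sym cv)) (adjacent-colours {u} {v} e)
  sides-meet {u} {v} e (inj₂ (inj₁ (_ , cu , _))) (inj₂ (inj₁ (_ , cv , _))) = contradiction (trans cu (sym cv)) (adjacent-colours {u} {v} e)
  sides-meet {u} {v} e (inj₁ (refl , cu , _)) (inj₂ (inj₁ (_ , refl , cv , refl))) = ≤-reflexive (adjacent-comps {u} {v} e cu cv)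
  sides-meet {u} {v} e (inj₂ (inj₁ (_ , refl , cu , _))) (inj₁ (refl , cv , refl)) = ≤-reflexive (adjacent-comps {u} {v} e cu cv)

  Adj-sym : ∀ {u v} → Adj u v → Adj v u
  Adj-sym {u} {v} = subst T (edge-sym u v)

  -- If `z` is one of the two, it is an out-neighbour of the other. It cannot be an out-neighbour of
  -- both: it would have the colour of `v`.
  meet⇒adjacent : ∀ {u v z} → u ≢ v → Comp (toℕ u) (col (toℕ v)) z → Comp (toℕ v) (col (toℕ u)) z → Adj u v
  meet⇒adjacent u≢v (inj₁ (refl , _)) (inj₁ (eq , _)) = contradiction (toℕ-injective eq) u≢v
  meet⇒adjacent {u} {v} u≢v (inj₁ (refl , _)) (inj₂ (a , a< , eq , _)) = Adj-sym {v} {u} (edge⁻ a< (sym eq))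
  meet⇒adjacent u≢v (inj₂ (a , a< , eq , _)) (inj₁ (refl , _)) = edge⁻ a< (sym eq)
  meet⇒adjacent {v = v} u≢v (inj₂ (_ , _ , _ , colz)) (inj₂ (a , a< , refl , _)) =
    contradiction (sym colz) (near (toℕ<n v) a< (out-differs (toℕ<n v) a<))

  own-side : ∀ {u j l h} → Side u (col u) j l h → Comp u j l × h ≡ l
  own-side (inj₁ (_ , cu , eq)) = cu , eq
  own-side (inj₂ (inj₁ (ne , _))) = contradiction refl ne
  own-side (inj₂ (inj₂ (ne , _))) = contradiction refl ne

  other-side : ∀ {v i l h} → Side v i (col v) l h → Comp v i l × h ≡ l
  other-side (inj₁ (refl , cv , eq)) = cv , eq
  other-side (inj₂ (inj₁ (_ , _ , cv , eq))) = cv , eq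
  other-side (inj₂ (inj₂ (_ , ne , _))) = contradiction refl ne

  module _ (f : ℕ → ℕ) (written : Written (c * c * n) f) where

    index : Fin n → Fin (c * c) → ℕ
    index v t = 2 * (toℕ v * (c * c) + toℕ t)

    low high : Fin n → Fin (c * c) → ℕ
    low v t = f (1 + index v t)
    high v t = f (2 + index v t)

    side : ∀ v i j → Side (toℕ v) (toℕ i) (toℕ j) (low v (Fin.combine i j)) (high v (Fin.combine i j))
    side v i j = proj₂ written (≤-trans (≤-reflexive (cong suc e≡)) (slot-< {c * c} (toℕ<n v) (slot-< {c} (toℕ<n i) (toℕ<n j))))
      (toℕ<n i) (toℕ<n j) e≡
      where
      e≡ : toℕ v * (c * c) + toℕ (Fin.combine i j) ≡ position (toℕ v) (toℕ i) (toℕ j)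
      e≡ = cong₂ _+_ (*-comm (toℕ v) (c * c)) (toℕ-combine i j)

    low≤high : ∀ v t → low v t ≤ high v t
    low≤high v t with combine-surjective {c} t
    ... | i , j , refl = proj₁ (side-≤ (toℕ<n v) (side v i j))

    boxOf : Fin n → Box (c * c)
    boxOf v t = record { lo = fromℕ (low v t) ; hi = fromℕ (high v t) ; lo≤hi = fromℕ-mono-≤ (low≤high v t) }

    intersect⁺ : ∀ u v → Adj u v → Intersect (boxOf u) (boxOf v)
    -- In each coordinate the larger left endpoint lies in both intervals.
    intersect⁺ u v e = (λ t → fromℕ (low u t ⊔ low v t)) ,
      (λ t → fromℕ-mono-≤ (m≤m⊔n (low u t) (low v t)) , fromℕ-mono-≤ (⊔-lub (low≤high u t) (crossing (Adj-sym {u} {v} e) t))) ,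
      (λ t → fromℕ-mono-≤ (m≤n⊔m (low u t) (low v t)) , fromℕ-mono-≤ (⊔-lub (crossing e t) (low≤high v t)))
      where
      crossing : ∀ {u v} → Adj u v → ∀ t → low u t ≤ high v t
      crossing {u} {v} e t with combine-surjective {c} t
      ... | i , j , refl = sides-meet {u} {v} e (side u i j) (side v i j)

    intersect⁻ : ∀ u v → u ≢ v → Intersect (boxOf u) (boxOf v) → Adj u v
    intersect⁻ u v u≢v (p , p∈u , p∈v) = meet⇒adjacent u≢v compᵤ (subst (Comp (toℕ v) (col (toℕ u))) l≡ compᵥ)
      where
      -- One dimension decides: in the one given by the two colours both boxes degenerate to points,
      -- which must coincide.
      i j : Fin c
      i = Fin.fromℕ< (col<c (toℕ<n u))
      j = Fin.fromℕ< (col<c (toℕ<n v))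
      i≡ : toℕ i ≡ col (toℕ u)
      i≡ = toℕ-fromℕ< (col<c (toℕ<n u))
      j≡ : toℕ j ≡ col (toℕ v)
      j≡ = toℕ-fromℕ< (col<c (toℕ<n v))
      t = Fin.combine i j
      sideᵤ : Comp (toℕ u) (col (toℕ v)) (low u t) × high u t ≡ low u t
      sideᵤ = own-side (subst₂ (λ x y → Side (toℕ u) x y (low u t) (high u t)) i≡ j≡ (side u i j))
      sideᵥ : Comp (toℕ v) (col (toℕ u)) (low v t) × high v t ≡ low v t
      sideᵥ = other-side (subst₂ (λ x y → Side (toℕ v) x y (low v t) (high v t)) i≡ j≡ (side v i j))
      compᵤ = proj₁ sideᵤ
      compᵥ = proj₁ sideᵥ
      l≡ : low v t ≡ low u t
      l≡ = ≤-antisym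
        (≤-trans (between⇒≤ (p t) (proj₁ (p∈v t)) (proj₂ (p∈u t))) (≤-reflexive (proj₂ sideᵤ)))
        (≤-trans (between⇒≤ (p t) (proj₁ (p∈u t)) (proj₂ (p∈v t))) (≤-reflexive (proj₂ sideᵥ)))

    representation : BoxRepresentation G (c * c)
    representation = record
      { box = boxOf
      ; adjacent = λ u v u≢v → mk⇔ (intersect⁺ u v) (intersect⁻ u v u≢v)
      }

-- The algorithm

module Algorithm (k : ℤ) where

  -- `K₁` bounds the bags, `D₁` the out-degrees of the graph, `K₂` the enlarged bags and `D₂` the
  -- out-degrees of the augmented graph; greedy colouring takes one colour more.
  K₁ D₁ K₂ D₂ colours : ℕ
  K₁ = suc ℤ.∣ k ∣
  D₁ = 4 * K₁
  K₂ = suc D₁ * K₁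
  D₂ = 4 * K₂
  colours = suc D₂

  colourAndBox boxProgram program : Program
  colourAndBox = peel D₂ ⨟ colour D₂ ⨟ writeBoxes D₁ colours
  boxProgram = copyOut D₁ ⨟ augment D₁ ⨟ colourAndBox
  program = readInput ⨟ peel D₁ ⨟ boxProgram

  colourAndBoxTime boxProgramTime programTime : ℕ
  colourAndBoxTime = peelTime K₂ + (colourTime D₂ + boxTime D₁ colours)
  boxProgramTime = copyTime D₁ + (augmentTime D₁ + colourAndBoxTime)
  programTime = readTime K₁ + (peelTime K₁ + boxProgramTime)

  Zero : ℕ → Memory → Set
  Zero a σ = ∀ i → σ a i ≡ 0

  module OnGraph {n : ℕ} (G : Graph n) (TD : TreeDecomposition G) (width≤k : TreeDecomposition.width TD ℤ.≤ k)
    (L : AdjacencyLists G) where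
    open Graph G
    open FromDecomposition TD width≤k
    open Reading L
    open BagTree bagTree using (Share)

    Result : Memory → Set
    Result τ = Σ (BoxRepresentation G (colours * colours)) (Outputs τ)

    inputCells-share : ∀ {x y} → (x , y) ∈ inputCells → Share x y
    inputCells-share p with inputCells⁻ p
    ... | u , v , refl , refl , e = edge-shares e

    sparse : ∀ S {C} → Unique C → (∀ {x y} → (x , y) ∈ C → (x , y) ∈ inputCells × x ∈ S × y ∈ S) →
             length C ≤ 2 * K₁ * length S
    sparse S uniq inside = Ownership.share-sparse bagTree S uniq λ p →
      let p∈ , x∈ , y∈ = inside p in x∈ , y∈ , inputCells-share p∈

    bag<n : ∀ {v} i → v ∈ BagTree.bag bagTree i → v < n
    bag<n i v∈ with ∈-elements⁻ (TreeDecomposition.bag TD i) v∈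
    ... | u , refl , _ = toℕ<n u

    module Peel₁ = PeelingRun n K₁ inputCells inputCells<n sparse

    module AfterPeel (σ₁ : Memory) (peeled : Peel₁.PeeledOf σ₁) where
      open Peeling n D₁ inputCells inputCells<n using (module Oriented)
      open Oriented (Peel₁.Peeled.oriented peeled)

      out cnt rank : ℕ → ℕ
      out = σ₁ OUT
      cnt = σ₁ CNT
      rank = σ₁ RANK

      out<n : ∀ {v a} → v < n → a < cnt v → out (D₁ * v + a) < n
      out<n v<n a< = proj₂ (inputCells<n (proj₁ (sound v<n a<)))

      open AugmentedTree bagTree n D₁ out cnt cnt≤D bag<n (λ v<n a< → inputCells-share (proj₁ (sound v<n a<)))
      open BagTree augmentedTree using () renaming (Share to Share′)
      open Augment n D₁ out cnt cnt≤D out<n Share′ Share′-sym near siblings far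

      module AfterAugment (σ₂ : Memory) (C : List Cell) (emitted : EmittedOf σ₂ C)
        (complete₂ : ∀ {p} → Augmented n p → p ∈ C) where

        C<n : ∀ {u w} → (u , w) ∈ C → u < n × w < n
        C<n p = let u<n , w<n , _ = Emitted.sound emitted p in u<n , w<n

        sparse₂ : ∀ S {C′} → Unique C′ → (∀ {x y} → (x , y) ∈ C′ → (x , y) ∈ C × x ∈ S × y ∈ S) →
                  length C′ ≤ 2 * K₂ * length S
        sparse₂ S uniq inside = Ownership.share-sparse augmentedTree S uniq λ p →
          let p∈ , x∈ , y∈ = inside p in x∈ , y∈ , proj₂ (proj₂ (Emitted.sound emitted p∈))

        module Peel₂ = PeelingRun n K₂ C C<n sparse₂

        module AfterColour (col : ℕ → ℕ) (col≤ : ∀ {v} → v < n → col v ≤ D₂)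
          (proper : ∀ {u w} → (u , w) ∈ C → (w , u) ∈ C → u ≢ w → col u ≢ col w) where

          -- Peeling treated both cells of the edge. A cell without a slot was left to its reverse
          -- because the latter starts at the higher rank, which is impossible in both directions.
          edge⁺ : ∀ {u v} → Adj u v →
            (∃[ a ] (a < cnt (toℕ u) × out (D₁ * toℕ u + a) ≡ toℕ v)) ⊎ (∃[ a ] (a < cnt (toℕ v) × out (D₁ * toℕ v + a) ≡ toℕ u))
          edge⁺ {u} {v} e with complete (inputCells⁺ e) | complete (inputCells⁺ {v} {u} (subst T (edge-sym u v) e))

          ... | inj₂ (inj₂ (inj₂ o)) | _ = inj₁ o
          ... | _ | inj₂ (inj₂ (inj₂ o)) = inj₂ o
          ... | inj₂ (inj₁ eq) | _ = ⊥-elim (subst T (edge-irrefl v) (subst (λ z → Adj z v) (toℕ-injective eq) e))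
          ... | _ | inj₂ (inj₁ eq) = ⊥-elim (subst T (edge-irrefl v) (subst (λ z → Adj z v) (toℕ-injective (sym eq)) e))
          ... | inj₂ (inj₂ (inj₁ lt)) | inj₂ (inj₂ (inj₁ gt)) = contradiction gt (<-asym lt)

          edge⁻ : ∀ {u v a} → a < cnt (toℕ u) → out (D₁ * toℕ u + a) ≡ toℕ v → Adj u v
          edge⁻ {u} {v} a< eq with inputCells⁻ (proj₁ (sound (toℕ<n u) a<))
          ... | u′ , v′ , u≡ , v≡ , e with toℕ-injective u≡ | toℕ-injective (trans v≡ eq)
          ...   | refl | refl = e

          open Representation G D₁ colours out cnt col rank cnt≤D (s≤s ∘ col≤) out<n
            (λ v<n a< → proj₂ (sound v<n a<)) edge⁺ edge⁻
            (λ {v} {a} v<n a< → proper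
              (complete₂ (v , v<n , a , a< , inj₁ (inj₁ refl))) (complete₂ (v , v<n , a , a< , inj₁ (inj₂ refl))))
            (λ {v} {a} {b} v<n a< b< → proper
              (complete₂ (v , v<n , a , a< , inj₂ (inj₁ (b , b< , inj₁ refl))))
              (complete₂ (v , v<n , a , a< , inj₂ (inj₁ (b , b< , inj₂ refl)))))
            (λ {v} {a} {b} v<n a< b< → proper
              (complete₂ (v , v<n , a , a< , inj₂ (inj₂ (b , b< , inj₁ refl))))
              (complete₂ (v , v<n , a , a< , inj₂ (inj₂ (b , b< , inj₂ refl))))) public
          open Boxes n D₁ colours out cnt col cnt≤D public

          box-run : ∀ {σ} → Env σ → LinearRun (suc n) (boxTime D₁ colours) (writeBoxes D₁ colours) σ Result
          box-run env = conclude
            (λ {τ} w → representation (τ OUTPUT) w , proj₁ w , λ v i →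
              ≃ᵣ-refl (lo (boxOf (τ OUTPUT) w v i)) , ≃ᵣ-refl (hi (boxOf (τ OUTPUT) w v i)))
            (boxes-run env λ v<n a< → s≤s (col≤ (out<n v<n a<)))

        colour-and-box-run : Zero USED σ₂ → LinearRun (suc n) colourAndBoxTime colourAndBox σ₂ Result
        colour-and-box-run unused =
          Peel₂.peel-run n≡ m≡ cells unique thenˡ λ fr₃ peeled₂ →
          Colouring.colour-run n D₂ C C<n (trans (fr₃ nReg refl 0) n≡)
            (Peel₂.Peeled.ranked peeled₂) (Peel₂.Peeled.oriented peeled₂)
            (λ i → trans (fr₃ USED refl i) (unused i)) thenˡ λ {σ₄} fr₄ (col≤ , proper) →
          AfterColour.box-run (σ₄ COL) col≤ proper
            ( trans (fr₄ nReg refl 0) (trans (fr₃ nReg refl 0) n≡)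
            , (λ _ → refl)
            , (λ {x} x<n → trans (fr₄ CNT₁ refl x) (trans (fr₃ CNT₁ refl x) (cnt≡ x<n)))
            , (λ x<n a< → trans (fr₄ OUT₁ refl _) (trans (fr₃ OUT₁ refl _) (out≡ x<n a<))))
          where open Emitted emitted

      box-program-run : σ₁ nReg 0 ≡ n → Zero MARK σ₁ → Zero USED σ₁ →
        LinearRun (suc n) boxProgramTime boxProgram σ₁ Result
      box-program-run n≡ unmarked unused =
        copy-run n D₁ n≡ thenˡ λ fr (copied , copied-out) →
        augment-run (trans (fr nReg refl 0) n≡) (λ i → trans (fr MARK refl i) (unmarked i)) copied copied-out
          thenˡ λ {σ₂} fr′ (C , emitted , complete₂) →
        AfterAugment.colour-and-box-run σ₂ C emitted complete₂
          (λ i → trans (fr′ USED refl i) (trans (fr USED refl i) (unused i)))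

    program-run : LinearRun (suc n) programTime program (initial (encode L)) Result
    program-run =
      read-run K₁ (≤-trans (sparse (upTo n) inputCells-unique all-inside) (≤-reflexive (cong (2 * K₁ *_) (length-upTo n))))
        thenˡ λ fr (n≡ , m≡ , cells) →
      Peel₁.peel-run n≡ m≡ cells inputCells-unique thenˡ λ {σ₁} fr′ peeled →
      AfterPeel.box-program-run σ₁ peeled (trans (fr′ nReg refl 0) n≡)
        (λ i → trans (fr′ MARK refl i) (fr MARK refl i)) (λ i → trans (fr′ USED refl i) (fr USED refl i))
      where
      all-inside : ∀ {x y} → (x , y) ∈ inputCells → (x , y) ∈ inputCells × x ∈ upTo n × y ∈ upTo n
      all-inside p = p , ∈-upTo⁺ (proj₁ (inputCells<n p)) , ∈-upTo⁺ (proj₂ (inputCells<n p))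

-- Linear running time and the result

affine∈O : ∀ c → (λ n → suc n * c) ∈O (λ n → n)
affine∈O c = 2 * c , 1 , λ n 1≤n → begin
  suc n * c       ≤⟨ *-monoˡ-≤ c (+-monoˡ-≤ n 1≤n) ⟩
  (n + n) * c     ≡⟨ cong (λ z → (n + z) * c) (sym (+-identityʳ n)) ⟩
  2 * n * c       ≡⟨ trans (*-assoc 2 n c) (cong (2 *_) (*-comm n c)) ⟩
  2 * (c * n)     ≡⟨ *-assoc 2 c n ⟨
  2 * c * n       ∎
  where open ≤-Reasoning

theorem19 : (k : ℤ) →
    Σ[ d ∈ ℕ ] Σ[ P ∈ Program ] Σ[ f ∈ (ℕ → ℕ) ]
    ((f ∈O (λ n → n)) ×
    (∀ (n : ℕ) (G : Graph n) → tw[ G ]≤ k → (L : AdjacencyLists G) →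
    ∃[ t ] ∃[ σ ]
    (⟨ P , initial (encode L) ⟩⇓[ t ] σ ×
    t ≤ f n ×
    ∃[ b ] (b ≤ d × Σ (BoxRepresentation G b) (Outputs σ)))))
-- Every output has the same dimension, one coordinate per ordered pair of colours. The
-- decomposition attaining the treewidth has width at most `k` and is handed to the analysis.
theorem19 k = colours * colours , program , (λ n → suc n * programTime) , affine∈O programTime ,
  λ n G (t , ((T , width≡t) , _) , t≤k) L →
    let run d time≤ result = LinearRun.steps (OnGraph.program-run G T (subst (ℤ._≤ k) (sym width≡t) t≤k) L)
    in _ , _ , d , time≤ , colours * colours , ≤-refl , result
  where open Algorithm k
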